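{- Let $W$ be an irreducible $T$-module with endpoint $r$ and diameter $d=D-2r$. Then the following hold for $0\le i,j\le d$ and nonzero vectors $u\in E_rW$, $u^*\in E^*_rW$, $u^{\varepsilon}\in E^{\varepsilon}_rW$. (i) $$\langle E_{r+i}u^*,E^{\varepsilon}_{r+j}u^*\rangle=\mathbf{i}^{ -i-j}(2-2\mathbf{i})^{ -d}\|u^*\|^2\binom{d}{i}\binom{d}{j}\;{}_2F_1\Big({ -i,-j\atop -d};2\Big).$$ (ii) $$\langle E^*_{r+i}u^{\varepsilon},E_{r+j}u^{\varepsilon}\rangle=\mathbf{i}^{ -i-j}(2-2\mathbf{i})^{ -d}\|u^{\varepsilon}\|^2\binom{d}{i}\binom{d}{j}\;{}_2F_1\Big({ -i,-j\atop -d};2\Big).$$ (iii) $$\langle E^{\varepsilon}_{r+i}u,E^*_{r+j}u\rangle=\mathbf{i}^{ -i-j}(2-2\mathbf{i})^{ -d}\|u\|^2\binom{d}{i}\binom{d}{j}\;{}_2F_1\Big({ -i,-j\atop -d};2\Big).$$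
   Context: Let $D$ be a positive integer and let $Q_D$ be the $D$-cube: the graph with vertex set $X=\{0,1\}^D$, two vertices being adjacent iff they differ in exactly one coordinate; $\partial$ denotes path-length distance. $\mathrm{Mat}_X(\mathbb{C})$ is the algebra of complex matrices with rows and columns indexed by $X$, acting on $V=\mathbb{C}^X$ (column vectors) by left multiplication. $V$ carries the Hermitian inner product $\langle v,w\rangle=v^t\overline{w}$ (linear in the first argument), with $\|v\|^2=\langle v,v\rangle$. Write $\mathbf{i}^2=-1$ (the bold $\mathbf{i}$ is the imaginary unit; the plain $i$ is an index). Let $A$ be the adjacency matrix of $Q_D$. Fix $x=(0,0,\ldots,0)\in X$. Let $A^*$ be the diagonal matrix in $\mathrm{Mat}_X(\mathbb{C})$ with $(y,y)$-entry $D-2\partial(x,y)$ for $y\in X$, and let $A^{\varepsilon}=-\mathbf{i}(AA^*-A^*A)/2$. Let $T$ be the subalgebra of $\mathrm{Mat}_X(\mathbb{C})$ generated by $A$ and $A^*$. The eigenvalues of $A$ are $\theta_i=D-2i$ $(0\le i\le D)$. For $0\le i\le D$: $E_i=\prod_{0\le j\le D,\,j\ne i}\frac{A-\theta_jI}{\theta_i-\theta_j}$ is the primitive idempotent of $A$ for $\theta_i$ (the orthogonal projection onto the $\theta_i$-eigenspace of $A$); $E_i^*$ is the diagonal matrix with $(y,y)$-entry $1$ if $\partial(x,y)=i$ and $0$ otherwise; and $E_i^{\varepsilon}=P^{ -1}E_iP$, where $P=P_1^{\otimes D}$ (Kronecker power, $P_{yz}=\prod_{k=1}^D(P_1)_{y_kz_k}$,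 invertible) with $P_1=\begin{pmatrix}1&1\\-\mathbf{i}&\mathbf{i}\end{pmatrix}$, rows and columns indexed by $0,1$ in that order. ($E_i^*$ and $E_i^{\varepsilon}$ are the primitive idempotents of $A^*$ and $A^{\varepsilon}$ for the eigenvalue $D-2i$.) A $T$-module is a subspace $W\subseteq V$ with $BW\subseteq W$ for all $B\in T$; it is irreducible if $W\ne0$ and it contains no $T$-modules other than $0$ and $W$. The endpoint of an irreducible $T$-module $W$ is $r=\min\{i\mid 0\le i\le D,\ E_i^*W\neq0\}$ (it is known that also $r=\min\{i\mid E_iW\ne0\}$), and its diameter is $d=|\{i\mid 0\le i\le D,\ E_i^*W\ne0\}|-1$; it is known that $d=D-2r$ and $0\le r\le D/2$. For $a\in\mathbb{C}$ and an integer $n\ge0$, $(a)_n=a(a+1)\cdots(a+n-1)$ with $(a)_0=1$. For integers $0\le i,j\le d$, ${}_2F_1\big({ -i,-j\atop -d};2\big)=\sum_{n=0}^d\frac{(-i)_n(-j)_n}{(-d)_n\,n!}2^n$. -}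

module Defs where

open import Algebra.Bundles using (CommutativeRing)
open import Data.Bool.Base using (if_then_else_; true; false)
open import Data.Fin.Base using (Fin; toℕ; zero; suc)
import Data.Fin.Properties as Fin
open import Data.Fin.Patterns using (0F; 1F)
open import Data.Fin.Subset using (Subset; _∈_; ∣_∣)
open import Data.Integer.Base as ℤ using (ℤ; +_)
open import Data.List.Base using (List; foldr; map; filter; upTo)
open import Data.Nat.Base as ℕ using (ℕ; _≤_; _⊔_; _!; z≤n; s≤s)
import Data.Nat.Properties as ℕ
open import Data.Product.Base using (Σ; ∃; _×_; _,_; proj₁; proj₂)
open import Data.Rational.Base as ℚ using (ℚ; 0ℚ; 1ℚ; ½)
import Data.Rational.Properties as ℚ
open import Data.Rational.Solver using (module +-*-Solver)
open import Data.Vec.Base using (Vec; []; _∷_; replicate)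
import Data.Vec.Properties as Vec
open import Function.Base using (_∘_)
open import Function.Bundles using (_⇔_)
open import Level using (0ℓ)
open import Relation.Binary.PropositionalEquality
  using (_≡_; _≢_; refl; sym; trans; cong; cong₂; subst; subst₂)
open import Relation.Nullary using (¬_; Dec; yes; no; does; ¬?)

open +-*-Solver using (solve; _:=_; _:+_; _:*_; _:-_; :-_; con)

-- f m n tends to 0 as m and n tend to infinity independently.
Null : (ℕ → ℕ → ℚ) → Set
Null f = ∀ ε → 0ℚ ℚ.< ε →
  ∃ λ N → ∀ m n → N ≤ m → N ≤ n → ℚ.∣ f m n ∣ ℚ.< ε

-- Cauchy reals: without quotients, equality is the relation _≈ℝ_.  Eta is off so
-- that arithmetic expressions are not unfolded into their Cauchy proofs.
record ℝ : Set where
  no-eta-equality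
  field
    seq    : ℕ → ℚ
    cauchy : Null (λ m n → seq m ℚ.- seq n)

open ℝ public

infix 4 _≈ℝ_

record _≈ℝ_ (x y : ℝ) : Set where
  constructor mk≈
  field
    limit : ∀ ε → 0ℚ ℚ.< ε →
      ∃ λ N → ∀ n → N ≤ n → ℚ.∣ seq x n ℚ.- seq y n ∣ ℚ.< ε

half-pos : ∀ {ε} → 0ℚ ℚ.< ε → 0ℚ ℚ.< ½ ℚ.* ε
half-pos {ε} 0<ε = subst (ℚ._< ½ ℚ.* ε) (ℚ.*-zeroʳ ½) (ℚ.*-monoʳ-<-pos ½ 0<ε)

halves : ∀ ε → ½ ℚ.* ε ℚ.+ ½ ℚ.* ε ≡ ε
halves = solve 1 (λ e → con ½ :* e :+ con ½ :* e := e) refl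

null-cong : ∀ {f g} → (∀ m n → f m n ≡ g m n) → Null f → Null g
null-cong f≡g p ε 0<ε with N , h ← p ε 0<ε =
  N , λ m n N≤m N≤n → subst (λ t → ℚ.∣ t ∣ ℚ.< ε) (f≡g m n) (h m n N≤m N≤n)

null-0 : Null (λ _ _ → 0ℚ)
null-0 ε 0<ε = 0 , λ _ _ _ _ → 0<ε

null-+ : ∀ {f g} → Null f → Null g → Null (λ m n → f m n ℚ.+ g m n)
null-+ {f} {g} p q ε 0<ε
  with N , h ← p (½ ℚ.* ε) (half-pos 0<ε) | M , k ← q (½ ℚ.* ε) (half-pos 0<ε) =
  N ⊔ M , λ m n m≥ n≥ → ℚ.≤-<-trans (ℚ.∣p+q∣≤∣p∣+∣q∣ (f m n) (g m n))
    (subst (ℚ.∣ f m n ∣ ℚ.+ ℚ.∣ g m n ∣ ℚ.<_) (halves ε)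
      (ℚ.+-mono-<
        (h m n (ℕ.≤-trans (ℕ.m≤m⊔n N M) m≥) (ℕ.≤-trans (ℕ.m≤m⊔n N M) n≥))
        (k m n (ℕ.≤-trans (ℕ.m≤n⊔m N M) m≥) (ℕ.≤-trans (ℕ.m≤n⊔m N M) n≥))))

null-neg : ∀ {f} → Null f → Null (λ m n → ℚ.- f m n)
null-neg {f} p ε 0<ε with N , h ← p ε 0<ε =
  N , λ m n m≥ n≥ → subst (ℚ._< ε) (sym (ℚ.∣-p∣≡∣p∣ (f m n))) (h m n m≥ n≥)

Bounded : (ℕ → ℕ → ℚ) → Set
Bounded b = ∃ λ B → 0ℚ ℚ.< B ×
  ∃ λ N → ∀ m n → N ≤ m → N ≤ n → ℚ.∣ b m n ∣ ℚ.≤ B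

null-* : ∀ {b f} → Bounded b → Null f → Null (λ m n → b m n ℚ.* f m n)
null-* {b} {f} (B , 0<B , M , k) p ε 0<ε = M ⊔ N , bound
  where
  instance
    B-pos : ℚ.Positive B
    B-pos = ℚ.positive 0<B
    B-nonNeg : ℚ.NonNegative B
    B-nonNeg = ℚ.pos⇒nonNeg B
    B-nonZero : ℚ.NonZero B
    B-nonZero = ℚ.pos⇒nonZero B
  δ : ℚ
  δ = (ℚ.1/ B) ℚ.* ε
  0<δ : 0ℚ ℚ.< δ
  0<δ = subst (ℚ._< δ) (ℚ.*-zeroʳ (ℚ.1/ B))
    (ℚ.*-monoʳ-<-pos (ℚ.1/ B) {{ℚ.1/pos⇒pos B}} 0<ε)
  Bδ : B ℚ.* δ ≡ ε
  Bδ = trans (sym (ℚ.*-assoc B (ℚ.1/ B) ε))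
         (trans (cong (ℚ._* ε) (ℚ.*-inverseʳ B)) (ℚ.*-identityˡ ε))
  N = proj₁ (p δ 0<δ)
  bound : ∀ m n → M ⊔ N ≤ m → M ⊔ N ≤ n → ℚ.∣ b m n ℚ.* f m n ∣ ℚ.< ε
  bound m n m≥ n≥ = subst₂ ℚ._<_ (sym (ℚ.∣p*q∣≡∣p∣*∣q∣ (b m n) (f m n))) Bδ
    (ℚ.≤-<-trans
      (ℚ.*-monoʳ-≤-nonNeg ℚ.∣ f m n ∣ {{ℚ.nonNegative (ℚ.0≤∣p∣ (f m n))}}
        (k m n (ℕ.≤-trans (ℕ.m≤m⊔n M N) m≥) (ℕ.≤-trans (ℕ.m≤m⊔n M N) n≥)))
      (ℚ.*-monoʳ-<-pos B (proj₂ (p δ 0<δ) m n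
        (ℕ.≤-trans (ℕ.m≤n⊔m M N) m≥) (ℕ.≤-trans (ℕ.m≤n⊔m M N) n≥))))

seq-bound : ∀ x → ∃ λ B → 0ℚ ℚ.< B × ∃ λ N → ∀ m → N ≤ m → ℚ.∣ seq x m ∣ ℚ.≤ B
seq-bound x = B , 0<B , N , bound
  where
  0<1 : 0ℚ ℚ.< 1ℚ
  0<1 = ℚ.positive⁻¹ 1ℚ
  N = proj₁ (cauchy x 1ℚ 0<1)
  B = 1ℚ ℚ.+ ℚ.∣ seq x N ∣
  0<B : 0ℚ ℚ.< B
  0<B = ℚ.+-mono-<-≤ 0<1 (ℚ.0≤∣p∣ (seq x N))
  split : ∀ a b → (a ℚ.- b) ℚ.+ b ≡ a
  split = solve 2 (λ a b → (a :- b) :+ b := a) refl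
  bound : ∀ m → N ≤ m → ℚ.∣ seq x m ∣ ℚ.≤ B
  bound m m≥ = subst (λ t → ℚ.∣ t ∣ ℚ.≤ B) (split (seq x m) (seq x N))
    (ℚ.≤-trans (ℚ.∣p+q∣≤∣p∣+∣q∣ (seq x m ℚ.- seq x N) (seq x N))
      (ℚ.+-monoˡ-≤ ℚ.∣ seq x N ∣
        (ℚ.<⇒≤ (proj₂ (cauchy x 1ℚ 0<1) m N m≥ ℕ.≤-refl))))

boundedˡ : ∀ x → Bounded (λ m n → seq x m)
boundedˡ x = let B , 0<B , N , h = seq-bound x in B , 0<B , N , λ m n m≥ n≥ → h m m≥

boundedʳ : ∀ x → Bounded (λ m n → seq x n)
boundedʳ x = let B , 0<B , N , h = seq-bound x in B , 0<B , N , λ m n m≥ n≥ → h n n≥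

fromNull : ∀ {x y} → Null (λ m _ → seq x m ℚ.- seq y m) → x ≈ℝ y
fromNull p = mk≈ λ ε 0<ε → let N , h = p ε 0<ε in N , λ n n≥ → h n n n≥ n≥

toNull : ∀ {x y} → x ≈ℝ y → Null (λ m _ → seq x m ℚ.- seq y m)
toNull (mk≈ p) ε 0<ε = let N , h = p ε 0<ε in N , λ m _ m≥ _ → h m m≥

pointwise : ∀ {x y} → (∀ n → seq x n ≡ seq y n) → x ≈ℝ y
pointwise {x} {y} x≡y = fromNull (null-cong
  (λ m _ → trans (sym (ℚ.+-inverseʳ (seq y m))) (cong (ℚ._- seq y m) (sym (x≡y m))))
  null-0)

fromℚ : ℚ → ℝ
fromℚ q .seq _  = q
fromℚ q .cauchy = null-cong (λ _ _ → sym (ℚ.+-inverseʳ q)) null-0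

infixl 6 _+ℝ_ _-ℝ_
infixl 7 _*ℝ_
infix  8 -ℝ_

_+ℝ_ : ℝ → ℝ → ℝ
(x +ℝ y) .seq n  = seq x n ℚ.+ seq y n
(x +ℝ y) .cauchy = null-cong (λ m n → eq (seq x m) (seq x n) (seq y m) (seq y n))
  (null-+ (cauchy x) (cauchy y))
  where
  eq : ∀ a b c d → (a ℚ.- b) ℚ.+ (c ℚ.- d) ≡ (a ℚ.+ c) ℚ.- (b ℚ.+ d)
  eq = solve 4 (λ a b c d → (a :- b) :+ (c :- d) := (a :+ c) :- (b :+ d)) refl

-ℝ_ : ℝ → ℝ
(-ℝ x) .seq n  = ℚ.- seq x n
(-ℝ x) .cauchy =
  null-cong (λ m n → ℚ.neg-distrib-+ (seq x m) (ℚ.- seq x n)) (null-neg (cauchy x))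

_-ℝ_ : ℝ → ℝ → ℝ
x -ℝ y = x +ℝ (-ℝ y)

_*ℝ_ : ℝ → ℝ → ℝ
(x *ℝ y) .seq n  = seq x n ℚ.* seq y n
(x *ℝ y) .cauchy = null-cong (λ m n → eq (seq x m) (seq x n) (seq y m) (seq y n))
  (null-+ (null-* (boundedˡ x) (cauchy y)) (null-* (boundedʳ y) (cauchy x)))
  where
  eq : ∀ a b c d → a ℚ.* (c ℚ.- d) ℚ.+ d ℚ.* (a ℚ.- b) ≡ a ℚ.* c ℚ.- b ℚ.* d
  eq = solve 4 (λ a b c d → a :* (c :- d) :+ d :* (a :- b) := a :* c :- b :* d) refl

≈ℝ-refl : ∀ {x} → x ≈ℝ x
≈ℝ-refl = pointwise (λ _ → refl)

≈ℝ-sym : ∀ {x y} → x ≈ℝ y → y ≈ℝ x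
≈ℝ-sym {x} {y} p = fromNull (null-cong (λ m _ → eq (seq x m) (seq y m)) (null-neg (toNull p)))
  where
  eq : ∀ a b → ℚ.- (a ℚ.- b) ≡ b ℚ.- a
  eq = solve 2 (λ a b → :- (a :- b) := b :- a) refl

≈ℝ-trans : ∀ {x y z} → x ≈ℝ y → y ≈ℝ z → x ≈ℝ z
≈ℝ-trans {x} {y} {z} p q =
  fromNull (null-cong (λ m _ → eq (seq x m) (seq y m) (seq z m)) (null-+ (toNull p) (toNull q)))
  where
  eq : ∀ a b c → (a ℚ.- b) ℚ.+ (b ℚ.- c) ≡ a ℚ.- c
  eq = solve 3 (λ a b c → (a :- b) :+ (b :- c) := a :- c) refl

+ℝ-cong : ∀ {x y u v} → x ≈ℝ y → u ≈ℝ v → x +ℝ u ≈ℝ y +ℝ v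
+ℝ-cong {x} {y} {u} {v} p q = fromNull (null-cong
  (λ m _ → eq (seq x m) (seq y m) (seq u m) (seq v m)) (null-+ (toNull p) (toNull q)))
  where
  eq : ∀ a b c d → (a ℚ.- b) ℚ.+ (c ℚ.- d) ≡ (a ℚ.+ c) ℚ.- (b ℚ.+ d)
  eq = solve 4 (λ a b c d → (a :- b) :+ (c :- d) := (a :+ c) :- (b :+ d)) refl

-ℝ-cong : ∀ {x y} → x ≈ℝ y → -ℝ x ≈ℝ -ℝ y
-ℝ-cong {x} {y} p = fromNull (null-cong
  (λ m _ → ℚ.neg-distrib-+ (seq x m) (ℚ.- seq y m)) (null-neg (toNull p)))

*ℝ-cong : ∀ {x y u v} → x ≈ℝ y → u ≈ℝ v → x *ℝ u ≈ℝ y *ℝ v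
*ℝ-cong {x} {y} {u} {v} p q = fromNull (null-cong
  (λ m _ → eq (seq x m) (seq y m) (seq u m) (seq v m))
  (null-+ (null-* (boundedˡ x) (toNull q)) (null-* (boundedˡ v) (toNull p))))
  where
  eq : ∀ a b c d → a ℚ.* (c ℚ.- d) ℚ.+ d ℚ.* (a ℚ.- b) ≡ a ℚ.* c ℚ.- b ℚ.* d
  eq = solve 4 (λ a b c d → a :* (c :- d) :+ d :* (a :- b) := a :* c :- b :* d) refl

ℝ-commutativeRing : CommutativeRing 0ℓ 0ℓ
ℝ-commutativeRing = record
  { Carrier = ℝ ; _≈_ = _≈ℝ_ ; _+_ = _+ℝ_ ; _*_ = _*ℝ_ ; -_ = -ℝ_
  ; 0# = fromℚ 0ℚ ; 1# = fromℚ 1ℚ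
  ; isCommutativeRing = record
    { isRing = record
      { +-isAbelianGroup = record
        { isGroup = record
          { isMonoid = record
            { isSemigroup = record
              { isMagma = record
                { isEquivalence = record { refl = ≈ℝ-refl ; sym = ≈ℝ-sym ; trans = ≈ℝ-trans }
                ; ∙-cong = +ℝ-cong }
              ; assoc = λ x y z → pointwise λ n → ℚ.+-assoc (seq x n) (seq y n) (seq z n) }
            ; identity = (λ x → pointwise λ n → ℚ.+-identityˡ (seq x n))
                       , (λ x → pointwise λ n → ℚ.+-identityʳ (seq x n)) }
          ; inverse = (λ x → pointwise λ n → ℚ.+-inverseˡ (seq x n))
                    , (λ x → pointwise λ n → ℚ.+-inverseʳ (seq x n))
          ; ⁻¹-cong = -ℝ-cong }
        ; comm = λ x y → pointwise λ n → ℚ.+-comm (seq x n) (seq y n) }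
      ; *-cong = *ℝ-cong
      ; *-assoc = λ x y z → pointwise λ n → ℚ.*-assoc (seq x n) (seq y n) (seq z n)
      ; *-identity = (λ x → pointwise λ n → ℚ.*-identityˡ (seq x n))
                   , (λ x → pointwise λ n → ℚ.*-identityʳ (seq x n))
      ; distrib = (λ x y z → pointwise λ n → ℚ.*-distribˡ-+ (seq x n) (seq y n) (seq z n))
                , (λ x y z → pointwise λ n → ℚ.*-distribʳ-+ (seq x n) (seq y n) (seq z n)) }
    ; *-comm = λ x y → pointwise λ n → ℚ.*-comm (seq x n) (seq y n) } }

record ℂ : Set where
  no-eta-equality
  field
    re im : ℝ

open ℂ public

infix 4 _≈ℂ_

record _≈ℂ_ (z w : ℂ) : Set where
  constructor _,_
  field
    re-≈ : re z ≈ℝ re w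
    im-≈ : im z ≈ℝ im w

infixl 6 _+ℂ_ _-ℂ_
infixl 7 _*ℂ_
infix  8 -ℂ_

_+ℂ_ _-ℂ_ _*ℂ_ : ℂ → ℂ → ℂ
(z +ℂ w) .re = re z +ℝ re w
(z +ℂ w) .im = im z +ℝ im w
(z -ℂ w) .re = re z -ℝ re w
(z -ℂ w) .im = im z -ℝ im w
(z *ℂ w) .re = re z *ℝ re w -ℝ im z *ℝ im w
(z *ℂ w) .im = re z *ℝ im w +ℝ im z *ℝ re w

-ℂ_ conj : ℂ → ℂ
(-ℂ z) .re = -ℝ re z
(-ℂ z) .im = -ℝ im z
conj z .re = re z
conj z .im = -ℝ im z

gaussian : ℚ → ℚ → ℂ
gaussian a b .re = fromℚ a
gaussian a b .im = fromℚ b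

ι : ℚ → ℂ
ι q = gaussian q 0ℚ

0ℂ 1ℂ 𝐢 : ℂ
0ℂ = ι 0ℚ
1ℂ = ι 1ℚ
𝐢  = gaussian 0ℚ 1ℚ

ℂ-commutativeRing : CommutativeRing 0ℓ 0ℓ
ℂ-commutativeRing = record
  { Carrier = ℂ ; _≈_ = _≈ℂ_ ; _+_ = _+ℂ_ ; _*_ = _*ℂ_ ; -_ = -ℂ_ ; 0# = 0ℂ ; 1# = 1ℂ
  ; isCommutativeRing = record
    { isRing = record
      { +-isAbelianGroup = record
        { isGroup = record
          { isMonoid = record
            { isSemigroup = record
              { isMagma = record
                { isEquivalence = record
                  { refl = R.refl , R.refl
                  ; sym = λ (p , q) → R.sym p , R.sym q
                  ; trans = λ (p , q) (p′ , q′) → R.trans p p′ , R.trans q q′ }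
                ; ∙-cong = λ (p , q) (p′ , q′) → R.+-cong p p′ , R.+-cong q q′ }
              ; assoc = λ x y z → R.+-assoc _ _ _ , R.+-assoc _ _ _ }
            ; identity = (λ x → R.+-identityˡ _ , R.+-identityˡ _)
                       , (λ x → R.+-identityʳ _ , R.+-identityʳ _) }
          ; inverse = (λ x → R.-‿inverseˡ _ , R.-‿inverseˡ _)
                    , (λ x → R.-‿inverseʳ _ , R.-‿inverseʳ _)
          ; ⁻¹-cong = λ (p , q) → R.-‿cong p , R.-‿cong q }
        ; comm = λ x y → R.+-comm _ _ , R.+-comm _ _ }
      ; *-cong = λ (p , q) (p′ , q′) →
            R.+-cong (R.*-cong p p′) (R.-‿cong (R.*-cong q q′))
          , R.+-cong (R.*-cong p q′) (R.*-cong q p′)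
      ; *-assoc = λ x y z →
            pointwise (λ n → assoc-re (x ≬ n) (x ≬ᵢ n) (y ≬ n) (y ≬ᵢ n) (z ≬ n) (z ≬ᵢ n))
          , pointwise (λ n → assoc-im (x ≬ n) (x ≬ᵢ n) (y ≬ n) (y ≬ᵢ n) (z ≬ n) (z ≬ᵢ n))
      ; *-identity =
            (λ x → pointwise (λ n → idˡ-re (x ≬ n) (x ≬ᵢ n))
                 , pointwise (λ n → idˡ-im (x ≬ n) (x ≬ᵢ n)))
          , (λ x → pointwise (λ n → idʳ-re (x ≬ n) (x ≬ᵢ n))
                 , pointwise (λ n → idʳ-im (x ≬ n) (x ≬ᵢ n)))
      ; distrib =
            (λ x y z →
              pointwise (λ n → dˡ-re (x ≬ n) (x ≬ᵢ n) (y ≬ n) (y ≬ᵢ n) (z ≬ n) (z ≬ᵢ n))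
            , pointwise (λ n → dˡ-im (x ≬ n) (x ≬ᵢ n) (y ≬ n) (y ≬ᵢ n) (z ≬ n) (z ≬ᵢ n)))
          , (λ x y z →
              pointwise (λ n → dʳ-re (x ≬ n) (x ≬ᵢ n) (y ≬ n) (y ≬ᵢ n) (z ≬ n) (z ≬ᵢ n))
            , pointwise (λ n → dʳ-im (x ≬ n) (x ≬ᵢ n) (y ≬ n) (y ≬ᵢ n) (z ≬ n) (z ≬ᵢ n))) }
    ; *-comm = λ x y →
          pointwise (λ n → comm-re (x ≬ n) (x ≬ᵢ n) (y ≬ n) (y ≬ᵢ n))
        , pointwise (λ n → comm-im (x ≬ n) (x ≬ᵢ n) (y ≬ n) (y ≬ᵢ n)) } }
  where
  module R = CommutativeRing ℝ-commutativeRing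
  open import Data.Rational.Base using (_+_; _*_; _-_)
  _≬_ _≬ᵢ_ : ℂ → ℕ → ℚ
  x ≬ n = seq (re x) n
  x ≬ᵢ n = seq (im x) n
  assoc-re : ∀ a b c d e f →
    (a * c - b * d) * e - (a * d + b * c) * f ≡ a * (c * e - d * f) - b * (c * f + d * e)
  assoc-re = solve 6 (λ a b c d e f →
    (a :* c :- b :* d) :* e :- (a :* d :+ b :* c) :* f :=
    a :* (c :* e :- d :* f) :- b :* (c :* f :+ d :* e)) refl
  assoc-im : ∀ a b c d e f →
    (a * c - b * d) * f + (a * d + b * c) * e ≡ a * (c * f + d * e) + b * (c * e - d * f)
  assoc-im = solve 6 (λ a b c d e f →
    (a :* c :- b :* d) :* f :+ (a :* d :+ b :* c) :* e :=
    a :* (c :* f :+ d :* e) :+ b :* (c :* e :- d :* f)) refl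
  idˡ-re : ∀ a b → 1ℚ * a - 0ℚ * b ≡ a
  idˡ-re = solve 2 (λ a b → con 1ℚ :* a :- con 0ℚ :* b := a) refl
  idˡ-im : ∀ a b → 1ℚ * b + 0ℚ * a ≡ b
  idˡ-im = solve 2 (λ a b → con 1ℚ :* b :+ con 0ℚ :* a := b) refl
  idʳ-re : ∀ a b → a * 1ℚ - b * 0ℚ ≡ a
  idʳ-re = solve 2 (λ a b → a :* con 1ℚ :- b :* con 0ℚ := a) refl
  idʳ-im : ∀ a b → a * 0ℚ + b * 1ℚ ≡ b
  idʳ-im = solve 2 (λ a b → a :* con 0ℚ :+ b :* con 1ℚ := b) refl
  dˡ-re : ∀ a b c d e f → a * (c + e) - b * (d + f) ≡ (a * c - b * d) + (a * e - b * f)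
  dˡ-re = solve 6 (λ a b c d e f →
    a :* (c :+ e) :- b :* (d :+ f) := (a :* c :- b :* d) :+ (a :* e :- b :* f)) refl
  dˡ-im : ∀ a b c d e f → a * (d + f) + b * (c + e) ≡ (a * d + b * c) + (a * f + b * e)
  dˡ-im = solve 6 (λ a b c d e f →
    a :* (d :+ f) :+ b :* (c :+ e) := (a :* d :+ b :* c) :+ (a :* f :+ b :* e)) refl
  dʳ-re : ∀ a b c d e f → (c + e) * a - (d + f) * b ≡ (c * a - d * b) + (e * a - f * b)
  dʳ-re = solve 6 (λ a b c d e f →
    (c :+ e) :* a :- (d :+ f) :* b := (c :* a :- d :* b) :+ (e :* a :- f :* b)) refl
  dʳ-im : ∀ a b c d e f → (c + e) * b + (d + f) * a ≡ (c * b + d * a) + (e * b + f * a)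
  dʳ-im = solve 6 (λ a b c d e f →
    (c :+ e) :* b :+ (d :+ f) :* a := (c :* b :+ d :* a) :+ (e :* b :+ f :* a)) refl
  comm-re : ∀ a b c d → a * c - b * d ≡ c * a - d * b
  comm-re = solve 4 (λ a b c d → a :* c :- b :* d := c :* a :- d :* b) refl
  comm-im : ∀ a b c d → a * d + b * c ≡ c * b + d * a
  comm-im = solve 4 (λ a b c d → a :* d :+ b :* c := c :* b :+ d :* a) refl

open import Algebra.Properties.Semiring.Exp
  (CommutativeRing.semiring ℂ-commutativeRing) public
  using () renaming (_^_ to _^ℂ_)

-- Inversion on ℝ is not a total function constructively, so negative powers
-- are taken of complex numbers packaged with an inverse.
record Unit : Set where
  field
    val inv  : ℂ
    inverse  : val *ℂ inv ≈ℂ 1ℂ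

infixr 8 _^⁻_

_^⁻_ : Unit → ℕ → ℂ
z ^⁻ n = Unit.inv z ^ℂ n

𝐢ᵘ : Unit
𝐢ᵘ = record { val = 𝐢 ; inv = -ℂ 𝐢 ; inverse = pointwise (λ _ → refl) , pointwise (λ _ → refl) }

[2-2𝐢]ᵘ : Unit
[2-2𝐢]ᵘ = record
  { val     = ι (+ 2 ℚ./ 1) -ℂ ι (+ 2 ℚ./ 1) *ℂ 𝐢
  ; inv     = gaussian (+ 1 ℚ./ 4) (+ 1 ℚ./ 4)
  ; inverse = pointwise (λ _ → refl) , pointwise (λ _ → refl)
  }

X : ℕ → Set
X D = Vec (Fin 2) D

𝟎 : ∀ {D} → X D
𝟎 = replicate _ 0F

differences : ∀ {D} → X D → X D → ℕ
differences []      []      = 0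
differences (a ∷ y) (b ∷ z) = (if does (a Fin.≟ b) then 0 else 1) ℕ.+ differences y z

Adj : ∀ {D} → X D → X D → Set
Adj y z = differences y z ≡ 1

data Walk {D : ℕ} : X D → X D → ℕ → Set where
  stop : ∀ {y} → Walk y y 0
  step : ∀ {y w z n} → Adj y w → Walk w z n → Walk y z (ℕ.suc n)

IsDistance : ∀ {D} → X D → X D → ℕ → Set
IsDistance y z n = Walk y z n × (∀ m → Walk y z m → n ≤ m)

differences-refl : ∀ {D} (y : X D) → differences y y ≡ 0
differences-refl []       = refl
differences-refl (0F ∷ y) = differences-refl y
differences-refl (1F ∷ y) = differences-refl y

cons : ∀ {D n} a {y z : X D} → Walk y z n → Walk (a ∷ y) (a ∷ z) n
cons a  stop       = stop
cons 0F (step p q) = step p (cons 0F q)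
cons 1F (step p q) = step p (cons 1F q)

shortest : ∀ {D} (y z : X D) → Walk y z (differences y z)
shortest []       []       = stop
shortest (0F ∷ y) (0F ∷ z) = cons 0F (shortest y z)
shortest (0F ∷ y) (1F ∷ z) = step (cong ℕ.suc (differences-refl y)) (cons 1F (shortest y z))
shortest (1F ∷ y) (0F ∷ z) = step (cong ℕ.suc (differences-refl y)) (cons 0F (shortest y z))
shortest (1F ∷ y) (1F ∷ z) = cons 1F (shortest y z)

triangle : ∀ {D} (y w z : X D) → differences y z ≤ differences y w ℕ.+ differences w z
triangle []       []       []       = z≤n
triangle (0F ∷ y) (0F ∷ w) (0F ∷ z) = triangle y w z
triangle (0F ∷ y) (0F ∷ w) (1F ∷ z) =
  subst (ℕ.suc (differences y z) ≤_) (sym (ℕ.+-suc (differences y w) (differences w z))) (s≤s (triangle y w z))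
triangle (0F ∷ y) (1F ∷ w) (0F ∷ z) = ℕ.≤-trans (triangle y w z)
  (ℕ.+-mono-≤ (ℕ.n≤1+n (differences y w)) (ℕ.n≤1+n (differences w z)))
triangle (0F ∷ y) (1F ∷ w) (1F ∷ z) = s≤s (triangle y w z)
triangle (1F ∷ y) (0F ∷ w) (0F ∷ z) = s≤s (triangle y w z)
triangle (1F ∷ y) (0F ∷ w) (1F ∷ z) = ℕ.≤-trans (triangle y w z)
  (ℕ.+-mono-≤ (ℕ.n≤1+n (differences y w)) (ℕ.n≤1+n (differences w z)))
triangle (1F ∷ y) (1F ∷ w) (0F ∷ z) =
  subst (ℕ.suc (differences y z) ≤_) (sym (ℕ.+-suc (differences y w) (differences w z))) (s≤s (triangle y w z))
triangle (1F ∷ y) (1F ∷ w) (1F ∷ z) = triangle y w z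

walk-length : ∀ {D} {y z : X D} m → Walk y z m → differences y z ≤ m
walk-length {y = y} .0 stop = ℕ.≤-reflexive (differences-refl y)
walk-length {y = y} {z} .(ℕ.suc _) (step {w = w} p q) = ℕ.≤-trans (triangle y w z)
  (subst (λ t → t ℕ.+ differences w z ≤ _) (sym p) (s≤s (walk-length _ q)))

-- ∂ is path-length distance; this computes it as the number of differing
-- coordinates and proves that value to be the least length of a walk.
distance : ∀ {D} (y z : X D) → ∃ (IsDistance y z)
distance y z = differences y z , shortest y z , walk-length

∂ : ∀ {D} → X D → X D → ℕ
∂ y z = proj₁ (distance y z)

V Mat : ℕ → Set
V   D = X D → ℂ
Mat D = X D → X D → ℂ

sumX : ∀ {D} → (X D → ℂ) → ℂ
sumX {ℕ.zero}  f = f []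
sumX {ℕ.suc D} f = sumX (f ∘ (0F ∷_)) +ℂ sumX (f ∘ (1F ∷_))

infix  4 _≋_ _≋ᴹ_
infixl 6 _+ⱽ_ _+ᴹ_ _-ᴹ_
infixr 7 _•ⱽ_ _•ᴹ_ _·_
infixl 7 _*ᴹ_

_≋_ : ∀ {D} → V D → V D → Set
v ≋ w = ∀ y → v y ≈ℂ w y

0ⱽ : ∀ {D} → V D
0ⱽ _ = 0ℂ

_+ⱽ_ : ∀ {D} → V D → V D → V D
(v +ⱽ w) y = v y +ℂ w y

_•ⱽ_ : ∀ {D} → ℂ → V D → V D
(c •ⱽ v) y = c *ℂ v y

⟨_,_⟩ : ∀ {D} → V D → V D → ℂ
⟨ v , w ⟩ = sumX λ y → v y *ℂ conj (w y)

∥_∥² : ∀ {D} → V D → ℂ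
∥ v ∥² = ⟨ v , v ⟩

_≋ᴹ_ : ∀ {D} → Mat D → Mat D → Set
M ≋ᴹ N = ∀ y z → M y z ≈ℂ N y z

_+ᴹ_ _-ᴹ_ _*ᴹ_ : ∀ {D} → Mat D → Mat D → Mat D
(M +ᴹ N) y z = M y z +ℂ N y z
(M -ᴹ N) y z = M y z -ℂ N y z
(M *ᴹ N) y z = sumX λ w → M y w *ℂ N w z

_•ᴹ_ : ∀ {D} → ℂ → Mat D → Mat D
(c •ᴹ M) y z = c *ℂ M y z

_·_ : ∀ {D} → Mat D → V D → V D
(M · v) y = sumX λ z → M y z *ℂ v z

diag : ∀ {D} → (X D → ℂ) → Mat D
diag f y z = if does (Vec.≡-dec Fin._≟_ y z) then f y else 0ℂ

I : ∀ {D} → Mat D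
I = diag λ _ → 1ℂ

∏ᴹ : ∀ {D} → List (Mat D) → Mat D
∏ᴹ = foldr _*ᴹ_ I

Kron : ∀ {D} → (Fin 2 → Fin 2 → ℂ) → Mat D
Kron M []      []      = 1ℂ
Kron M (a ∷ y) (b ∷ z) = M a b *ℂ Kron M y z

A : ∀ {D} → Mat D
A y z = if does (differences y z ℕ.≟ 1) then 1ℂ else 0ℂ

-- D - 2i, an integer regarded as a rational
θ : ℕ → ℕ → ℚ
θ D i = (+ D ℤ.- + (2 ℕ.* i)) ℚ./ 1

A* : ∀ {D} → Mat D
A* {D} = diag λ y → ι (θ D (∂ 𝟎 y))

data T {D : ℕ} : Mat D → Set where
  gen-A  : T A
  gen-A* : T A*
  one    : T I
  add    : ∀ {M N} → T M → T N → T (M +ᴹ N)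
  scale  : ∀ c {M} → T M → T (c •ᴹ M)
  mul    : ∀ {M N} → T M → T N → T (M *ᴹ N)
  resp   : ∀ {M N} → M ≋ᴹ N → T M → T N

-- Inverse of a rational, with the junk value 0 at 0; below it is only applied
-- to nonzero arguments.
infix 8 _⁻¹

_⁻¹ : ℚ → ℚ
q ⁻¹ with q ℚ.≟ 0ℚ
... | yes _   = 0ℚ
... | no q≢0 = ℚ.1/_ q {{ℚ.≢-nonZero q≢0}}

E : ∀ {D} → ℕ → Mat D
E {D} i = ∏ᴹ (map factor (filter (λ j → ¬? (j ℕ.≟ i)) (upTo (ℕ.suc D))))
  where
  factor : ℕ → Mat D
  factor j = ι ((θ D i ℚ.- θ D j) ⁻¹) •ᴹ (A -ᴹ ι (θ D j) •ᴹ I)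

E* : ∀ {D} → ℕ → Mat D
E* i = diag λ y → if does (∂ 𝟎 y ℕ.≟ i) then 1ℂ else 0ℂ

P₁ P₁⁻¹ : Fin 2 → Fin 2 → ℂ
P₁ 0F 0F = 1ℂ
P₁ 0F 1F = 1ℂ
P₁ 1F 0F = -ℂ 𝐢
P₁ 1F 1F = 𝐢

P₁⁻¹ 0F 0F = ι ½
P₁⁻¹ 0F 1F = ι ½ *ℂ 𝐢
P₁⁻¹ 1F 0F = ι ½
P₁⁻¹ 1F 1F = -ℂ (ι ½ *ℂ 𝐢)

P P⁻¹ : ∀ {D} → Mat D
P   = Kron P₁
P⁻¹ = Kron P₁⁻¹

module KronInverse where
  open CommutativeRing ℂ-commutativeRing
    using (setoid; _≈_; _+_; _*_; +-cong; *-cong; *-congˡ; *-congʳ; *-assoc; *-comm;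
           distribˡ; distribʳ; zeroˡ; *-identityˡ)
    renaming (refl to ≈-refl; trans to ≈-trans; sym to ≈-sym)
  open import Relation.Binary.Reasoning.Setoid setoid

  sumX-cong : ∀ {D} {f g : X D → ℂ} → (∀ y → f y ≈ g y) → sumX f ≈ sumX g
  sumX-cong {ℕ.zero}  h = h []
  sumX-cong {ℕ.suc D} h = +-cong (sumX-cong (h ∘ (0F ∷_))) (sumX-cong (h ∘ (1F ∷_)))

  sumX-scale : ∀ {D} c (f : X D → ℂ) → sumX (λ y → c * f y) ≈ c * sumX f
  sumX-scale {ℕ.zero}  c f = ≈-refl
  sumX-scale {ℕ.suc D} c f = ≈-trans
    (+-cong (sumX-scale c (f ∘ (0F ∷_))) (sumX-scale c (f ∘ (1F ∷_))))
    (≈-sym (distribˡ c _ _))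

  interchange : ∀ a b c d → (a * b) * (c * d) ≈ (a * c) * (b * d)
  interchange a b c d = begin
    (a * b) * (c * d) ≈⟨ *-assoc a b (c * d) ⟩
    a * (b * (c * d)) ≈⟨ *-congˡ (*-assoc b c d) ⟨
    a * ((b * c) * d) ≈⟨ *-congˡ (*-congʳ (*-comm b c)) ⟩
    a * ((c * b) * d) ≈⟨ *-congˡ (*-assoc c b d) ⟩
    a * (c * (b * d)) ≈⟨ *-assoc a c (b * d) ⟨
    (a * c) * (b * d) ∎

  kron : ∀ (M N : Fin 2 → Fin 2 → ℂ) →
    (∀ a b → M a 0F * N 0F b + M a 1F * N 1F b ≈ (if does (a Fin.≟ b) then 1ℂ else 0ℂ)) →
    ∀ {D} → Kron {D} M *ᴹ Kron N ≋ᴹ I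
  kron M N h []      []      = *-identityˡ 1ℂ
  kron M N h (a ∷ y) (b ∷ z) = begin
    sumX (λ w → (M a 0F * Kron M y w) * (N 0F b * Kron N w z)) +
    sumX (λ w → (M a 1F * Kron M y w) * (N 1F b * Kron N w z))
      ≈⟨ +-cong (pull 0F) (pull 1F) ⟩
    (M a 0F * N 0F b) * (Kron M *ᴹ Kron N) y z + (M a 1F * N 1F b) * (Kron M *ᴹ Kron N) y z
      ≈⟨ distribʳ _ _ _ ⟨
    (M a 0F * N 0F b + M a 1F * N 1F b) * (Kron M *ᴹ Kron N) y z
      ≈⟨ *-cong (h a b) (kron M N h y z) ⟩
    (if does (a Fin.≟ b) then 1ℂ else 0ℂ) * I y z
      ≈⟨ δ (does (a Fin.≟ b)) ⟩
    I (a ∷ y) (b ∷ z) ∎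
    where
    pull : ∀ c → sumX (λ w → (M a c * Kron M y w) * (N c b * Kron N w z))
                 ≈ (M a c * N c b) * (Kron M *ᴹ Kron N) y z
    pull c = ≈-trans
      (sumX-cong λ w → interchange (M a c) (Kron M y w) (N c b) (Kron N w z))
      (sumX-scale (M a c * N c b) (λ w → Kron M y w * Kron N w z))
    open import Data.Bool.Base using (_∧_)
    δ : ∀ p → (if p then 1ℂ else 0ℂ) * I y z ≈
              (if p ∧ does (Vec.≡-dec Fin._≟_ y z) then 1ℂ else 0ℂ)
    δ false = zeroˡ _
    δ true  = *-identityˡ _

P*P⁻¹≋I : ∀ {D} → P {D} *ᴹ P⁻¹ ≋ᴹ I
P*P⁻¹≋I = KronInverse.kron P₁ P₁⁻¹ λ where
  0F 0F → pointwise (λ _ → refl) , pointwise (λ _ → refl)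
  0F 1F → pointwise (λ _ → refl) , pointwise (λ _ → refl)
  1F 0F → pointwise (λ _ → refl) , pointwise (λ _ → refl)
  1F 1F → pointwise (λ _ → refl) , pointwise (λ _ → refl)

P⁻¹*P≋I : ∀ {D} → P⁻¹ {D} *ᴹ P ≋ᴹ I
P⁻¹*P≋I = KronInverse.kron P₁⁻¹ P₁ λ where
  0F 0F → pointwise (λ _ → refl) , pointwise (λ _ → refl)
  0F 1F → pointwise (λ _ → refl) , pointwise (λ _ → refl)
  1F 0F → pointwise (λ _ → refl) , pointwise (λ _ → refl)
  1F 1F → pointwise (λ _ → refl) , pointwise (λ _ → refl)

Eᵋ : ∀ {D} → ℕ → Mat D
Eᵋ i = P⁻¹ *ᴹ E i *ᴹ P

record Subspace (D : ℕ) : Set₁ where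
  field
    Mem      : V D → Set
    mem-resp : ∀ {v w} → v ≋ w → Mem v → Mem w
    mem-0    : Mem 0ⱽ
    mem-+    : ∀ {v w} → Mem v → Mem w → Mem (v +ⱽ w)
    mem-•    : ∀ c {v} → Mem v → Mem (c •ⱽ v)

open Subspace public using (Mem)

infix 4 _∈ˢ_ _⊆ˢ_ _∈_⟨_⟩

_∈ˢ_ : ∀ {D} → V D → Subspace D → Set
v ∈ˢ W = Mem W v

_⊆ˢ_ : ∀ {D} → Subspace D → Subspace D → Set
U ⊆ˢ W = ∀ v → v ∈ˢ U → v ∈ˢ W

IsZero : ∀ {D} → Subspace D → Set
IsZero W = ∀ v → v ∈ˢ W → v ≋ 0ⱽ

IsModule : ∀ {D} → Subspace D → Set
IsModule W = ∀ B → T B → ∀ w → w ∈ˢ W → (B · w) ∈ˢ W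

-- The last field says that no module U inside W is different from both 0 and W.
-- It is not phrased as the disjunction "U = 0 or U = W", which constructively
-- cannot be established for arbitrary U even when W is one-dimensional.
record IsIrreducible {D : ℕ} (W : Subspace D) : Set₁ where
  field
    isModule : IsModule W
    nonzero  : ¬ IsZero W
    minimal  : ∀ U → IsModule U → U ⊆ˢ W → ¬ (¬ IsZero U × ¬ (W ⊆ˢ U))

_∈_⟨_⟩ : ∀ {D} → V D → Mat D → Subspace D → Set
v ∈ M ⟨ W ⟩ = ∃ λ w → w ∈ˢ W × v ≋ M · w

E*W≢0 : ∀ {D} → Subspace D → ℕ → Set
E*W≢0 W i = ¬ (∀ v → v ∈ E* i ⟨ W ⟩ → v ≋ 0ⱽ)

IsEndpoint : ∀ {D} → Subspace D → ℕ → Set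
IsEndpoint {D} W r = (r ≤ D × E*W≢0 W r) × (∀ i → i ≤ D → E*W≢0 W i → r ≤ i)

-- S is the set {i | E*ᵢW ≠ 0}, so d = ∣S∣ - 1.
IsDiameter : ∀ {D} → Subspace D → ℕ → Set
IsDiameter {D} W d = ∃ λ (S : Subset (ℕ.suc D)) →
  (∀ i → i ∈ S ⇔ E*W≢0 W (toℕ i)) × ℕ.suc d ≡ ∣ S ∣

fromℕ : ℕ → ℚ
fromℕ n = + n ℚ./ 1

poch : ℚ → ℕ → ℚ
poch a ℕ.zero    = 1ℚ
poch a (ℕ.suc n) = poch a n ℚ.* (a ℚ.+ fromℕ n)

₂F₁[-_,-_∣-_∣2] : ℕ → ℕ → ℕ → ℚ
₂F₁[- i ,- j ∣- d ∣2] = foldr ℚ._+_ 0ℚ (map term (upTo (ℕ.suc d)))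
  where
  term : ℕ → ℚ
  term n = poch (ℚ.- fromℕ i) n ℚ.* poch (ℚ.- fromℕ j) n
             ℚ.* (poch (ℚ.- fromℕ d) n ℚ.* fromℕ (n !)) ⁻¹
             ℚ.* fromℕ (2 ℕ.^ n)

{-# OPTIONS --safe #-}
module Submission where

-- Everything reduces to (i) by applying P: P†P is scalar, P³ is scalar, P intertwines Eᵋ with E,
-- E with E* and E* with Eᵋ, and PW ⊆ W because P is, up to a scalar, the product of Σ 𝐢ᵏ Eₖ and
-- Σ 𝐢ᵏ E*ₖ.  For (i), the vector u* has weight r and is killed by the lowering operator, since
-- E*ₖW = 0 for k < r; hence ⟨G u*, u*⟩ = (g₀₀)ᵈ (det g)ʳ ∥u*∥² for the D-th Kronecker power G of
-- any 2×2 matrix g with g₀₀ invertible, by factoring g into unitriangular and diagonal matrices.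
-- Both Σ aᵏ Eₖ and Σ bˡ Eᵋₗ are Kronecker powers, so Σ aᵏ bˡ ⟨Eₖu*, Eᵋₗu*⟩ equals
-- (ab)ʳ ((1 - 𝐢a - 𝐢b + ab) / (2 - 2𝐢))ᵈ ∥u*∥² for all natural a and b.  Comparing coefficients
-- with the generating function of the Krawtchouk polynomials gives the formula.

open import Algebra.Bundles using (CommutativeRing; RawRing)
import Algebra.Properties.AbelianGroup
open import Algebra.Solver.Ring.AlmostCommutativeRing
  using (fromCommutativeRing; _-Raw-AlmostCommutative⟶_)
import Algebra.Solver.Ring
open import Data.Bool.Base using (Bool; if_then_else_)
open import Data.Fin.Base using (Fin)
open import Data.Fin.Patterns using (0F; 1F)
open import Data.Integer.Base as ℤ using (ℤ; +_; -[1+_])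
import Data.Integer.Properties as ℤ
open import Data.List.Base using (List; []; _∷_; map; filter; foldr; upTo; applyUpTo)
open import Data.List.Membership.Propositional using () renaming (_∈_ to _∈ᴸ_)
open import Data.List.Membership.Propositional.Properties using (∈-filter⁺; ∈-upTo⁺)
open import Data.List.Properties using (map-upTo)
open import Data.List.Relation.Unary.All using (All; []; _∷_)
open import Data.List.Relation.Unary.All.Properties using (all-filter)
open import Data.List.Relation.Unary.Any using (here; there)
open import Data.Maybe.Base using (Maybe; just; nothing)
open import Data.Nat.Base as ℕ using (ℕ; zero; suc; _+_; _*_; _∸_; _≤_; _<_; z≤n; s≤s; _!)
open import Data.Nat.Combinatorics using (_C_; nCk+nC[k+1]≡[n+1]C[k+1]; k>n⇒nCk≡0)
open import Data.Nat.Coprimality using (1-coprimeTo) renaming (sym to coprime-sym)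
import Data.Nat.Properties as ℕ
import Data.Nat.Solver as ℕ-Solver
open import Data.Product.Base using (∃; _×_; _,_; proj₁; proj₂)
import Data.Product.Properties as Product
open import Data.Rational.Base as ℚ using (ℚ; 0ℚ; 1ℚ; ½; mkℚ)
import Data.Rational.Properties as ℚ
open import Data.Rational.Solver using (module +-*-Solver)
open import Data.Sum.Base using (inj₁; inj₂)
open import Data.Vec.Base using ([]; _∷_)
open import Function.Base using (_∘_; id)
open import Level using (0ℓ)
open import Relation.Binary.PropositionalEquality
  using (_≡_; _≢_; refl; sym; trans; cong; cong₂; subst; module ≡-Reasoning)
open import Relation.Nullary using (Dec; ¬_; ¬?; yes; no; does; contradiction)
open import Relation.Nullary.Decidable using (dec-true; dec-false)
open import Defs

open Algebra.Properties.AbelianGroup ℚ.+-0-abelianGroup using (⁻¹-involutive)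

-- Rational hypergeometric terms

-- A single `Eₖ` is not a Kronecker power, but `Σ tᵏ Eₖ` is; this is why inner products are treated
-- through generating functions. With `L` the operator behind `lower`, `u*` is a lowest weight
-- vector for an action of sl₂, and `(g₀₀)ᵈ (det g)ʳ` is the matrix coefficient of `g` at such a
-- vector. `P₁` represents, up to a scalar, a rotation by a third of a turn that permutes the
-- mutually perpendicular axes of `A`, `A*` and `A^ε`; its cube is the scalar `2 - 2𝐢`. The obstacle
-- is constructive: equality on `ℂ` is undecidable and inversion is partial. Natural parameters `a`,
-- `b` meet this three times. Differences of distinct nodes are nonzero rationals, so coefficients
-- can be compared by dividing out roots; real `b` makes `Σ bˡ Eᵋₗ` Hermitian; and the corner `g₀₀`
-- has real part `(1 + a)(1 + b)/4`, so an inverse can be written down. The endpoint condition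
-- yields vanishing of `E*ₖW` only up to double negation, which is removed because equality of
-- Cauchy reals is stable.

integer : ℤ → ℚ
integer z = z ℚ./ 1

-- `z / 1` is normalised by a gcd that is stuck for a variable `z`; the explicit fraction exposes
-- the numerator and the denominator, so that rational arithmetic computes on it.
integer-mkℚ : ∀ z → integer z ≡ mkℚ z 0 (coprime-sym (1-coprimeTo ℤ.∣ z ∣))
integer-mkℚ z = ℚ.↥p/↧p≡p (mkℚ z 0 (coprime-sym (1-coprimeTo ℤ.∣ z ∣)))

integer-+ : ∀ y z → integer (y ℤ.+ z) ≡ integer y ℚ.+ integer z
integer-+ y z = trans
  -- Adding two fractions with denominator 1 produces the numerator `y * 1 + z * 1`.
  (cong₂ (λ a b → integer (a ℤ.+ b)) (sym (ℤ.*-identityʳ y)) (sym (ℤ.*-identityʳ z)))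
  (sym (cong₂ ℚ._+_ (integer-mkℚ y) (integer-mkℚ z)))

integer-* : ∀ y z → integer (y ℤ.* z) ≡ integer y ℚ.* integer z
integer-* y z = sym (cong₂ ℚ._*_ (integer-mkℚ y) (integer-mkℚ z))

integer-neg : ∀ z → integer (ℤ.- z) ≡ ℚ.- integer z
integer-neg (+ zero)  = refl
integer-neg (+ suc n) = refl
integer-neg -[1+ n ]  = sym (⁻¹-involutive (fromℕ (suc n)))

integer-injective : ∀ {y z} → integer y ≡ integer z → y ≡ z
integer-injective {y} {z} eq = cong ℚ.ℚ.numerator
  (trans (sym (integer-mkℚ y)) (trans eq (integer-mkℚ z)))

fromℕ-+ : ∀ m n → fromℕ (m ℕ.+ n) ≡ fromℕ m ℚ.+ fromℕ n
fromℕ-+ m n = integer-+ (+ m) (+ n)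

fromℕ-* : ∀ m n → fromℕ (m ℕ.* n) ≡ fromℕ m ℚ.* fromℕ n
fromℕ-* m n = trans (cong integer (ℤ.pos-* m n)) (integer-* (+ m) (+ n))

fromℕ-suc : ∀ n → fromℕ (suc n) ≡ 1ℚ ℚ.+ fromℕ n
fromℕ-suc n = fromℕ-+ 1 n

fromℕ-injective : ∀ {m n} → fromℕ m ≡ fromℕ n → m ≡ n
fromℕ-injective eq = ℤ.+-injective (integer-injective eq)

⁻¹-inverseʳ : ∀ {q} → q ≢ 0ℚ → q ℚ.* q ⁻¹ ≡ 1ℚ
⁻¹-inverseʳ {q} q≢0 with q ℚ.≟ 0ℚ
... | yes q≡0 = contradiction q≡0 q≢0
... | no  q≢0 = ℚ.*-inverseʳ q {{ℚ.≢-nonZero q≢0}}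

*-≢0 : ∀ {p q} → p ≢ 0ℚ → q ≢ 0ℚ → p ℚ.* q ≢ 0ℚ
*-≢0 {p} {q} p≢0 q≢0 pq≡0 = q≢0 (begin
  q                   ≡⟨ ℚ.*-identityˡ q ⟨
  1ℚ ℚ.* q            ≡⟨ cong (ℚ._* q) (trans (ℚ.*-comm (p ⁻¹) p) (⁻¹-inverseʳ p≢0)) ⟨
  p ⁻¹ ℚ.* p ℚ.* q    ≡⟨ ℚ.*-assoc (p ⁻¹) p q ⟩
  p ⁻¹ ℚ.* (p ℚ.* q)  ≡⟨ cong (p ⁻¹ ℚ.*_) pq≡0 ⟩
  p ⁻¹ ℚ.* 0ℚ         ≡⟨ ℚ.*-zeroʳ (p ⁻¹) ⟩
  0ℚ                  ∎)
  where open ≡-Reasoning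

-‿≢0 : ∀ {p} → p ≢ 0ℚ → ℚ.- p ≢ 0ℚ
-‿≢0 {p} p≢0 -p≡0 = p≢0 (trans (sym (⁻¹-involutive p)) (cong ℚ.-_ -p≡0))

absorption : ∀ n k → suc k ℕ.* (suc n C suc k) ≡ suc n ℕ.* (n C k)
absorption zero    zero    = refl
absorption zero    (suc k) = trans
  (cong (suc (suc k) ℕ.*_) (k>n⇒nCk≡0 {1} {suc (suc k)} (s≤s (s≤s z≤n))))
  (trans (ℕ.*-zeroʳ (suc (suc k))) (sym (cong (1 ℕ.*_) (k>n⇒nCk≡0 {0} {suc k} (s≤s z≤n)))))
absorption (suc n) zero    = begin
  1 ℕ.* (suc (suc n) C 1)                          ≡⟨ cong (1 ℕ.*_) (nCk+nC[k+1]≡[n+1]C[k+1] (suc n) 0) ⟨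
  1 ℕ.* (1 ℕ.+ (suc n C 1))                        ≡⟨ cong (λ t → 1 ℕ.* (1 ℕ.+ t)) (ℕ.*-identityˡ (suc n C 1)) ⟨
  1 ℕ.* (1 ℕ.+ 1 ℕ.* (suc n C 1))                  ≡⟨ cong (λ t → 1 ℕ.* (1 ℕ.+ t)) (absorption n 0) ⟩
  1 ℕ.* (1 ℕ.+ suc n ℕ.* 1)                        ≡⟨ ℕ.*-identityˡ _ ⟩
  suc (suc n) ℕ.* 1                                ∎
  where open ≡-Reasoning
absorption (suc n) (suc k) = begin
  suc (suc k) ℕ.* (suc (suc n) C suc (suc k))                       ≡⟨ cong (suc (suc k) ℕ.*_) (nCk+nC[k+1]≡[n+1]C[k+1] (suc n) (suc k)) ⟨
  suc (suc k) ℕ.* ((suc n C suc k) ℕ.+ (suc n C suc (suc k)))       ≡⟨ regroup k (suc n C suc k) (suc n C suc (suc k)) ⟩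
  (suc n C suc k) ℕ.+ suc k ℕ.* (suc n C suc k) ℕ.+ suc (suc k) ℕ.* (suc n C suc (suc k))
                                                                     ≡⟨ cong₂ (λ a b → (suc n C suc k) ℕ.+ a ℕ.+ b) (absorption n k) (absorption n (suc k)) ⟩
  (suc n C suc k) ℕ.+ suc n ℕ.* (n C k) ℕ.+ suc n ℕ.* (n C suc k)   ≡⟨ collect n (suc n C suc k) (n C k) (n C suc k) ⟩
  (suc n C suc k) ℕ.+ suc n ℕ.* ((n C k) ℕ.+ (n C suc k))           ≡⟨ cong (λ t → (suc n C suc k) ℕ.+ suc n ℕ.* t) (nCk+nC[k+1]≡[n+1]C[k+1] n k) ⟩
  suc (suc n) ℕ.* (suc n C suc k)                                    ∎
  where
  open ≡-Reasoning
  open ℕ-Solver.+-*-Solver using (solve; _:=_; _:+_; _:*_; con)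
  regroup : ∀ k a b → suc (suc k) ℕ.* (a ℕ.+ b) ≡ a ℕ.+ suc k ℕ.* a ℕ.+ suc (suc k) ℕ.* b
  regroup = solve 3 (λ k a b → (con 2 :+ k) :* (a :+ b) := a :+ (con 1 :+ k) :* a :+ (con 2 :+ k) :* b) refl
  collect : ∀ n a b c → a ℕ.+ suc n ℕ.* b ℕ.+ suc n ℕ.* c ≡ a ℕ.+ suc n ℕ.* (b ℕ.+ c)
  collect = solve 4 (λ n a b c → a :+ (con 1 :+ n) :* b :+ (con 1 :+ n) :* c := a :+ (con 1 :+ n) :* (b :+ c)) refl

-- shiftedC d n i is the binomial coefficient (d - n choose i - n), for n ≤ d.
shiftedC : ℕ → ℕ → ℕ → ℕ
shiftedC d       zero    i       = d C i
shiftedC d       (suc n) zero    = 0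
shiftedC zero    (suc n) (suc i) = 0
shiftedC (suc d) (suc n) (suc i) = shiftedC d n i

sign : ℕ → ℚ
sign zero    = 1ℚ
sign (suc n) = ℚ.- sign n

-- `poch` peels off its last factor. Peeling off the first one turns the base `-(i + 1)` into `-i`,
-- which is what an induction on `i` needs.
poch-head : ∀ a n → poch a (suc n) ≡ a ℚ.* poch (a ℚ.+ 1ℚ) n
poch-head a zero    = ring a
  where
  open +-*-Solver
  ring : ∀ a → 1ℚ ℚ.* (a ℚ.+ 0ℚ) ≡ a ℚ.* 1ℚ
  ring = solve 1 (λ a → con 1ℚ :* (a :+ con 0ℚ) := a :* con 1ℚ) refl
poch-head a (suc n) = trans
  (cong₂ ℚ._*_ (poch-head a n) (cong (a ℚ.+_) (fromℕ-suc n)))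
  (ring a (poch (a ℚ.+ 1ℚ) n) (fromℕ n))
  where
  open +-*-Solver
  ring : ∀ a p m → (a ℚ.* p) ℚ.* (a ℚ.+ (1ℚ ℚ.+ m)) ≡ a ℚ.* (p ℚ.* (a ℚ.+ 1ℚ ℚ.+ m))
  ring = solve 3 (λ a p m → (a :* p) :* (a :+ (con 1ℚ :+ m)) := a :* (p :* (a :+ con 1ℚ :+ m))) refl

poch-neg-suc : ∀ i n → poch (ℚ.- fromℕ (suc i)) (suc n) ≡ ℚ.- (fromℕ (suc i) ℚ.* poch (ℚ.- fromℕ i) n)
poch-neg-suc i n = begin
  poch (ℚ.- fromℕ (suc i)) (suc n)                              ≡⟨ poch-head (ℚ.- fromℕ (suc i)) n ⟩
  ℚ.- fromℕ (suc i) ℚ.* poch (ℚ.- fromℕ (suc i) ℚ.+ 1ℚ) n       ≡⟨ cong (λ t → ℚ.- fromℕ (suc i) ℚ.* poch t n)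
                                                                     (trans (cong (λ t → ℚ.- t ℚ.+ 1ℚ) (fromℕ-suc i)) (pred (fromℕ i))) ⟩
  ℚ.- fromℕ (suc i) ℚ.* poch (ℚ.- fromℕ i) n                    ≡⟨ ℚ.neg-distribˡ-* (fromℕ (suc i)) _ ⟨
  ℚ.- (fromℕ (suc i) ℚ.* poch (ℚ.- fromℕ i) n)                  ∎
  where
  open ≡-Reasoning
  open +-*-Solver
  pred : ∀ m → ℚ.- (1ℚ ℚ.+ m) ℚ.+ 1ℚ ≡ ℚ.- m
  pred = solve 1 (λ m → :- (con 1ℚ :+ m) :+ con 1ℚ := :- m) refl

poch-0 : ∀ n → poch (ℚ.- fromℕ 0) (suc n) ≡ 0ℚ
poch-0 n = trans (poch-head (ℚ.- fromℕ 0) n) (ℚ.*-zeroˡ (poch (ℚ.- fromℕ 0 ℚ.+ 1ℚ) n))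

absorptionℚ : ∀ n k → fromℕ (suc k) ℚ.* fromℕ (suc n C suc k) ≡ fromℕ (suc n) ℚ.* fromℕ (n C k)
absorptionℚ n k = trans (sym (fromℕ-* (suc k) (suc n C suc k)))
  (trans (cong fromℕ (absorption n k)) (fromℕ-* (suc n) (n C k)))

-- For `n ≤ i ≤ d` both sides are `(-1)ⁿ d! / ((d - i)! (i - n)!)`. Lowering `d`, `n` and `i`
-- together by absorption avoids dividing by factorials, and both sides vanish when `i < n`.
C-poch : ∀ {d n} i → n ≤ d →
  fromℕ (d C i) ℚ.* poch (ℚ.- fromℕ i) n ≡ poch (ℚ.- fromℕ d) n ℚ.* fromℕ (shiftedC d n i)
C-poch {d} i z≤n = ℚ.*-comm (fromℕ (d C i)) 1ℚ
C-poch {suc d} {suc n} zero (s≤s n≤d) = trans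
  (trans (cong (fromℕ (suc d C 0) ℚ.*_) (poch-0 n)) (ℚ.*-zeroʳ (fromℕ (suc d C 0))))
  (sym (ℚ.*-zeroʳ (poch (ℚ.- fromℕ (suc d)) (suc n))))
C-poch {suc d} {suc n} (suc i) (s≤s n≤d) = begin
  fromℕ (suc d C suc i) ℚ.* poch (ℚ.- fromℕ (suc i)) (suc n)
    ≡⟨ cong (fromℕ (suc d C suc i) ℚ.*_) (poch-neg-suc i n) ⟩
  fromℕ (suc d C suc i) ℚ.* ℚ.- (fromℕ (suc i) ℚ.* poch (ℚ.- fromℕ i) n)
    ≡⟨ front (fromℕ (suc d C suc i)) (fromℕ (suc i)) (poch (ℚ.- fromℕ i) n) ⟩
  ℚ.- (fromℕ (suc i) ℚ.* fromℕ (suc d C suc i) ℚ.* poch (ℚ.- fromℕ i) n)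
    ≡⟨ cong (λ t → ℚ.- (t ℚ.* poch (ℚ.- fromℕ i) n)) (absorptionℚ d i) ⟩
  ℚ.- (fromℕ (suc d) ℚ.* fromℕ (d C i) ℚ.* poch (ℚ.- fromℕ i) n)
    ≡⟨ cong ℚ.-_ (ℚ.*-assoc (fromℕ (suc d)) (fromℕ (d C i)) (poch (ℚ.- fromℕ i) n)) ⟩
  ℚ.- (fromℕ (suc d) ℚ.* (fromℕ (d C i) ℚ.* poch (ℚ.- fromℕ i) n))
    ≡⟨ cong (λ t → ℚ.- (fromℕ (suc d) ℚ.* t)) (C-poch i n≤d) ⟩
  ℚ.- (fromℕ (suc d) ℚ.* (poch (ℚ.- fromℕ d) n ℚ.* fromℕ (shiftedC d n i)))
    ≡⟨ back (fromℕ (suc d)) (poch (ℚ.- fromℕ d) n) (fromℕ (shiftedC d n i)) ⟩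
  ℚ.- (fromℕ (suc d) ℚ.* poch (ℚ.- fromℕ d) n) ℚ.* fromℕ (shiftedC d n i)
    ≡⟨ cong (ℚ._* fromℕ (shiftedC d n i)) (poch-neg-suc d n) ⟨
  poch (ℚ.- fromℕ (suc d)) (suc n) ℚ.* fromℕ (shiftedC d n i) ∎
  where
  open ≡-Reasoning
  open +-*-Solver
  front : ∀ c s p → c ℚ.* ℚ.- (s ℚ.* p) ≡ ℚ.- (s ℚ.* c ℚ.* p)
  front = solve 3 (λ c s p → c :* :- (s :* p) := :- (s :* c :* p)) refl
  back : ∀ a b c → ℚ.- (a ℚ.* (b ℚ.* c)) ≡ ℚ.- (a ℚ.* b) ℚ.* c
  back = solve 3 (λ a b c → :- (a :* (b :* c)) := :- (a :* b) :* c) refl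

poch-C : ∀ {d n} → n ≤ d → poch (ℚ.- fromℕ d) n ≡ sign n ℚ.* fromℕ (d C n) ℚ.* fromℕ (n !)
poch-C z≤n = refl
poch-C {suc d} {suc n} (s≤s n≤d) = begin
  poch (ℚ.- fromℕ (suc d)) (suc n)
    ≡⟨ poch-neg-suc d n ⟩
  ℚ.- (fromℕ (suc d) ℚ.* poch (ℚ.- fromℕ d) n)
    ≡⟨ cong (λ t → ℚ.- (fromℕ (suc d) ℚ.* t)) (poch-C n≤d) ⟩
  ℚ.- (fromℕ (suc d) ℚ.* (sign n ℚ.* fromℕ (d C n) ℚ.* fromℕ (n !)))
    ≡⟨ front (fromℕ (suc d)) (sign n) (fromℕ (d C n)) (fromℕ (n !)) ⟩
  ℚ.- sign n ℚ.* (fromℕ (suc d) ℚ.* fromℕ (d C n)) ℚ.* fromℕ (n !)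
    ≡⟨ cong (λ t → ℚ.- sign n ℚ.* t ℚ.* fromℕ (n !)) (absorptionℚ d n) ⟨
  ℚ.- sign n ℚ.* (fromℕ (suc n) ℚ.* fromℕ (suc d C suc n)) ℚ.* fromℕ (n !)
    ≡⟨ back (ℚ.- sign n) (fromℕ (suc n)) (fromℕ (suc d C suc n)) (fromℕ (n !)) ⟩
  ℚ.- sign n ℚ.* fromℕ (suc d C suc n) ℚ.* (fromℕ (suc n) ℚ.* fromℕ (n !))
    ≡⟨ cong (ℚ.- sign n ℚ.* fromℕ (suc d C suc n) ℚ.*_) (fromℕ-* (suc n) (n !)) ⟨
  ℚ.- sign n ℚ.* fromℕ (suc d C suc n) ℚ.* fromℕ (suc n !) ∎
  where
  open ≡-Reasoning
  open +-*-Solver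
  front : ∀ a b c e → ℚ.- (a ℚ.* (b ℚ.* c ℚ.* e)) ≡ ℚ.- b ℚ.* (a ℚ.* c) ℚ.* e
  front = solve 4 (λ a b c e → :- (a :* (b :* c :* e)) := :- b :* (a :* c) :* e) refl
  back : ∀ a b c e → a ℚ.* (b ℚ.* c) ℚ.* e ≡ a ℚ.* c ℚ.* (b ℚ.* e)
  back = solve 4 (λ a b c e → a :* (b :* c) :* e := a :* c :* (b :* e)) refl

fromℕ-suc≢0 : ∀ n → fromℕ (suc n) ≢ 0ℚ
fromℕ-suc≢0 n eq = ℕ.1+n≢0 (fromℕ-injective {suc n} {0} eq)

poch≢0 : ∀ {d n} → n ≤ d → poch (ℚ.- fromℕ d) n ≢ 0ℚ
poch≢0 z≤n ()
poch≢0 {suc d} {suc n} (s≤s n≤d) = subst (_≢ 0ℚ) (sym (poch-neg-suc d n))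
  (-‿≢0 (*-≢0 (fromℕ-suc≢0 d) (poch≢0 n≤d)))

!≢0 : ∀ n → fromℕ (n !) ≢ 0ℚ
!≢0 n eq = ℕ.≢-nonZero⁻¹ (n !) {{n ℕ.!≢0}} (fromℕ-injective {n !} {0} eq)

-- The sum over `n` of `(-2)ⁿ C(d,n) C(d-n,i-n) C(d-n,j-n)` is the symmetric form `C(d,j) Kᵢ(j)` of
-- the binary Krawtchouk polynomial `Kᵢ`.
krawtchoukTerm : ℕ → ℕ → ℕ → ℕ → ℚ
krawtchoukTerm d i j n =
  sign n ℚ.* fromℕ (2 ℕ.^ n) ℚ.* fromℕ (d C n) ℚ.* fromℕ (shiftedC d n i) ℚ.* fromℕ (shiftedC d n j)

hypergeometricTerm : ℕ → ℕ → ℕ → ℕ → ℚ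
hypergeometricTerm d i j n = poch (ℚ.- fromℕ i) n ℚ.* poch (ℚ.- fromℕ j) n
  ℚ.* (poch (ℚ.- fromℕ d) n ℚ.* fromℕ (n !)) ⁻¹ ℚ.* fromℕ (2 ℕ.^ n)

-- `C-poch` creates two factors `(-d)ₙ`. One is expanded by `poch-C`, and its `n!` together with the
-- other cancels the denominator. As `n ≤ d`, that denominator is nonzero and the default value of
-- `_⁻¹` never enters.
hypergeometric-krawtchouk : ∀ {d n} i j → n ≤ d →
  fromℕ (d C i) ℚ.* fromℕ (d C j) ℚ.* hypergeometricTerm d i j n ≡ krawtchoukTerm d i j n
hypergeometric-krawtchouk {d} {n} i j n≤d = begin
  Ci ℚ.* Cj ℚ.* (pi ℚ.* pj ℚ.* q ℚ.* t)
    ≡⟨ front Ci Cj pi pj q t ⟩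
  (Ci ℚ.* pi) ℚ.* (Cj ℚ.* pj) ℚ.* q ℚ.* t
    ≡⟨ cong₂ (λ a b → a ℚ.* b ℚ.* q ℚ.* t) (C-poch i n≤d) (C-poch j n≤d) ⟩
  (pd ℚ.* ci) ℚ.* (pd ℚ.* cj) ℚ.* q ℚ.* t
    ≡⟨ cong (λ a → (a ℚ.* ci) ℚ.* (pd ℚ.* cj) ℚ.* q ℚ.* t) (poch-C n≤d) ⟩
  ((sign n ℚ.* Cn ℚ.* m) ℚ.* ci) ℚ.* (pd ℚ.* cj) ℚ.* q ℚ.* t
    ≡⟨ back (sign n) Cn m ci pd cj q t ⟩
  sign n ℚ.* t ℚ.* Cn ℚ.* ci ℚ.* cj ℚ.* (pd ℚ.* m ℚ.* q)
    ≡⟨ cong (sign n ℚ.* t ℚ.* Cn ℚ.* ci ℚ.* cj ℚ.*_) (⁻¹-inverseʳ (*-≢0 (poch≢0 n≤d) (!≢0 n))) ⟩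
  sign n ℚ.* t ℚ.* Cn ℚ.* ci ℚ.* cj ℚ.* 1ℚ
    ≡⟨ ℚ.*-identityʳ _ ⟩
  krawtchoukTerm d i j n ∎
  where
  open ≡-Reasoning
  open +-*-Solver
  Ci = fromℕ (d C i)
  Cj = fromℕ (d C j)
  Cn = fromℕ (d C n)
  ci = fromℕ (shiftedC d n i)
  cj = fromℕ (shiftedC d n j)
  pi = poch (ℚ.- fromℕ i) n
  pj = poch (ℚ.- fromℕ j) n
  pd = poch (ℚ.- fromℕ d) n
  m  = fromℕ (n !)
  q  = (pd ℚ.* m) ⁻¹
  t  = fromℕ (2 ℕ.^ n)
  front : ∀ Ci Cj pi pj q t → Ci ℚ.* Cj ℚ.* (pi ℚ.* pj ℚ.* q ℚ.* t) ≡ (Ci ℚ.* pi) ℚ.* (Cj ℚ.* pj) ℚ.* q ℚ.* t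
  front = solve 6 (λ Ci Cj pi pj q t →
    Ci :* Cj :* (pi :* pj :* q :* t) := (Ci :* pi) :* (Cj :* pj) :* q :* t) refl
  back : ∀ s Cn m ci pd cj q t → ((s ℚ.* Cn ℚ.* m) ℚ.* ci) ℚ.* (pd ℚ.* cj) ℚ.* q ℚ.* t ≡
    s ℚ.* t ℚ.* Cn ℚ.* ci ℚ.* cj ℚ.* (pd ℚ.* m ℚ.* q)
  back = solve 8 (λ s Cn m ci pd cj q t → ((s :* Cn :* m) :* ci) :* (pd :* cj) :* q :* t :=
    s :* t :* Cn :* ci :* cj :* (pd :* m :* q)) refl

sumℚ : ℕ → (ℕ → ℚ) → ℚ
sumℚ n f = foldr ℚ._+_ 0ℚ (applyUpTo f n)

sumℚ-cong : ∀ n {f g} → (∀ k → k < n → f k ≡ g k) → sumℚ n f ≡ sumℚ n g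
sumℚ-cong zero    h = refl
sumℚ-cong (suc n) h = cong₂ ℚ._+_ (h 0 (s≤s z≤n)) (sumℚ-cong n (λ k k<n → h (suc k) (s≤s k<n)))

sumℚ-* : ∀ n c f → c ℚ.* sumℚ n f ≡ sumℚ n (λ k → c ℚ.* f k)
sumℚ-* zero    c f = ℚ.*-zeroʳ c
sumℚ-* (suc n) c f = trans (ℚ.*-distribˡ-+ c (f 0) _) (cong (c ℚ.* f 0 ℚ.+_) (sumℚ-* n c (f ∘ suc)))

₂F₁-krawtchouk : ∀ d i j →
  fromℕ (d C i) ℚ.* fromℕ (d C j) ℚ.* ₂F₁[- i ,- j ∣- d ∣2] ≡ sumℚ (suc d) (krawtchoukTerm d i j)
₂F₁-krawtchouk d i j = trans
  (cong (λ l → fromℕ (d C i) ℚ.* fromℕ (d C j) ℚ.* foldr ℚ._+_ 0ℚ l)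
    (map-upTo (hypergeometricTerm d i j) (suc d)))
  (trans (sumℚ-* (suc d) (fromℕ (d C i) ℚ.* fromℕ (d C j)) (hypergeometricTerm d i j))
    (sumℚ-cong (suc d) (λ n n<1+d → hypergeometric-krawtchouk i j (ℕ.≤-pred n<1+d))))

1+d+2r≡r+1+d+r : ∀ d r → suc (d + 2 * r) ≡ r + (suc d + r)
1+d+2r≡r+1+d+r = solve 2 (λ d r → con 1 :+ (d :+ con 2 :* r) := r :+ ((con 1 :+ d) :+ r)) refl
  where open ℕ-Solver.+-*-Solver using (solve; _:=_; _:+_; _:*_; con)

open +-*-Solver using () renaming
  (solve to solveℚ; _:=_ to _≐_; _:*_ to _⊗_; _:+_ to _⊕_; _:-_ to _⊝_; :-_ to ⊝_; con to conℚ)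

-- Complex numbers

∣∣-chain : ∀ {α β} a b → ℚ.∣ a ℚ.- b ∣ ℚ.< α → ℚ.∣ b ∣ ℚ.< β → ℚ.∣ a ∣ ℚ.< α ℚ.+ β
∣∣-chain a b p q = subst (λ t → ℚ.∣ t ∣ ℚ.< _) (split a b)
  (ℚ.≤-<-trans (ℚ.∣p+q∣≤∣p∣+∣q∣ (a ℚ.- b) b) (ℚ.+-mono-< p q))
  where
  split : ∀ a b → (a ℚ.- b) ℚ.+ b ≡ a
  split = solveℚ 2 (λ a b → (a ⊝ b) ⊕ b ≐ a) refl

-- The question is decided at one rational: choose `N` beyond which terms differ by less than `ε/4`
-- and compare `∣ z N ∣` with `ε/2`. If it is smaller, the tail stays below `ε`; if not, convergence
-- to 0 is refuted.
small-tail : ∀ {z : ℕ → ℚ} → Null (λ m n → z m ℚ.- z n) →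
  ¬ ¬ (∀ ε → 0ℚ ℚ.< ε → ∃ λ N → ∀ n → N ≤ n → ℚ.∣ z n ∣ ℚ.< ε) →
  ∀ ε → 0ℚ ℚ.< ε → ∃ λ N → ∀ n → N ≤ n → ℚ.∣ z n ∣ ℚ.< ε
small-tail {z} cauchy-z ¬¬null ε 0<ε
  with N , h ← cauchy-z (½ ℚ.* (½ ℚ.* ε)) (half-pos (half-pos 0<ε))
  with ℚ.∣ z N ∣ ℚ.<? ½ ℚ.* ε
... | yes small = N , λ n N≤n → subst (ℚ.∣ z n ∣ ℚ.<_) (halves ε)
        (∣∣-chain (z n) (z N) (ℚ.<-trans (h n N N≤n ℕ.≤-refl) quarter) small)
  where
  quarter : ½ ℚ.* (½ ℚ.* ε) ℚ.< ½ ℚ.* ε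
  quarter = subst (½ ℚ.* (½ ℚ.* ε) ℚ.<_) (halves (½ ℚ.* ε))
    (subst (ℚ._< ½ ℚ.* (½ ℚ.* ε) ℚ.+ ½ ℚ.* (½ ℚ.* ε)) (ℚ.+-identityʳ _)
      (ℚ.+-monoʳ-< (½ ℚ.* (½ ℚ.* ε)) (half-pos (half-pos 0<ε))))
... | no large = contradiction refute ¬¬null
  where
  refute : ¬ (∀ ε → 0ℚ ℚ.< ε → ∃ λ N → ∀ n → N ≤ n → ℚ.∣ z n ∣ ℚ.< ε)
  refute p with M , k ← p (½ ℚ.* (½ ℚ.* ε)) (half-pos (half-pos 0<ε)) =
    large (subst (ℚ.∣ z N ∣ ℚ.<_) (halves (½ ℚ.* ε))
      (∣∣-chain (z N) (z (N ℕ.⊔ M)) (h N (N ℕ.⊔ M) ℕ.≤-refl (ℕ.m≤m⊔n N M)) (k (N ℕ.⊔ M) (ℕ.m≤n⊔m N M))))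

stableℝ : ∀ {x y} → ¬ ¬ x ≈ℝ y → x ≈ℝ y
stableℝ {x} {y} ¬¬x≈y = mk≈ (small-tail (cauchy (x -ℝ y)) (λ p → ¬¬x≈y (λ (mk≈ q) → p q)))

-- Lets the negative hypothesis E*W≢0 be used contrapositively.
stable : ∀ {z w} → ¬ ¬ z ≈ℂ w → z ≈ℂ w
stable h = stableℝ (λ p → h (λ (q , _) → p q)) , stableℝ (λ p → h (λ (_ , q) → p q))

-- Gaussian rationals have decidable equality, unlike `ℂ`. As coefficients they let the ring solver
-- normalise expressions that contain `𝐢` and fractions.
ℚ[𝐢]-rawRing : RawRing 0ℓ 0ℓ
ℚ[𝐢]-rawRing = record
  { Carrier = ℚ × ℚ
  ; _≈_ = _≡_
  ; _+_ = λ (a , b) (c , d) → a ℚ.+ c , b ℚ.+ d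
  ; _*_ = λ (a , b) (c , d) → a ℚ.* c ℚ.- b ℚ.* d , a ℚ.* d ℚ.+ b ℚ.* c
  ; -_  = λ (a , b) → ℚ.- a , ℚ.- b
  ; 0#  = 0ℚ , 0ℚ
  ; 1#  = 1ℚ , 0ℚ
  }

pointwiseℂ : ∀ {z w} → (∀ n → seq (re z) n ≡ seq (re w) n) → (∀ n → seq (im z) n ≡ seq (im w) n) → z ≈ℂ w
pointwiseℂ p q = pointwise p , pointwise q

gaussian-morphism : ℚ[𝐢]-rawRing -Raw-AlmostCommutative⟶ fromCommutativeRing ℂ-commutativeRing
gaussian-morphism = record
  { ⟦_⟧    = λ (a , b) → gaussian a b
  ; +-homo = λ _ _ → pointwiseℂ (λ _ → refl) (λ _ → refl)
  ; *-homo = λ _ _ → pointwiseℂ (λ _ → refl) (λ _ → refl)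
  ; -‿homo = λ _ → pointwiseℂ (λ _ → refl) (λ _ → refl)
  ; 0-homo = CommutativeRing.refl ℂ-commutativeRing
  ; 1-homo = CommutativeRing.refl ℂ-commutativeRing
  }

gaussian-≟ : (p q : ℚ × ℚ) → Maybe (gaussian (proj₁ p) (proj₂ p) ≈ℂ gaussian (proj₁ q) (proj₂ q))
gaussian-≟ p q with Product.≡-dec ℚ._≟_ ℚ._≟_ p q
... | yes refl = just (CommutativeRing.refl ℂ-commutativeRing)
... | no  _    = nothing

module ℂ-Solver = Algebra.Solver.Ring ℚ[𝐢]-rawRing (fromCommutativeRing ℂ-commutativeRing)
  gaussian-morphism gaussian-≟
open ℂ-Solver using (solve; _:=_; _:+_; _:*_; :-_; con; Polynomial)

:0 :1 :½ :𝐢 : ∀ {n} → Polynomial n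
:0 = con (0ℚ , 0ℚ)
:1 = con (1ℚ , 0ℚ)
:½ = con (½ , 0ℚ)
:𝐢 = con (0ℚ , 1ℚ)

open CommutativeRing ℂ-commutativeRing
  using (setoid; +-cong; +-congˡ; +-congʳ; +-assoc; +-comm; +-identityˡ; +-identityʳ;
         *-cong; *-congˡ; *-congʳ; *-assoc; *-comm; *-identityˡ; *-identityʳ;
         distribˡ; distribʳ; zeroˡ; zeroʳ)
  renaming (refl to ≈-refl; trans to ≈-trans; sym to ≈-sym; reflexive to ≈-reflexive)
open import Relation.Binary.Reasoning.Setoid setoid
open import Algebra.Properties.CommutativeSemiring.Exp
  (CommutativeRing.commutativeSemiring ℂ-commutativeRing)
  using (^-homo-*; ^-distrib-*; ^-congˡ; ^-assocʳ)
open KronInverse using (sumX-cong; sumX-scale)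

minus : ∀ z w → z -ℂ w ≈ℂ z +ℂ -ℂ w
minus z w = ≈ℝ-refl , ≈ℝ-refl

ι-+ : ∀ p q → ι (p ℚ.+ q) ≈ℂ ι p +ℂ ι q
ι-+ p q = pointwiseℂ (λ _ → refl) (λ _ → refl)

ι-* : ∀ p q → ι (p ℚ.* q) ≈ℂ ι p *ℂ ι q
ι-* p q = pointwiseℂ (λ _ → re-eq p q) (λ _ → im-eq p q)
  where
  re-eq : ∀ p q → p ℚ.* q ≡ p ℚ.* q ℚ.- 0ℚ ℚ.* 0ℚ
  re-eq = solveℚ 2 (λ p q → p ⊗ q ≐ p ⊗ q ⊝ conℚ 0ℚ ⊗ conℚ 0ℚ) refl
  im-eq : ∀ p q → 0ℚ ≡ p ℚ.* 0ℚ ℚ.+ 0ℚ ℚ.* q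
  im-eq = solveℚ 2 (λ p q → conℚ 0ℚ ≐ p ⊗ conℚ 0ℚ ⊕ conℚ 0ℚ ⊗ q) refl

ι-neg : ∀ p → ι (ℚ.- p) ≈ℂ -ℂ ι p
ι-neg p = pointwiseℂ (λ _ → refl) (λ _ → refl)

ν : ℕ → ℂ
ν n = ι (fromℕ n)

ν-cong : ∀ {m n} → m ≡ n → ν m ≈ℂ ν n
ν-cong eq = ≈-reflexive (cong ν eq)

ν-+ : ∀ m n → ν (m + n) ≈ℂ ν m +ℂ ν n
ν-+ m n = ≈-trans (≈-reflexive (cong ι (fromℕ-+ m n))) (ι-+ (fromℕ m) (fromℕ n))

cancel : ∀ {z w x y} → w *ℂ z ≈ℂ 1ℂ → z *ℂ x ≈ℂ z *ℂ y → x ≈ℂ y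
cancel {z} {w} {x} {y} wz≈1 zx≈zy = begin
  x             ≈⟨ undo x ⟨
  w *ℂ (z *ℂ x) ≈⟨ *-congˡ zx≈zy ⟩
  w *ℂ (z *ℂ y) ≈⟨ undo y ⟩
  y             ∎
  where
  undo : ∀ x → w *ℂ (z *ℂ x) ≈ℂ x
  undo x = ≈-trans (≈-sym (*-assoc w z x)) (≈-trans (*-congʳ wz≈1) (*-identityˡ x))

ι-inverseˡ : ∀ {q} → q ≢ 0ℚ → ι (q ⁻¹) *ℂ ι q ≈ℂ 1ℂ
ι-inverseˡ {q} q≢0 = ≈-trans (≈-sym (ι-* (q ⁻¹) q))
  (≈-reflexive (cong ι (trans (ℚ.*-comm (q ⁻¹) q) (⁻¹-inverseʳ q≢0))))

-- Polynomials

-- Horner's form of `Σ_{k<n} f k tᵏ`. No powers of `t` occur, so linearity is a direct induction; at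
-- `t = 1` it is the plain finite sum.
ev : ℕ → (ℕ → ℂ) → ℂ → ℂ
ev zero    f t = 0ℂ
ev (suc n) f t = f 0 +ℂ t *ℂ ev n (f ∘ suc) t

ev-cong : ∀ n {f g s t} → (∀ k → k < n → f k ≈ℂ g k) → s ≈ℂ t → ev n f s ≈ℂ ev n g t
ev-cong zero    h s≈t = ≈-refl
ev-cong (suc n) h s≈t = +-cong (h 0 (s≤s z≤n))
  (*-cong s≈t (ev-cong n (λ k k<n → h (suc k) (s≤s k<n)) s≈t))

ev-0 : ∀ n t → ev n (λ _ → 0ℂ) t ≈ℂ 0ℂ
ev-0 zero    t = ≈-refl
ev-0 (suc n) t = ≈-trans (+-identityˡ _) (≈-trans (*-congˡ (ev-0 n t)) (zeroʳ t))

ev-+ : ∀ n f g t → ev n (λ k → f k +ℂ g k) t ≈ℂ ev n f t +ℂ ev n g t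
ev-+ zero    f g t = ≈-sym (+-identityˡ 0ℂ)
ev-+ (suc n) f g t = ≈-trans (+-congˡ (*-congˡ (ev-+ n (f ∘ suc) (g ∘ suc) t)))
  (ring (f 0) (g 0) t (ev n (f ∘ suc) t) (ev n (g ∘ suc) t))
  where
  ring : ∀ a b t x y → a +ℂ b +ℂ t *ℂ (x +ℂ y) ≈ℂ (a +ℂ t *ℂ x) +ℂ (b +ℂ t *ℂ y)
  ring = solve 5 (λ a b t x y → a :+ b :+ t :* (x :+ y) := (a :+ t :* x) :+ (b :+ t :* y)) ≈-refl

ev-* : ∀ n c f t → ev n (λ k → c *ℂ f k) t ≈ℂ c *ℂ ev n f t
ev-* zero    c f t = ≈-sym (zeroʳ c)
ev-* (suc n) c f t = ≈-trans (+-congˡ (*-congˡ (ev-* n c (f ∘ suc) t)))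
  (ring c (f 0) t (ev n (f ∘ suc) t))
  where
  ring : ∀ c a t x → c *ℂ a +ℂ t *ℂ (c *ℂ x) ≈ℂ c *ℂ (a +ℂ t *ℂ x)
  ring = solve 4 (λ c a t x → c :* a :+ t :* (c :* x) := c :* (a :+ t :* x)) ≈-refl

ev-*ʳ : ∀ n c f t → ev n (λ k → f k *ℂ c) t ≈ℂ ev n f t *ℂ c
ev-*ʳ n c f t = ≈-trans (ev-cong n (λ k _ → *-comm (f k) c) ≈-refl)
  (≈-trans (ev-* n c f t) (*-comm c _))

ev-swap : ∀ m n (f : ℕ → ℕ → ℂ) s t → ev m (λ i → ev n (λ j → f i j) t) s ≈ℂ ev n (λ j → ev m (λ i → f i j) s) t
ev-swap zero    n f s t = ≈-sym (ev-0 n t)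
ev-swap (suc m) n f s t = begin
  ev n (f 0) t +ℂ s *ℂ ev m (λ i → ev n (f (suc i)) t) s             ≈⟨ +-congˡ (*-congˡ (ev-swap m n (f ∘ suc) s t)) ⟩
  ev n (f 0) t +ℂ s *ℂ ev n (λ j → ev m (λ i → f (suc i) j) s) t     ≈⟨ +-congˡ (ev-* n s _ t) ⟨
  ev n (f 0) t +ℂ ev n (λ j → s *ℂ ev m (λ i → f (suc i) j) s) t     ≈⟨ ev-+ n (f 0) _ t ⟨
  ev n (λ j → f 0 j +ℂ s *ℂ ev m (λ i → f (suc i) j) s) t            ∎

ev-scale : ∀ n c f t → ev n (λ k → c ^ℂ k *ℂ f k) t ≈ℂ ev n f (c *ℂ t)
ev-scale zero    c f t = ≈-refl
ev-scale (suc n) c f t = begin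
  1ℂ *ℂ f 0 +ℂ t *ℂ ev n (λ k → c *ℂ c ^ℂ k *ℂ f (suc k)) t
    ≈⟨ +-cong (*-identityˡ (f 0)) (*-congˡ (ev-cong n (λ k _ → *-assoc c (c ^ℂ k) (f (suc k))) ≈-refl)) ⟩
  f 0 +ℂ t *ℂ ev n (λ k → c *ℂ (c ^ℂ k *ℂ f (suc k))) t
    ≈⟨ +-congˡ (*-congˡ (≈-trans (ev-* n c _ t) (*-congˡ (ev-scale n c (f ∘ suc) t)))) ⟩
  f 0 +ℂ t *ℂ (c *ℂ ev n (f ∘ suc) (c *ℂ t))
    ≈⟨ +-congˡ (≈-trans (≈-sym (*-assoc t c _)) (*-congʳ (*-comm t c))) ⟩
  f 0 +ℂ (c *ℂ t) *ℂ ev n (f ∘ suc) (c *ℂ t) ∎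

ev-extend : ∀ {m n} f t → m ≤ n → (∀ k → m ≤ k → f k ≈ℂ 0ℂ) → ev n f t ≈ℂ ev m f t
ev-extend {n = n} f t z≤n h = ≈-trans (ev-cong n (λ k _ → h k z≤n) ≈-refl) (ev-0 n t)
ev-extend f t (s≤s m≤n) h = +-congˡ (*-congˡ (ev-extend (f ∘ suc) t m≤n (λ k m≤k → h (suc k) (s≤s m≤k))))

ev-sumℚ : ∀ n f → ι (sumℚ n f) ≈ℂ ev n (ι ∘ f) 1ℂ
ev-sumℚ zero    f = ≈-refl
ev-sumℚ (suc n) f = ≈-trans (ι-+ (f 0) _)
  (+-congˡ (≈-trans (ev-sumℚ n (f ∘ suc)) (≈-sym (*-identityˡ _))))

shift : ℕ → (ℕ → ℂ) → ℕ → ℂ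
shift zero    f k       = f k
shift (suc r) f zero    = 0ℂ
shift (suc r) f (suc k) = shift r f k

ev-shift : ∀ r n f t → ev (r + n) (shift r f) t ≈ℂ t ^ℂ r *ℂ ev n f t
ev-shift zero    n f t = ≈-sym (*-identityˡ _)
ev-shift (suc r) n f t = ≈-trans (+-identityˡ _)
  (≈-trans (*-congˡ (ev-shift r n f t)) (≈-sym (*-assoc t (t ^ℂ r) _)))

shift-+ : ∀ r f k → shift r f (r + k) ≡ f k
shift-+ zero    f k = refl
shift-+ (suc r) f k = shift-+ r f k

-- Synthetic division by t - s of the polynomial with coefficients f 0, …, f n.
quotient : ℕ → (ℕ → ℂ) → ℂ → ℕ → ℂ
quotient n       f s zero    = ev n (f ∘ suc) s
quotient zero    f s (suc k) = 0ℂ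
quotient (suc n) f s (suc k) = quotient n (f ∘ suc) s k

ev-quotient : ∀ n f s t → ev (suc n) f t ≈ℂ (t -ℂ s) *ℂ ev n (quotient n f s) t +ℂ ev (suc n) f s
ev-quotient zero    f s t = ring (f 0) s t (t -ℂ s)
  where
  ring : ∀ a s t u → a +ℂ t *ℂ 0ℂ ≈ℂ u *ℂ 0ℂ +ℂ (a +ℂ s *ℂ 0ℂ)
  ring = solve 4 (λ a s t u → a :+ t :* :0 := u :* :0 :+ (a :+ s :* :0)) ≈-refl
ev-quotient (suc n) f s t = begin
  f 0 +ℂ t *ℂ ev (suc n) (f ∘ suc) t
    ≈⟨ +-congˡ (*-congˡ (≈-trans (ev-quotient n (f ∘ suc) s t) (+-congʳ (*-congʳ (minus t s))))) ⟩
  f 0 +ℂ t *ℂ ((t +ℂ -ℂ s) *ℂ q +ℂ p)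
    ≈⟨ ring (f 0) t s q p ⟩
  (t +ℂ -ℂ s) *ℂ (p +ℂ t *ℂ q) +ℂ (f 0 +ℂ s *ℂ p)
    ≈⟨ +-congʳ (*-congʳ (minus t s)) ⟨
  (t -ℂ s) *ℂ (p +ℂ t *ℂ q) +ℂ (f 0 +ℂ s *ℂ p) ∎
  where
  p = ev (suc n) (f ∘ suc) s
  q = ev n (quotient n (f ∘ suc) s) t
  ring : ∀ a t s q p → a +ℂ t *ℂ ((t +ℂ -ℂ s) *ℂ q +ℂ p) ≈ℂ (t +ℂ -ℂ s) *ℂ (p +ℂ t *ℂ q) +ℂ (a +ℂ s *ℂ p)
  ring = solve 5 (λ a t s q p → a :+ t :* ((t :+ :- s) :* q :+ p) := (t :+ :- s) :* (p :+ t :* q) :+ (a :+ s :* p)) ≈-refl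

+-zeroˡ-cancel : ∀ {x y} → x +ℂ y ≈ℂ 0ℂ → y ≈ℂ 0ℂ → x ≈ℂ 0ℂ
+-zeroˡ-cancel {x} {y} sum≈0 y≈0 = ≈-trans (≈-sym (+-identityʳ x)) (≈-trans (+-congˡ (≈-sym y≈0)) sum≈0)

-- Horner's scheme read backwards: each quotient coefficient is the value at `s` of the polynomial
-- formed by the remaining coefficients, so its vanishing supplies the root hypothesis for the next
-- step.
quotient≈0 : ∀ n f s → ev (suc n) f s ≈ℂ 0ℂ → (∀ k → k < n → quotient n f s k ≈ℂ 0ℂ) →
  ∀ k → k < suc n → f k ≈ℂ 0ℂ
quotient≈0 zero    f s root q≈0 zero    _ = +-zeroˡ-cancel root (zeroʳ s)
quotient≈0 zero    f s root q≈0 (suc k) (s≤s ())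
quotient≈0 (suc n) f s root q≈0 zero    _ = +-zeroˡ-cancel root (≈-trans (*-congˡ (q≈0 0 (s≤s z≤n))) (zeroʳ s))
quotient≈0 (suc n) f s root q≈0 (suc k) (s≤s k<1+n) =
  quotient≈0 n (f ∘ suc) s (q≈0 0 (s≤s z≤n)) (λ l l<n → q≈0 (suc l) (s≤s l<n)) k k<1+n

-- Dividing by `t - N` leaves a quotient that vanishes at every `m > N`, because `m - N` is a
-- nonzero rational and hence has an explicit inverse. The bound `N` is there to grow during the
-- induction.
ev≈0⇒coefficients≈0 : ∀ n f N → (∀ m → N ≤ m → ev n f (ν m) ≈ℂ 0ℂ) → ∀ k → k < n → f k ≈ℂ 0ℂ
ev≈0⇒coefficients≈0 (suc n) f N root = quotient≈0 n f (ν N) (root N ℕ.≤-refl)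
  (ev≈0⇒coefficients≈0 n (quotient n f (ν N)) (suc N) λ m N<m →
    cancel {w = ι ((fromℕ m ℚ.- fromℕ N) ⁻¹)} (unit m N<m) (begin
      (ν m -ℂ ν N) *ℂ ev n (quotient n f (ν N)) (ν m)
        ≈⟨ +-identityʳ _ ⟨
      (ν m -ℂ ν N) *ℂ ev n (quotient n f (ν N)) (ν m) +ℂ 0ℂ
        ≈⟨ +-congˡ (root N ℕ.≤-refl) ⟨
      (ν m -ℂ ν N) *ℂ ev n (quotient n f (ν N)) (ν m) +ℂ ev (suc n) f (ν N)
        ≈⟨ ev-quotient n f (ν N) (ν m) ⟨
      ev (suc n) f (ν m)
        ≈⟨ root m (ℕ.<⇒≤ N<m) ⟩
      0ℂ
        ≈⟨ zeroʳ (ν m -ℂ ν N) ⟨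
      (ν m -ℂ ν N) *ℂ 0ℂ ∎))
  where
  difference≢0 : ∀ m → N < m → fromℕ m ℚ.- fromℕ N ≢ 0ℚ
  difference≢0 m N<m eq = ℕ.<⇒≢ N<m (sym (fromℕ-injective {m} {N} (trans (split (fromℕ m) (fromℕ N)) (trans (cong (ℚ._+ fromℕ N) eq) (ℚ.+-identityˡ (fromℕ N))))))
    where
    split : ∀ a b → a ≡ (a ℚ.- b) ℚ.+ b
    split = solveℚ 2 (λ a b → a ≐ (a ⊝ b) ⊕ b) refl
  unit : ∀ m → N < m → ι ((fromℕ m ℚ.- fromℕ N) ⁻¹) *ℂ (ν m -ℂ ν N) ≈ℂ 1ℂ
  unit m N<m = ≈-trans (*-congˡ (pointwiseℂ (λ _ → refl) (λ _ → refl))) (ι-inverseˡ (difference≢0 m N<m))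

ev-injective : ∀ n f g → (∀ m → ev n f (ν m) ≈ℂ ev n g (ν m)) → ∀ k → k < n → f k ≈ℂ g k
ev-injective n f g h k k<n = difference≈0 (ev≈0⇒coefficients≈0 n (λ k → f k +ℂ -ℂ 1ℂ *ℂ g k) 0 root k k<n)
  where
  root : ∀ m → 0 ≤ m → ev n (λ k → f k +ℂ -ℂ 1ℂ *ℂ g k) (ν m) ≈ℂ 0ℂ
  root m _ = begin
    ev n (λ k → f k +ℂ -ℂ 1ℂ *ℂ g k) (ν m)       ≈⟨ ev-+ n f _ (ν m) ⟩
    ev n f (ν m) +ℂ ev n (λ k → -ℂ 1ℂ *ℂ g k) (ν m) ≈⟨ +-cong (h m) (ev-* n (-ℂ 1ℂ) g (ν m)) ⟩
    ev n g (ν m) +ℂ -ℂ 1ℂ *ℂ ev n g (ν m)        ≈⟨ solve 1 (λ x → x :+ :- :1 :* x := :0) ≈-refl (ev n g (ν m)) ⟩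
    0ℂ                                            ∎
  difference≈0 : ∀ {x y} → x +ℂ -ℂ 1ℂ *ℂ y ≈ℂ 0ℂ → x ≈ℂ y
  difference≈0 {x} {y} eq = begin
    x                          ≈⟨ solve 2 (λ x y → x := (x :+ :- :1 :* y) :+ y) ≈-refl x y ⟩
    (x +ℂ -ℂ 1ℂ *ℂ y) +ℂ y     ≈⟨ +-congʳ eq ⟩
    0ℂ +ℂ y                    ≈⟨ +-identityˡ y ⟩
    y                          ∎

-- For each `m`, comparing coefficients in the outer variable makes the inner polynomials agree at
-- `m`; these are then compared in turn.
ev²-injective : ∀ n (f g : ℕ → ℕ → ℂ) →
  (∀ l m → ev n (λ i → ev n (f i) (ν m)) (ν l) ≈ℂ ev n (λ i → ev n (g i) (ν m)) (ν l)) →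
  ∀ i j → i < n → j < n → f i j ≈ℂ g i j
ev²-injective n f g h i j i<n j<n = ev-injective n (f i) (g i)
  (λ m → ev-injective n (λ i → ev n (f i) (ν m)) (λ i → ev n (g i) (ν m)) (λ l → h l m) i i<n) j j<n

-- Binomial theorem and generating function of the Krawtchouk polynomials

binomial : ∀ d n Y x → d < n → ev n (λ k → ν (d C k) *ℂ Y ^ℂ (d ∸ k)) x ≈ℂ (Y +ℂ x) ^ℂ d
binomial zero (suc n) Y x _ = begin
  1ℂ *ℂ 1ℂ +ℂ x *ℂ ev n (λ k → ν (0 C suc k) *ℂ 1ℂ) x
    ≈⟨ +-cong (*-identityˡ 1ℂ) (*-congˡ (≈-trans (ev-cong n (λ k _ → ≈-trans (*-congʳ (ν-cong (k>n⇒nCk≡0 {0} {suc k} (s≤s z≤n)))) (zeroˡ 1ℂ)) ≈-refl) (ev-0 n x))) ⟩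
  1ℂ +ℂ x *ℂ 0ℂ
    ≈⟨ ≈-trans (+-congˡ (zeroʳ x)) (+-identityʳ 1ℂ) ⟩
  1ℂ ∎
binomial (suc d) (suc n) Y x (s≤s d<n) = begin
  ev (suc n) (λ k → ν (suc d C k) *ℂ Y ^ℂ (suc d ∸ k)) x
    ≈⟨ ev-cong (suc n) (λ k _ → pascal k) ≈-refl ⟩
  ev (suc n) (λ k → Y *ℂ c k +ℂ shift 1 c k) x
    ≈⟨ ≈-trans (ev-+ (suc n) (λ k → Y *ℂ c k) (shift 1 c) x) (+-cong (ev-* (suc n) Y c x) (ev-shift 1 n c x)) ⟩
  Y *ℂ ev (suc n) c x +ℂ x ^ℂ 1 *ℂ ev n c x
    -- The lengths `suc n` and `n` both occur with the same `d`; this is why the theorem is stated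
    -- for every length above `d`.
    ≈⟨ +-cong (*-congˡ (binomial d (suc n) Y x (ℕ.m<n⇒m<1+n d<n))) (*-cong (*-identityʳ x) (binomial d n Y x d<n)) ⟩
  Y *ℂ (Y +ℂ x) ^ℂ d +ℂ x *ℂ (Y +ℂ x) ^ℂ d
    ≈⟨ distribʳ _ Y x ⟨
  (Y +ℂ x) ^ℂ suc d ∎
  where
  c : ℕ → ℂ
  c k = ν (d C k) *ℂ Y ^ℂ (d ∸ k)
  -- With truncated subtraction `d ∸ k` is `1 + (d ∸ suc k)` only for `k < d`; beyond that the
  -- binomial coefficient vanishes.
  raise : ∀ k → ν (d C suc k) *ℂ Y ^ℂ (d ∸ k) ≈ℂ Y *ℂ (ν (d C suc k) *ℂ Y ^ℂ (d ∸ suc k))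
  raise k with k ℕ.<? d
  ... | yes k<d = ≈-trans
    (*-congˡ (≈-reflexive (cong (Y ^ℂ_) (ℕ.+-∸-assoc 1 k<d))))
    (solve 3 (λ a Y p → a :* (Y :* p) := Y :* (a :* p)) ≈-refl (ν (d C suc k)) Y (Y ^ℂ (d ∸ suc k)))
  ... | no  k≮d = ≈-trans (≈-trans (*-congʳ C≈0) (zeroˡ _))
    (≈-sym (≈-trans (*-congˡ (≈-trans (*-congʳ C≈0) (zeroˡ _))) (zeroʳ Y)))
    where
    C≈0 : ν (d C suc k) ≈ℂ 0ℂ
    C≈0 = ν-cong (k>n⇒nCk≡0 (s≤s (ℕ.≮⇒≥ k≮d)))
  pascal : ∀ k → ν (suc d C k) *ℂ Y ^ℂ (suc d ∸ k) ≈ℂ Y *ℂ c k +ℂ shift 1 c k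
  pascal zero    = solve 3 (λ a Y p → a :* (Y :* p) := Y :* (a :* p) :+ :0) ≈-refl 1ℂ Y (Y ^ℂ d)
  pascal (suc k) = begin
    ν (suc d C suc k) *ℂ Y ^ℂ (d ∸ k)
      ≈⟨ *-congʳ (≈-trans (ν-cong (sym (nCk+nC[k+1]≡[n+1]C[k+1] d k))) (ν-+ (d C k) (d C suc k))) ⟩
    (ν (d C k) +ℂ ν (d C suc k)) *ℂ Y ^ℂ (d ∸ k)
      ≈⟨ solve 3 (λ a b p → (a :+ b) :* p := b :* p :+ a :* p) ≈-refl (ν (d C k)) (ν (d C suc k)) (Y ^ℂ (d ∸ k)) ⟩
    ν (d C suc k) *ℂ Y ^ℂ (d ∸ k) +ℂ ν (d C k) *ℂ Y ^ℂ (d ∸ k)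
      ≈⟨ +-congʳ (raise k) ⟩
    Y *ℂ c (suc k) +ℂ shift 1 c (suc k) ∎

1^n≈1 : ∀ n → 1ℂ ^ℂ n ≈ℂ 1ℂ
1^n≈1 zero    = ≈-refl
1^n≈1 (suc n) = ≈-trans (*-identityˡ _) (1^n≈1 n)

shiftedC-generating : ∀ {d n} t → n ≤ d →
  ev (suc d) (λ i → ν (shiftedC d n i)) t ≈ℂ t ^ℂ n *ℂ (1ℂ +ℂ t) ^ℂ (d ∸ n)
shiftedC-generating {d} t z≤n = begin
  ev (suc d) (λ i → ν (d C i)) t                     ≈⟨ ev-cong (suc d) {f = λ i → ν (d C i)} {s = t} (λ i _ → ≈-sym (≈-trans (*-congˡ (1^n≈1 (d ∸ i))) (*-identityʳ _))) ≈-refl ⟩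
  ev (suc d) (λ i → ν (d C i) *ℂ 1ℂ ^ℂ (d ∸ i)) t    ≈⟨ binomial d (suc d) 1ℂ t (ℕ.n<1+n d) ⟩
  (1ℂ +ℂ t) ^ℂ d                                     ≈⟨ *-identityˡ _ ⟨
  1ℂ *ℂ (1ℂ +ℂ t) ^ℂ d                               ∎
shiftedC-generating {suc d} {suc n} t (s≤s n≤d) = ≈-trans (+-identityˡ _)
  (≈-trans (*-congˡ (shiftedC-generating t n≤d)) (≈-sym (*-assoc t (t ^ℂ n) _)))

krawtchouk : ℕ → ℕ → ℕ → ℂ
krawtchouk d i j = ι (sumℚ (suc d) (krawtchoukTerm d i j))

sign-2^ : ∀ n → ι (sign n ℚ.* fromℕ (2 ℕ.^ n)) ≈ℂ (-ℂ (1ℂ +ℂ 1ℂ)) ^ℂ n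
sign-2^ zero    = ≈-refl
sign-2^ (suc n) = begin
  ι (ℚ.- sign n ℚ.* fromℕ (2 * 2 ℕ.^ n))                     ≈⟨ ≈-reflexive (cong (λ q → ι (ℚ.- sign n ℚ.* q)) (fromℕ-* 2 (2 ℕ.^ n))) ⟩
  ι (ℚ.- sign n ℚ.* (fromℕ 2 ℚ.* fromℕ (2 ℕ.^ n)))           ≈⟨ ≈-trans (ι-* (ℚ.- sign n) _) (*-cong (ι-neg (sign n)) (≈-trans (ι-* (fromℕ 2) _) (*-congʳ (ν-+ 1 1)))) ⟩
  -ℂ ι (sign n) *ℂ ((1ℂ +ℂ 1ℂ) *ℂ ι (fromℕ (2 ℕ.^ n)))       ≈⟨ solve 3 (λ s a t → :- s :* (a :* t) := :- a :* (s :* t)) ≈-refl (ι (sign n)) (1ℂ +ℂ 1ℂ) (ι (fromℕ (2 ℕ.^ n))) ⟩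
  -ℂ (1ℂ +ℂ 1ℂ) *ℂ (ι (sign n) *ℂ ι (fromℕ (2 ℕ.^ n)))       ≈⟨ *-congˡ (≈-trans (≈-sym (ι-* (sign n) _)) (sign-2^ n)) ⟩
  (-ℂ (1ℂ +ℂ 1ℂ)) ^ℂ suc n                                   ∎

ev-separate : ∀ l m n (w : ℕ → ℂ) (g h : ℕ → ℕ → ℂ) r s t →
  ev l (λ i → ev m (λ j → ev n (λ k → w k *ℂ g k i *ℂ h k j) t) s) r ≈ℂ
  ev n (λ k → w k *ℂ ev l (g k) r *ℂ ev m (h k) s) t
ev-separate l m n w g h r s t = begin
  ev l (λ i → ev m (λ j → ev n (λ k → w k *ℂ g k i *ℂ h k j) t) s) r
    ≈⟨ ev-cong l (λ i _ → ≈-trans (ev-swap m n (λ j k → w k *ℂ g k i *ℂ h k j) s t)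
         (ev-cong n (λ k _ → ev-* m (w k *ℂ g k i) (h k) s) ≈-refl)) ≈-refl ⟩
  ev l (λ i → ev n (λ k → w k *ℂ g k i *ℂ ev m (h k) s) t) r
    ≈⟨ ev-swap l n (λ i k → w k *ℂ g k i *ℂ ev m (h k) s) r t ⟩
  ev n (λ k → ev l (λ i → w k *ℂ g k i *ℂ ev m (h k) s) r) t
    ≈⟨ ev-cong n (λ k _ → ≈-trans (ev-*ʳ l (ev m (h k) s) (λ i → w k *ℂ g k i) r) (*-congʳ (ev-* l (w k) (g k) r))) ≈-refl ⟩
  ev n (λ k → w k *ℂ ev l (g k) r *ℂ ev m (h k) s) t ∎

-- Summing over `i` and `j` before `n` leaves the terms `(-2αβ)ⁿ C(d,n) ((1+α)(1+β))^(d-n)`, so the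
-- binomial theorem gives `((1+α)(1+β) - 2αβ)ᵈ`.
krawtchouk-generating : ∀ d α β →
  ev (suc d) (λ i → ev (suc d) (λ j → krawtchouk d i j) β) α ≈ℂ (1ℂ +ℂ α +ℂ β +ℂ -ℂ (α *ℂ β)) ^ℂ d
krawtchouk-generating d α β = begin
  ev N (λ i → ev N (λ j → krawtchouk d i j) β) α
    ≈⟨ ev-cong N {s = α} (λ i _ → ev-cong N {s = β} (λ j _ →
         ≈-trans (ev-sumℚ N (krawtchoukTerm d i j)) (ev-cong N {s = 1ℂ} (λ n _ → term i j n) ≈-refl)) ≈-refl) ≈-refl ⟩
  ev N (λ i → ev N (λ j → ev N (λ n → w n *ℂ g n i *ℂ g n j) 1ℂ) β) α
    ≈⟨ ev-separate N N N w g g α β 1ℂ ⟩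
  ev N (λ n → w n *ℂ ev N (g n) α *ℂ ev N (g n) β) 1ℂ
    ≈⟨ ev-cong N {s = 1ℂ} (λ n n<N → combine n (ℕ.≤-pred n<N)) ≈-refl ⟩
  ev N (λ n → (s *ℂ (α *ℂ β)) ^ℂ n *ℂ (ν (d C n) *ℂ Y ^ℂ (d ∸ n))) 1ℂ
    ≈⟨ ev-scale N (s *ℂ (α *ℂ β)) (λ n → ν (d C n) *ℂ Y ^ℂ (d ∸ n)) 1ℂ ⟩
  ev N (λ n → ν (d C n) *ℂ Y ^ℂ (d ∸ n)) (s *ℂ (α *ℂ β) *ℂ 1ℂ)
    ≈⟨ binomial d N Y _ (ℕ.n<1+n d) ⟩
  (Y +ℂ s *ℂ (α *ℂ β) *ℂ 1ℂ) ^ℂ d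
    ≈⟨ ^-congˡ d (solve 2 (λ α β → (:1 :+ α) :* (:1 :+ β) :+ :- (:1 :+ :1) :* (α :* β) :* :1 := :1 :+ α :+ β :+ :- (α :* β)) ≈-refl α β) ⟩
  (1ℂ +ℂ α +ℂ β +ℂ -ℂ (α *ℂ β)) ^ℂ d ∎
  where
  N = suc d
  s = -ℂ (1ℂ +ℂ 1ℂ)
  Y = (1ℂ +ℂ α) *ℂ (1ℂ +ℂ β)
  w : ℕ → ℂ
  w n = s ^ℂ n *ℂ ν (d C n)
  g : ℕ → ℕ → ℂ
  g n i = ν (shiftedC d n i)
  term : ∀ i j n → ι (krawtchoukTerm d i j n) ≈ℂ w n *ℂ g n i *ℂ g n j
  term i j n = ≈-trans (ι-* _ (fromℕ (shiftedC d n j))) (*-congʳ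
    (≈-trans (ι-* _ (fromℕ (shiftedC d n i))) (*-congʳ
      (≈-trans (ι-* _ (fromℕ (d C n))) (*-congʳ (sign-2^ n))))))
  combine : ∀ n → n ≤ d → w n *ℂ ev N (g n) α *ℂ ev N (g n) β ≈ℂ
    (s *ℂ (α *ℂ β)) ^ℂ n *ℂ (ν (d C n) *ℂ Y ^ℂ (d ∸ n))
  combine n n≤d = begin
    w n *ℂ ev N (g n) α *ℂ ev N (g n) β
      ≈⟨ *-cong (*-congˡ (shiftedC-generating α n≤d)) (shiftedC-generating β n≤d) ⟩
    s ^ℂ n *ℂ ν (d C n) *ℂ (α ^ℂ n *ℂ (1ℂ +ℂ α) ^ℂ (d ∸ n)) *ℂ (β ^ℂ n *ℂ (1ℂ +ℂ β) ^ℂ (d ∸ n))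
      ≈⟨ solve 6 (λ s c a p b q → s :* c :* (a :* p) :* (b :* q) := (s :* (a :* b)) :* (c :* (p :* q))) ≈-refl
           (s ^ℂ n) (ν (d C n)) (α ^ℂ n) ((1ℂ +ℂ α) ^ℂ (d ∸ n)) (β ^ℂ n) ((1ℂ +ℂ β) ^ℂ (d ∸ n)) ⟩
    s ^ℂ n *ℂ (α ^ℂ n *ℂ β ^ℂ n) *ℂ (ν (d C n) *ℂ ((1ℂ +ℂ α) ^ℂ (d ∸ n) *ℂ (1ℂ +ℂ β) ^ℂ (d ∸ n)))
      ≈⟨ *-cong (≈-trans (^-distrib-* s (α *ℂ β) n) (*-congˡ (^-distrib-* α β n))) (*-congˡ (^-distrib-* (1ℂ +ℂ α) (1ℂ +ℂ β) (d ∸ n))) ⟨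
    (s *ℂ (α *ℂ β)) ^ℂ n *ℂ (ν (d C n) *ℂ Y ^ℂ (d ∸ n)) ∎

private variable
  D : ℕ

≋-trans : ∀ {u v w : V D} → u ≋ v → v ≋ w → u ≋ w
≋-trans p q y = ≈-trans (p y) (q y)

≋-sym : ∀ {v w : V D} → v ≋ w → w ≋ v
≋-sym p y = ≈-sym (p y)

-- Matrices on the cube

sumX-+ : ∀ (f g : X D → ℂ) → sumX (λ y → f y +ℂ g y) ≈ℂ sumX f +ℂ sumX g
sumX-+ {zero}  f g = ≈-refl
sumX-+ {suc D} f g = ≈-trans (+-cong (sumX-+ (f ∘ (0F ∷_)) (g ∘ (0F ∷_))) (sumX-+ (f ∘ (1F ∷_)) (g ∘ (1F ∷_))))
  (solve 4 (λ a b c d → (a :+ b) :+ (c :+ d) := (a :+ c) :+ (b :+ d)) ≈-refl _ _ _ _)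

sumX-0 : ∀ {f : X D → ℂ} → (∀ y → f y ≈ℂ 0ℂ) → sumX f ≈ℂ 0ℂ
sumX-0 {zero}  h = h []
sumX-0 {suc D} h = ≈-trans (+-cong (sumX-0 (h ∘ (0F ∷_))) (sumX-0 (h ∘ (1F ∷_)))) (+-identityˡ 0ℂ)

sumX-swap : ∀ {D D′} (f : X D → X D′ → ℂ) → sumX (λ y → sumX (f y)) ≈ℂ sumX (λ z → sumX (λ y → f y z))
sumX-swap {zero}  f = ≈-refl
sumX-swap {suc D} f = ≈-trans (+-cong (sumX-swap (f ∘ (0F ∷_))) (sumX-swap (f ∘ (1F ∷_))))
  (≈-sym (sumX-+ (λ z → sumX (λ y → f (0F ∷ y) z)) (λ z → sumX (λ y → f (1F ∷ y) z))))

sumX-scaleʳ : ∀ c (f : X D → ℂ) → sumX (λ y → f y *ℂ c) ≈ℂ sumX f *ℂ c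
sumX-scaleʳ c f = ≈-trans (sumX-cong (λ y → *-comm (f y) c)) (≈-trans (sumX-scale c f) (*-comm c _))

·-congˡ : ∀ (M : Mat D) {v w} → v ≋ w → M · v ≋ M · w
·-congˡ M p y = sumX-cong (λ z → *-congˡ (p z))

·-assoc : ∀ (M N : Mat D) v → (M *ᴹ N) · v ≋ M · (N · v)
·-assoc M N v y = begin
  sumX (λ z → sumX (λ w → M y w *ℂ N w z) *ℂ v z)     ≈⟨ sumX-cong (λ z → sumX-scaleʳ (v z) (λ w → M y w *ℂ N w z)) ⟨
  sumX (λ z → sumX (λ w → M y w *ℂ N w z *ℂ v z))     ≈⟨ sumX-swap (λ z w → M y w *ℂ N w z *ℂ v z) ⟩
  sumX (λ w → sumX (λ z → M y w *ℂ N w z *ℂ v z))     ≈⟨ sumX-cong (λ w → sumX-cong (λ z → *-assoc (M y w) (N w z) (v z))) ⟩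
  sumX (λ w → sumX (λ z → M y w *ℂ (N w z *ℂ v z)))   ≈⟨ sumX-cong (λ w → sumX-scale (M y w) (λ z → N w z *ℂ v z)) ⟩
  sumX (λ w → M y w *ℂ sumX (λ z → N w z *ℂ v z))     ∎

·-•ᴹ : ∀ c (M : Mat D) v → (c •ᴹ M) · v ≋ c •ⱽ (M · v)
·-•ᴹ c M v y = ≈-trans (sumX-cong (λ z → *-assoc c (M y z) (v z))) (sumX-scale c (λ z → M y z *ℂ v z))

·--ᴹ : ∀ (M N : Mat D) v → (M -ᴹ N) · v ≋ (M · v) +ⱽ ((-ℂ 1ℂ) •ⱽ (N · v))
·--ᴹ M N v y = begin
  sumX (λ z → (M y z -ℂ N y z) *ℂ v z)
    ≈⟨ sumX-cong (λ z → ≈-trans (*-congʳ (minus (M y z) (N y z)))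
         (solve 3 (λ m n v → (m :+ :- n) :* v := m :* v :+ :- :1 :* (n :* v)) ≈-refl (M y z) (N y z) (v z))) ⟩
  sumX (λ z → M y z *ℂ v z +ℂ -ℂ 1ℂ *ℂ (N y z *ℂ v z))
    ≈⟨ sumX-+ (λ z → M y z *ℂ v z) (λ z → -ℂ 1ℂ *ℂ (N y z *ℂ v z)) ⟩
  sumX (λ z → M y z *ℂ v z) +ℂ sumX (λ z → -ℂ 1ℂ *ℂ (N y z *ℂ v z))
    ≈⟨ +-congˡ (sumX-scale (-ℂ 1ℂ) (λ z → N y z *ℂ v z)) ⟩
  sumX (λ z → M y z *ℂ v z) +ℂ -ℂ 1ℂ *ℂ sumX (λ z → N y z *ℂ v z) ∎

diag-· : ∀ f (v : V D) y → (diag f · v) y ≈ℂ f y *ℂ v y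
diag-· f v []       = ≈-refl
diag-· f v (0F ∷ y) = ≈-trans (+-cong (diag-· (f ∘ (0F ∷_)) (v ∘ (0F ∷_)) y) (sumX-0 (λ z → zeroˡ (v (1F ∷ z))))) (+-identityʳ _)
diag-· f v (1F ∷ y) = ≈-trans (+-cong (sumX-0 (λ z → zeroˡ (v (0F ∷ z)))) (diag-· (f ∘ (1F ∷_)) (v ∘ (1F ∷_)) y)) (+-identityˡ _)

I-· : ∀ (v : V D) → I · v ≋ v
I-· v y = ≈-trans (diag-· (λ _ → 1ℂ) v y) (*-identityˡ (v y))

weight : X D → ℕ
weight = ∂ 𝟎

weight≤ : ∀ (y : X D) → weight y ≤ D
weight≤ []       = z≤n
weight≤ (0F ∷ y) = ℕ.m≤n⇒m≤1+n (weight≤ y)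
weight≤ (1F ∷ y) = s≤s (weight≤ y)

indicator : Bool → ℂ
indicator b = if b then 1ℂ else 0ℂ

-- Once first coordinates differ, adjacency demands difference 0 in the others, so the off-diagonal
-- blocks of `A` are identity matrices. The test `≡ᵇ 0` is what `does (suc n ≟ 1)` computes to.
sumX-equal : ∀ (v : V D) y → sumX (λ z → indicator (differences y z ℕ.≡ᵇ 0) *ℂ v z) ≈ℂ v y
sumX-equal v []       = *-identityˡ (v [])
sumX-equal v (0F ∷ y) = ≈-trans (+-cong (sumX-equal (v ∘ (0F ∷_)) y) (sumX-0 (λ z → zeroˡ (v (1F ∷ z))))) (+-identityʳ _)
sumX-equal v (1F ∷ y) = ≈-trans (+-cong (sumX-0 (λ z → zeroˡ (v (0F ∷ z)))) (sumX-equal (v ∘ (1F ∷_)) y)) (+-identityˡ _)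

A-·-0 : ∀ (v : V (suc D)) y → (A · v) (0F ∷ y) ≈ℂ (A · (v ∘ (0F ∷_))) y +ℂ v (1F ∷ y)
A-·-0 v y = +-congˡ (sumX-equal (v ∘ (1F ∷_)) y)

A-·-1 : ∀ (v : V (suc D)) y → (A · v) (1F ∷ y) ≈ℂ (A · (v ∘ (1F ∷_))) y +ℂ v (0F ∷ y)
A-·-1 v y = ≈-trans (+-congʳ (sumX-equal (v ∘ (0F ∷_)) y)) (+-comm _ _)

-- Kronecker powers of 2×2 matrices

Mat₂ : Set
Mat₂ = Fin 2 → Fin 2 → ℂ

-- The action of the Kronecker power of M.
act : Mat₂ → V D → V D
act M v []      = v []
act M v (a ∷ y) = M a 0F *ℂ act M (v ∘ (0F ∷_)) y +ℂ M a 1F *ℂ act M (v ∘ (1F ∷_)) y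

Kron-· : ∀ M (v : V D) → Kron M · v ≋ act M v
Kron-· M v []      = *-identityˡ (v [])
Kron-· M v (a ∷ y) = +-cong (part 0F) (part 1F)
  where
  part : ∀ b → sumX (λ z → M a b *ℂ Kron M y z *ℂ v (b ∷ z)) ≈ℂ M a b *ℂ act M (v ∘ (b ∷_)) y
  part b = ≈-trans (sumX-cong (λ z → *-assoc (M a b) (Kron M y z) (v (b ∷ z))))
    (≈-trans (sumX-scale (M a b) (λ z → Kron M y z *ℂ v (b ∷ z))) (*-congˡ (Kron-· M (v ∘ (b ∷_)) y)))

act-cong : ∀ {M N : Mat₂} {v w : V D} → (∀ a b → M a b ≈ℂ N a b) → v ≋ w → act M v ≋ act N w
act-cong p q []      = q []
act-cong p q (a ∷ y) = +-cong (*-cong (p a 0F) (act-cong p (q ∘ (0F ∷_)) y)) (*-cong (p a 1F) (act-cong p (q ∘ (1F ∷_)) y))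

act-congˡ : ∀ (M : Mat₂) {v w : V D} → v ≋ w → act M v ≋ act M w
act-congˡ M = act-cong (λ _ _ → ≈-refl)

act-congʳ : ∀ {M N : Mat₂} (v : V D) → (∀ a b → M a b ≈ℂ N a b) → act M v ≋ act N v
act-congʳ v p = act-cong p (λ _ → ≈-refl)

act-+ : ∀ M (v w : V D) → act M (v +ⱽ w) ≋ act M v +ⱽ act M w
act-+ M v w []      = ≈-refl
act-+ M v w (a ∷ y) = ≈-trans
  (+-cong (*-congˡ (act-+ M (v ∘ (0F ∷_)) (w ∘ (0F ∷_)) y)) (*-congˡ (act-+ M (v ∘ (1F ∷_)) (w ∘ (1F ∷_)) y)))
  (solve 6 (λ m n a b c d → m :* (a :+ b) :+ n :* (c :+ d) := (m :* a :+ n :* c) :+ (m :* b :+ n :* d)) ≈-refl _ _ _ _ _ _)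

act-• : ∀ M c (v : V D) → act M (c •ⱽ v) ≋ c •ⱽ act M v
act-• M c v []      = ≈-refl
act-• M c v (a ∷ y) = ≈-trans
  (+-cong (*-congˡ (act-• M c (v ∘ (0F ∷_)) y)) (*-congˡ (act-• M c (v ∘ (1F ∷_)) y)))
  (solve 5 (λ m n c a b → m :* (c :* a) :+ n :* (c :* b) := c :* (m :* a :+ n :* b)) ≈-refl _ _ _ _ _)

infixr 7 _⊡_
_⊡_ : Mat₂ → Mat₂ → Mat₂
(M ⊡ N) a b = M a 0F *ℂ N 0F b +ℂ M a 1F *ℂ N 1F b

act-⊡ : ∀ M N (v : V D) → act M (act N v) ≋ act (M ⊡ N) v
act-⊡ M N v []      = ≈-refl
act-⊡ {suc D} M N v (a ∷ y) = ≈-trans (+-cong (*-congˡ (row 0F)) (*-congˡ (row 1F)))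
  (solve 8 (λ m n p q r s x z → m :* (p :* x :+ q :* z) :+ n :* (r :* x :+ s :* z) :=
     (m :* p :+ n :* r) :* x :+ (m :* q :+ n :* s) :* z) ≈-refl (M a 0F) (M a 1F) (N 0F 0F) (N 0F 1F) (N 1F 0F) (N 1F 1F) _ _)
  where
  v₀ v₁ : V D
  v₀ = v ∘ (0F ∷_)
  v₁ = v ∘ (1F ∷_)
  row : ∀ b → act M (act N v ∘ (b ∷_)) y ≈ℂ N b 0F *ℂ act (M ⊡ N) v₀ y +ℂ N b 1F *ℂ act (M ⊡ N) v₁ y
  row b = ≈-trans (act-+ M (N b 0F •ⱽ act N v₀) (N b 1F •ⱽ act N v₁) y)
    (+-cong (≈-trans (act-• M (N b 0F) (act N v₀) y) (*-congˡ (act-⊡ M N v₀ y)))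
            (≈-trans (act-• M (N b 1F) (act N v₁) y) (*-congˡ (act-⊡ M N v₁ y))))

diag₂ : ℂ → ℂ → Mat₂
diag₂ p q 0F 0F = p
diag₂ p q 0F 1F = 0ℂ
diag₂ p q 1F 0F = 0ℂ
diag₂ p q 1F 1F = q

act-diag₂ : ∀ c (v : V D) y → act (diag₂ 1ℂ c) v y ≈ℂ c ^ℂ weight y *ℂ v y
act-diag₂ c v []       = ≈-sym (*-identityˡ (v []))
act-diag₂ c v (0F ∷ y) = ≈-trans
  (solve 2 (λ x z → :1 :* x :+ :0 :* z := x) ≈-refl _ _) (act-diag₂ c (v ∘ (0F ∷_)) y)
act-diag₂ c v (1F ∷ y) = ≈-trans
  (solve 3 (λ c x z → :0 :* x :+ c :* z := c :* z) ≈-refl c _ _)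
  (≈-trans (*-congˡ (act-diag₂ c (v ∘ (1F ∷_)) y)) (≈-sym (*-assoc c _ _)))

act-scalar : ∀ c M (v : V D) → act (λ a b → c *ℂ M a b) v ≋ c ^ℂ D •ⱽ act M v
act-scalar c M v []      = ≈-sym (*-identityˡ (v []))
act-scalar c M v (a ∷ y) = ≈-trans
  (+-cong (*-congˡ (act-scalar c M (v ∘ (0F ∷_)) y)) (*-congˡ (act-scalar c M (v ∘ (1F ∷_)) y)))
  (solve 6 (λ c e m n x z → c :* m :* (e :* x) :+ c :* n :* (e :* z) := c :* e :* (m :* x :+ n :* z)) ≈-refl c _ _ _ _ _)

act-I : ∀ (v : V D) → act (diag₂ 1ℂ 1ℂ) v ≋ v
act-I v y = ≈-trans (act-diag₂ 1ℂ v y) (≈-trans (*-congʳ (1^n≈1 (weight y))) (*-identityˡ (v y)))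

-- The Hermitian form and adjoints

conj-+ : ∀ z w → conj (z +ℂ w) ≈ℂ conj z +ℂ conj w
conj-+ z w = pointwiseℂ (λ _ → refl) (λ n → ℚ.neg-distrib-+ (seq (im z) n) (seq (im w) n))

conj-* : ∀ z w → conj (z *ℂ w) ≈ℂ conj z *ℂ conj w
conj-* z w = pointwiseℂ (λ n → re-eq (seq (re z) n) (seq (im z) n) (seq (re w) n) (seq (im w) n))
                        (λ n → im-eq (seq (re z) n) (seq (im z) n) (seq (re w) n) (seq (im w) n))
  where
  re-eq : ∀ a b c d → a ℚ.* c ℚ.- b ℚ.* d ≡ a ℚ.* c ℚ.- ℚ.- b ℚ.* ℚ.- d
  re-eq = solveℚ 4 (λ a b c d → a ⊗ c ⊝ b ⊗ d ≐ a ⊗ c ⊝ (⊝ b) ⊗ (⊝ d)) refl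
  im-eq : ∀ a b c d → ℚ.- (a ℚ.* d ℚ.+ b ℚ.* c) ≡ a ℚ.* ℚ.- d ℚ.+ ℚ.- b ℚ.* c
  im-eq = solveℚ 4 (λ a b c d → ⊝ (a ⊗ d ⊕ b ⊗ c) ≐ a ⊗ (⊝ d) ⊕ (⊝ b) ⊗ c) refl

conj-involutive : ∀ z → conj (conj z) ≈ℂ z
conj-involutive z = pointwiseℂ (λ _ → refl) (λ n → ⁻¹-involutive (seq (im z) n))

conj-cong : ∀ {z w} → z ≈ℂ w → conj z ≈ℂ conj w
conj-cong (p , q) = p , -ℝ-cong q

⟨⟩-cong : ∀ {u v w x : V D} → u ≋ v → w ≋ x → ⟨ u , w ⟩ ≈ℂ ⟨ v , x ⟩
⟨⟩-cong p q = sumX-cong (λ y → *-cong (p y) (conj-cong (q y)))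

⟨⟩-+ˡ : ∀ (u v w : V D) → ⟨ u +ⱽ v , w ⟩ ≈ℂ ⟨ u , w ⟩ +ℂ ⟨ v , w ⟩
⟨⟩-+ˡ u v w = ≈-trans (sumX-cong (λ y → distribʳ (conj (w y)) (u y) (v y)))
  (sumX-+ (λ y → u y *ℂ conj (w y)) (λ y → v y *ℂ conj (w y)))

⟨⟩-+ʳ : ∀ (u v w : V D) → ⟨ u , v +ⱽ w ⟩ ≈ℂ ⟨ u , v ⟩ +ℂ ⟨ u , w ⟩
⟨⟩-+ʳ u v w = ≈-trans (sumX-cong (λ y → ≈-trans (*-congˡ (conj-+ (v y) (w y))) (distribˡ (u y) _ _)))
  (sumX-+ (λ y → u y *ℂ conj (v y)) (λ y → u y *ℂ conj (w y)))

⟨⟩-•ˡ : ∀ c (u v : V D) → ⟨ c •ⱽ u , v ⟩ ≈ℂ c *ℂ ⟨ u , v ⟩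
⟨⟩-•ˡ c u v = ≈-trans (sumX-cong (λ y → *-assoc c (u y) (conj (v y)))) (sumX-scale c (λ y → u y *ℂ conj (v y)))

⟨⟩-•ʳ : ∀ c (u v : V D) → ⟨ u , c •ⱽ v ⟩ ≈ℂ conj c *ℂ ⟨ u , v ⟩
⟨⟩-•ʳ c u v = ≈-trans
  (sumX-cong (λ y → ≈-trans (*-congˡ (conj-* c (v y)))
    (solve 3 (λ u c v → u :* (c :* v) := c :* (u :* v)) ≈-refl (u y) (conj c) (conj (v y)))))
  (sumX-scale (conj c) (λ y → u y *ℂ conj (v y)))

_† : Mat₂ → Mat₂
(M †) a b = conj (M b a)

⟨⟩-act : ∀ M (v w : V D) → ⟨ v , act M w ⟩ ≈ℂ ⟨ act (M †) v , w ⟩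
⟨⟩-act {zero}  M v w = ≈-refl
⟨⟩-act {suc D} M v w = begin
  ⟨ v₀ , (M 0F 0F •ⱽ act M w₀) +ⱽ (M 0F 1F •ⱽ act M w₁) ⟩ +ℂ ⟨ v₁ , (M 1F 0F •ⱽ act M w₀) +ⱽ (M 1F 1F •ⱽ act M w₁) ⟩
    ≈⟨ +-cong (right v₀ 0F) (right v₁ 1F) ⟩
  (conj (M 0F 0F) *ℂ s v₀ w₀ +ℂ conj (M 0F 1F) *ℂ s v₀ w₁) +ℂ (conj (M 1F 0F) *ℂ s v₁ w₀ +ℂ conj (M 1F 1F) *ℂ s v₁ w₁)
    ≈⟨ solve 4 (λ a b c d → (a :+ b) :+ (c :+ d) := (a :+ c) :+ (b :+ d)) ≈-refl _ _ _ _ ⟩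
  (conj (M 0F 0F) *ℂ s v₀ w₀ +ℂ conj (M 1F 0F) *ℂ s v₁ w₀) +ℂ (conj (M 0F 1F) *ℂ s v₀ w₁ +ℂ conj (M 1F 1F) *ℂ s v₁ w₁)
    ≈⟨ +-cong (left 0F w₀) (left 1F w₁) ⟨
  ⟨ act (M †) v , w ⟩ ∎
  where
  v₀ v₁ w₀ w₁ : V D
  v₀ = v ∘ (0F ∷_)
  v₁ = v ∘ (1F ∷_)
  w₀ = w ∘ (0F ∷_)
  w₁ = w ∘ (1F ∷_)
  s : V D → V D → ℂ
  s x z = ⟨ act (M †) x , z ⟩
  right : ∀ x a → ⟨ x , (M a 0F •ⱽ act M w₀) +ⱽ (M a 1F •ⱽ act M w₁) ⟩ ≈ℂ conj (M a 0F) *ℂ s x w₀ +ℂ conj (M a 1F) *ℂ s x w₁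
  right x a = ≈-trans (⟨⟩-+ʳ x (M a 0F •ⱽ act M w₀) (M a 1F •ⱽ act M w₁))
    (+-cong (≈-trans (⟨⟩-•ʳ (M a 0F) x (act M w₀)) (*-congˡ (⟨⟩-act M x w₀)))
            (≈-trans (⟨⟩-•ʳ (M a 1F) x (act M w₁)) (*-congˡ (⟨⟩-act M x w₁))))
  left : ∀ b z → ⟨ act (M †) v ∘ (b ∷_) , z ⟩ ≈ℂ conj (M 0F b) *ℂ s v₀ z +ℂ conj (M 1F b) *ℂ s v₁ z
  left b z = ≈-trans (⟨⟩-+ˡ (conj (M 0F b) •ⱽ act (M †) v₀) (conj (M 1F b) •ⱽ act (M †) v₁) z)
    (+-cong (⟨⟩-•ˡ (conj (M 0F b)) (act (M †) v₀) z) (⟨⟩-•ˡ (conj (M 1F b)) (act (M †) v₁) z))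

θ-linear : ∀ D i → θ D i ≡ fromℕ D ℚ.- fromℕ 2 ℚ.* fromℕ i
θ-linear D i = trans (integer-+ (+ D) (ℤ.- + (2 * i)))
  (cong (fromℕ D ℚ.+_) (trans (integer-neg (+ (2 * i))) (cong ℚ.-_ (fromℕ-* 2 i))))

θ-suc-0 : ∀ D w → ι (θ (suc D) w) ≈ℂ ι (θ D w) +ℂ 1ℂ
θ-suc-0 D w = ≈-trans (≈-reflexive (cong ι (trans (θ-linear (suc D) w)
  (trans (cong (ℚ._- fromℕ 2 ℚ.* fromℕ w) (fromℕ-suc D))
  (trans (ring (fromℕ D) (fromℕ 2) (fromℕ w)) (cong (ℚ._+ 1ℚ) (sym (θ-linear D w)))))))) (ι-+ (θ D w) 1ℚ)
  where
  ring : ∀ d t w → (1ℚ ℚ.+ d) ℚ.- t ℚ.* w ≡ (d ℚ.- t ℚ.* w) ℚ.+ 1ℚ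
  ring = solveℚ 3 (λ d t w → (conℚ 1ℚ ⊕ d) ⊝ t ⊗ w ≐ (d ⊝ t ⊗ w) ⊕ conℚ 1ℚ) refl

θ-suc-1 : ∀ D w → ι (θ (suc D) (suc w)) ≈ℂ ι (θ D w) +ℂ -ℂ 1ℂ
θ-suc-1 D w = ≈-trans (≈-reflexive (cong ι (trans (θ-linear (suc D) (suc w))
  (trans (cong₂ (λ a b → a ℚ.- fromℕ 2 ℚ.* b) (fromℕ-suc D) (fromℕ-suc w))
  (trans (ring (fromℕ D) (fromℕ w)) (cong (ℚ._- 1ℚ) (sym (θ-linear D w)))))))) (≈-trans (ι-+ (θ D w) (ℚ.- 1ℚ)) (+-congˡ (ι-neg 1ℚ)))
  where
  ring : ∀ d w → (1ℚ ℚ.+ d) ℚ.- fromℕ 2 ℚ.* (1ℚ ℚ.+ w) ≡ (d ℚ.- fromℕ 2 ℚ.* w) ℚ.- 1ℚ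
  ring = solveℚ 2 (λ d w → (conℚ 1ℚ ⊕ d) ⊝ conℚ (fromℕ 2) ⊗ (conℚ 1ℚ ⊕ w) ≐ (d ⊝ conℚ (fromℕ 2) ⊗ w) ⊝ conℚ 1ℚ) refl

θ-difference≢0 : ∀ D {i j} → i ≢ j → θ D i ℚ.- θ D j ≢ 0ℚ
θ-difference≢0 D {i} {j} i≢j eq = i≢j (sym (ℕ.*-cancelˡ-≡ j i 2 (fromℕ-injective {2 * j} {2 * i}
  (trans (fromℕ-* 2 j) (trans equal (sym (fromℕ-* 2 i)))))))
  where
  ring : ∀ d a b → b ≡ ((d ℚ.- a) ℚ.- (d ℚ.- b)) ℚ.+ a
  ring = solveℚ 3 (λ d a b → b ≐ ((d ⊝ a) ⊝ (d ⊝ b)) ⊕ a) refl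
  a = fromℕ 2 ℚ.* fromℕ i
  b = fromℕ 2 ℚ.* fromℕ j
  equal : b ≡ a
  equal = trans (ring (fromℕ D) a b) (trans
    (cong (ℚ._+ a) (trans (cong₂ ℚ._-_ (sym (θ-linear D i)) (sym (θ-linear D j))) eq)) (ℚ.+-identityˡ a))

-- The rows `(1, 1)` and `(-𝐢, 𝐢)` of `P₁` are left eigenvectors of the one-coordinate adjacency
-- matrix for 1 and -1. Each coordinate of `y` therefore contributes 1 or -1, in total
-- `D - 2 weight y`.
P₁-A : ∀ (v : V D) y → act P₁ (A · v) y ≈ℂ ι (θ D (weight y)) *ℂ act P₁ v y
P₁-A v [] = ≈-refl
P₁-A {suc D} v (a ∷ y) = begin
  P₁ a 0F *ℂ act P₁ ((A · v) ∘ (0F ∷_)) y +ℂ P₁ a 1F *ℂ act P₁ ((A · v) ∘ (1F ∷_)) y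
    ≈⟨ +-cong (*-congˡ (≈-trans (act-congˡ P₁ (A-·-0 v) y) (≈-trans (act-+ P₁ (A · v₀) v₁ y) (+-congʳ (P₁-A v₀ y)))))
              (*-congˡ (≈-trans (act-congˡ P₁ (A-·-1 v) y) (≈-trans (act-+ P₁ (A · v₁) v₀ y) (+-congʳ (P₁-A v₁ y))))) ⟩
  P₁ a 0F *ℂ (t *ℂ act P₁ v₀ y +ℂ act P₁ v₁ y) +ℂ P₁ a 1F *ℂ (t *ℂ act P₁ v₁ y +ℂ act P₁ v₀ y)
    ≈⟨ eigen a t (act P₁ v₀ y) (act P₁ v₁ y) (θ-suc-0 D (weight y)) (θ-suc-1 D (weight y)) ⟩
  ι (θ (suc D) (weight (a ∷ y))) *ℂ (P₁ a 0F *ℂ act P₁ v₀ y +ℂ P₁ a 1F *ℂ act P₁ v₁ y) ∎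
  where
  v₀ v₁ : V D
  v₀ = v ∘ (0F ∷_)
  v₁ = v ∘ (1F ∷_)
  t = ι (θ D (weight y))
  eigen : ∀ a t x z → ι (θ (suc D) (weight y)) ≈ℂ t +ℂ 1ℂ → ι (θ (suc D) (suc (weight y))) ≈ℂ t +ℂ -ℂ 1ℂ →
    P₁ a 0F *ℂ (t *ℂ x +ℂ z) +ℂ P₁ a 1F *ℂ (t *ℂ z +ℂ x) ≈ℂ
    ι (θ (suc D) (weight (a ∷ y))) *ℂ (P₁ a 0F *ℂ x +ℂ P₁ a 1F *ℂ z)
  eigen 0F t x z p q = ≈-trans (solve 3 (λ t x z → :1 :* (t :* x :+ z) :+ :1 :* (t :* z :+ x) := (t :+ :1) :* (:1 :* x :+ :1 :* z)) ≈-refl t x z) (*-congʳ (≈-sym p))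
  eigen 1F t x z p q = ≈-trans (solve 3 (λ t x z → :- :𝐢 :* (t :* x :+ z) :+ :𝐢 :* (t :* z :+ x) := (t :+ :- :1) :* (:- :𝐢 :* x :+ :𝐢 :* z)) ≈-refl t x z) (*-congʳ (≈-sym q))

-- Idempotents

-- A linear map that turns `B` into the diagonal matrix `A*`. Abstracting it lets one Lagrange
-- computation serve both `A`, through `act P₁`, and `A*`, through the identity.
record Intertwiner (B : Mat D) : Set where
  field
    ⟦_⟧    : V D → V D
    ⟦⟧-cong : ∀ {v w} → v ≋ w → ⟦ v ⟧ ≋ ⟦ w ⟧
    ⟦⟧-+   : ∀ v w → ⟦ v +ⱽ w ⟧ ≋ ⟦ v ⟧ +ⱽ ⟦ w ⟧
    ⟦⟧-•   : ∀ c v → ⟦ c •ⱽ v ⟧ ≋ c •ⱽ ⟦ v ⟧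
    eigen  : ∀ v y → ⟦ B · v ⟧ y ≈ℂ ι (θ D (weight y)) *ℂ ⟦ v ⟧ y

A-intertwiner : Intertwiner {D} A
A-intertwiner = record
  { ⟦_⟧ = act P₁ ; ⟦⟧-cong = act-congˡ P₁ ; ⟦⟧-+ = act-+ P₁ ; ⟦⟧-• = act-• P₁ ; eigen = P₁-A }

A*-intertwiner : Intertwiner {D} A*
A*-intertwiner {D} = record
  { ⟦_⟧ = id ; ⟦⟧-cong = id ; ⟦⟧-+ = λ _ _ _ → ≈-refl ; ⟦⟧-• = λ _ _ _ → ≈-refl
  ; eigen = diag-· (λ y → ι (θ D (weight y))) }

factor : Mat D → ℕ → ℕ → Mat D
factor {D} B i j = ι ((θ D i ℚ.- θ D j) ⁻¹) •ᴹ (B -ᴹ ι (θ D j) •ᴹ I)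

others : ℕ → ℕ → List ℕ
others D i = filter (λ j → ¬? (j ℕ.≟ i)) (upTo (suc D))

-- The body of `E` with `A` replaced by `B`, so that `projection A i` is `E i` by definition.
projection : Mat D → ℕ → Mat D
projection {D} B i = ∏ᴹ (map (factor B i) (others D i))

-- The value at `θ_w` of the product of the Lagrange factors for the node `θ_i`; with `js` all the
-- other nodes it is the Kronecker delta of `w` and `i`.
lagrange : ℕ → ℕ → ℕ → List ℕ → ℂ
lagrange D i w []       = 1ℂ
lagrange D i w (j ∷ js) = ι ((θ D i ℚ.- θ D j) ⁻¹ ℚ.* (θ D w ℚ.- θ D j)) *ℂ lagrange D i w js

lagrange-1 : ∀ D i {js} → All (_≢ i) js → lagrange D i i js ≈ℂ 1ℂ
lagrange-1 D i []           = ≈-refl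
lagrange-1 D i {j ∷ js} (j≢i ∷ h) = ≈-trans
  (*-cong (≈-trans (ι-* _ _) (ι-inverseˡ (θ-difference≢0 D (j≢i ∘ sym)))) (lagrange-1 D i h)) (*-identityˡ 1ℂ)

lagrange-0 : ∀ D i w {js} → w ∈ᴸ js → lagrange D i w js ≈ℂ 0ℂ
lagrange-0 D i w {j ∷ js} (here refl) = ≈-trans
  (*-congʳ (≈-reflexive (cong ι (trans (cong ((θ D i ℚ.- θ D w) ⁻¹ ℚ.*_) (ℚ.+-inverseʳ (θ D w))) (ℚ.*-zeroʳ ((θ D i ℚ.- θ D w) ⁻¹))))))
  (zeroˡ _)
lagrange-0 D i w {j ∷ js} (there p) = ≈-trans (*-congˡ (lagrange-0 D i w p)) (zeroʳ _)

lagrange-indicator : ∀ D i w → w ≤ D → lagrange D i w (others D i) ≈ℂ indicator (does (w ℕ.≟ i))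
lagrange-indicator D i w w≤D with w ℕ.≟ i
... | yes refl = ≈-trans (lagrange-1 D i (all-filter (λ j → ¬? (j ℕ.≟ i)) (upTo (suc D))))
  (≈-reflexive (cong indicator (sym (dec-true (i ℕ.≟ i) refl))))
... | no  w≢i  = ≈-trans (lagrange-0 D i w (∈-filter⁺ (λ j → ¬? (j ℕ.≟ i)) (∈-upTo⁺ (s≤s w≤D)) w≢i))
  (≈-reflexive (cong indicator (sym (dec-false (w ℕ.≟ i) w≢i))))

module _ {B : Mat D} (Φ : Intertwiner B) where
  open Intertwiner Φ

  factor-eigen : ∀ i j v y →
    ⟦ factor B i j · v ⟧ y ≈ℂ ι ((θ D i ℚ.- θ D j) ⁻¹ ℚ.* (θ D (weight y) ℚ.- θ D j)) *ℂ ⟦ v ⟧ y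
  factor-eigen i j v y = begin
    ⟦ factor B i j · v ⟧ y
      ≈⟨ ⟦⟧-cong expand y ⟩
    ⟦ c •ⱽ ((B · v) +ⱽ ((-ℂ 1ℂ) •ⱽ (t •ⱽ v))) ⟧ y
      ≈⟨ ≈-trans (⟦⟧-• c _ y) (*-congˡ (≈-trans (⟦⟧-+ _ _ y) (+-cong (eigen v y)
           (≈-trans (⟦⟧-• (-ℂ 1ℂ) _ y) (*-congˡ (⟦⟧-• t v y)))))) ⟩
    c *ℂ (ι (θ D (weight y)) *ℂ ⟦ v ⟧ y +ℂ -ℂ 1ℂ *ℂ (t *ℂ ⟦ v ⟧ y))
      ≈⟨ solve 4 (λ c s t x → c :* (s :* x :+ :- :1 :* (t :* x)) := (c :* (s :+ :- t)) :* x) ≈-refl c (ι (θ D (weight y))) t (⟦ v ⟧ y) ⟩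
    c *ℂ (ι (θ D (weight y)) +ℂ -ℂ t) *ℂ ⟦ v ⟧ y
      ≈⟨ *-congʳ (≈-trans (ι-* _ _) (*-congˡ (≈-trans (ι-+ _ _) (+-congˡ (ι-neg (θ D j)))))) ⟨
    ι ((θ D i ℚ.- θ D j) ⁻¹ ℚ.* (θ D (weight y) ℚ.- θ D j)) *ℂ ⟦ v ⟧ y ∎
    where
    c = ι ((θ D i ℚ.- θ D j) ⁻¹)
    t = ι (θ D j)
    expand : factor B i j · v ≋ c •ⱽ ((B · v) +ⱽ ((-ℂ 1ℂ) •ⱽ (t •ⱽ v)))
    expand z = ≈-trans (·-•ᴹ c (B -ᴹ t •ᴹ I) v z) (*-congˡ (≈-trans (·--ᴹ B (t •ᴹ I) v z)
      (+-congˡ (*-congˡ (≈-trans (·-•ᴹ t I v z) (*-congˡ (I-· v z)))))))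

  product-eigen : ∀ i js v y → ⟦ ∏ᴹ (map (factor B i) js) · v ⟧ y ≈ℂ lagrange D i (weight y) js *ℂ ⟦ v ⟧ y
  product-eigen i []       v y = ≈-trans (⟦⟧-cong (I-· v) y) (≈-sym (*-identityˡ _))
  product-eigen i (j ∷ js) v y = begin
    ⟦ (factor B i j *ᴹ ∏ᴹ (map (factor B i) js)) · v ⟧ y   ≈⟨ ⟦⟧-cong (·-assoc (factor B i j) _ v) y ⟩
    ⟦ factor B i j · (∏ᴹ (map (factor B i) js) · v) ⟧ y    ≈⟨ factor-eigen i j _ y ⟩
    _ *ℂ ⟦ ∏ᴹ (map (factor B i) js) · v ⟧ y                ≈⟨ *-congˡ (product-eigen i js v y) ⟩
    _ *ℂ (lagrange D i (weight y) js *ℂ ⟦ v ⟧ y)           ≈⟨ *-assoc _ _ _ ⟨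
    lagrange D i (weight y) (j ∷ js) *ℂ ⟦ v ⟧ y            ∎

  projection-eigen : ∀ i v → ⟦ projection B i · v ⟧ ≋ E* i · ⟦ v ⟧
  projection-eigen i v y = ≈-trans (product-eigen i (others D i) v y)
    (≈-trans (*-congʳ (lagrange-indicator D i (weight y) (weight≤ y)))
      (≈-sym (diag-· (λ y → if does (∂ 𝟎 y ℕ.≟ i) then 1ℂ else 0ℂ) ⟦ v ⟧ y)))

P₁-E : ∀ i (v : V D) → act P₁ (E i · v) ≋ E* i · act P₁ v
P₁-E = projection-eigen A-intertwiner

-- Expresses `E* i` as a polynomial in `A*`; this is how the diagonal idempotents come to preserve
-- every module.
E*-projection : ∀ i (v : V D) → projection A* i · v ≋ E* i · v
E*-projection = projection-eigen A*-intertwiner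

P₁-cancelˡ : ∀ (v : V D) → act P₁⁻¹ (act P₁ v) ≋ v
P₁-cancelˡ v = ≋-trans (act-⊡ P₁⁻¹ P₁ v) (≋-trans (act-congʳ v entries) (act-I v))
  where
  entries : ∀ a b → (P₁⁻¹ ⊡ P₁) a b ≈ℂ diag₂ 1ℂ 1ℂ a b
  entries 0F 0F = pointwiseℂ (λ _ → refl) (λ _ → refl)
  entries 0F 1F = pointwiseℂ (λ _ → refl) (λ _ → refl)
  entries 1F 0F = pointwiseℂ (λ _ → refl) (λ _ → refl)
  entries 1F 1F = pointwiseℂ (λ _ → refl) (λ _ → refl)

P₁-cancelʳ : ∀ (v : V D) → act P₁ (act P₁⁻¹ v) ≋ v
P₁-cancelʳ v = ≋-trans (act-⊡ P₁ P₁⁻¹ v) (≋-trans (act-congʳ v entries) (act-I v))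
  where
  entries : ∀ a b → (P₁ ⊡ P₁⁻¹) a b ≈ℂ diag₂ 1ℂ 1ℂ a b
  entries 0F 0F = pointwiseℂ (λ _ → refl) (λ _ → refl)
  entries 0F 1F = pointwiseℂ (λ _ → refl) (λ _ → refl)
  entries 1F 0F = pointwiseℂ (λ _ → refl) (λ _ → refl)
  entries 1F 1F = pointwiseℂ (λ _ → refl) (λ _ → refl)

P₁-injective : ∀ {v w : V D} → act P₁ v ≋ act P₁ w → v ≋ w
P₁-injective {v = v} {w} p = ≋-trans (≋-sym (P₁-cancelˡ v)) (≋-trans (act-congˡ P₁⁻¹ p) (P₁-cancelˡ w))

E-act : ∀ i (v : V D) → E i · v ≋ act P₁⁻¹ (E* i · act P₁ v)
E-act i v = P₁-injective (≋-trans (P₁-E i v) (≋-sym (P₁-cancelʳ (E* i · act P₁ v))))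

Eᵋ-act : ∀ i (v : V D) → Eᵋ i · v ≋ act P₁⁻¹ (E i · act P₁ v)
Eᵋ-act i v = ≋-trans (·-assoc (P⁻¹ *ᴹ E i) P v) (≋-trans (·-assoc P⁻¹ (E i) (P · v))
  (≋-trans (Kron-· P₁⁻¹ (E i · (P · v))) (act-congˡ P₁⁻¹ (·-congˡ (E i) (Kron-· P₁ v)))))

P₁-Eᵋ : ∀ i (v : V D) → act P₁ (Eᵋ i · v) ≋ E i · act P₁ v
P₁-Eᵋ i v = ≋-trans (act-congˡ P₁ (Eᵋ-act i v)) (P₁-cancelʳ (E i · act P₁ v))

-- Generating functions of the idempotents

evⱽ : ℕ → (ℕ → V D) → ℂ → V D
evⱽ n v t y = ev n (λ k → v k y) t

evⱽ-cong : ∀ n {v w : ℕ → V D} t → (∀ k → v k ≋ w k) → evⱽ n v t ≋ evⱽ n w t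
evⱽ-cong n t p y = ev-cong n (λ k _ → p k y) ≈-refl

act-0ⱽ : ∀ M → act M (0ⱽ {D}) ≋ 0ⱽ
act-0ⱽ M []      = ≈-refl
act-0ⱽ M (a ∷ y) = ≈-trans (+-cong (≈-trans (*-congˡ (act-0ⱽ M y)) (zeroʳ _)) (≈-trans (*-congˡ (act-0ⱽ M y)) (zeroʳ _))) (+-identityˡ 0ℂ)

act-evⱽ : ∀ M n (v : ℕ → V D) t → act M (evⱽ n v t) ≋ evⱽ n (λ k → act M (v k)) t
act-evⱽ M zero    v t = act-0ⱽ M
act-evⱽ M (suc n) v t y = ≈-trans (act-+ M (v 0) (t •ⱽ evⱽ n (v ∘ suc) t) y)
  (+-congˡ (≈-trans (act-• M t (evⱽ n (v ∘ suc) t) y) (*-congˡ (act-evⱽ M n (v ∘ suc) t y))))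

ev-indicator : ∀ n w x t → w < n → ev n (λ k → indicator (does (w ℕ.≟ k)) *ℂ x) t ≈ℂ t ^ℂ w *ℂ x
ev-indicator (suc n) zero    x t _         = ≈-trans
  (+-congˡ (*-congˡ (≈-trans (ev-cong n (λ k _ → zeroˡ x) ≈-refl) (ev-0 n t))))
  (solve 2 (λ x t → :1 :* x :+ t :* :0 := :1 :* x) ≈-refl x t)
ev-indicator (suc n) (suc w) x t (s≤s w<n) = ≈-trans
  (+-cong (zeroˡ x) (*-congˡ (ev-indicator n w x t w<n)))
  (≈-trans (+-identityˡ _) (≈-sym (*-assoc t (t ^ℂ w) x)))

-- Weighting `E* k` by `tᵏ` multiplies the entry at `y` by `t ^ℂ weight y`, and this factors over
-- the coordinates of `y`.
E*-generating : ∀ (v : V D) t → evⱽ (suc D) (λ k → E* k · v) t ≋ act (diag₂ 1ℂ t) v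
E*-generating {D} v t y = ≈-trans
  (ev-cong (suc D) {s = t} (λ k _ → diag-· (λ y → if does (∂ 𝟎 y ℕ.≟ k) then 1ℂ else 0ℂ) v y) ≈-refl)
  (≈-trans (ev-indicator (suc D) (weight y) (v y) t (s≤s (weight≤ y))) (≈-sym (act-diag₂ t v y)))

conjugate : Mat₂ → Mat₂
conjugate M = P₁⁻¹ ⊡ (M ⊡ P₁)

conjugated : ∀ M (v : V D) → act P₁⁻¹ (act M (act P₁ v)) ≋ act (conjugate M) v
conjugated M v = ≋-trans (act-congˡ P₁⁻¹ (act-⊡ M P₁ v)) (act-⊡ P₁⁻¹ (M ⊡ P₁) v)

E-generating : ∀ (v : V D) t → evⱽ (suc D) (λ k → E k · v) t ≋ act (conjugate (diag₂ 1ℂ t)) v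
E-generating {D} v t = ≋-trans (evⱽ-cong (suc D) t (λ k → E-act k v))
  (≋-trans (≋-sym (act-evⱽ P₁⁻¹ (suc D) (λ k → E* k · act P₁ v) t))
  (≋-trans (act-congˡ P₁⁻¹ (E*-generating (act P₁ v) t)) (conjugated (diag₂ 1ℂ t) v)))

Eᵋ-generating : ∀ (v : V D) t → evⱽ (suc D) (λ k → Eᵋ k · v) t ≋ act (conjugate (conjugate (diag₂ 1ℂ t))) v
Eᵋ-generating {D} v t = ≋-trans (evⱽ-cong (suc D) t (λ k → Eᵋ-act k v))
  (≋-trans (≋-sym (act-evⱽ P₁⁻¹ (suc D) (λ k → E k · act P₁ v) t))
  (≋-trans (act-congˡ P₁⁻¹ (E-generating (act P₁ v) t)) (conjugated (conjugate (diag₂ 1ℂ t)) v)))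

⟨0ⱽ,⟩ : ∀ (w : V D) → ⟨ 0ⱽ , w ⟩ ≈ℂ 0ℂ
⟨0ⱽ,⟩ w = sumX-0 (λ y → zeroˡ (conj (w y)))

⟨,0ⱽ⟩ : ∀ (w : V D) → ⟨ w , 0ⱽ ⟩ ≈ℂ 0ℂ
⟨,0ⱽ⟩ w = sumX-0 (λ y → ≈-trans (*-congˡ (pointwiseℂ (λ _ → refl) (λ _ → refl))) (zeroʳ (w y)))

⟨⟩-evˡ : ∀ n (v : ℕ → V D) w t → ⟨ evⱽ n v t , w ⟩ ≈ℂ ev n (λ k → ⟨ v k , w ⟩) t
⟨⟩-evˡ zero    v w t = ⟨0ⱽ,⟩ w
⟨⟩-evˡ (suc n) v w t = ≈-trans (⟨⟩-+ˡ (v 0) (t •ⱽ evⱽ n (v ∘ suc) t) w)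
  (+-congˡ (≈-trans (⟨⟩-•ˡ t (evⱽ n (v ∘ suc) t) w) (*-congˡ (⟨⟩-evˡ n (v ∘ suc) w t))))

⟨⟩-evʳ : ∀ n (v : ℕ → V D) w t → ⟨ w , evⱽ n v t ⟩ ≈ℂ ev n (λ k → ⟨ w , v k ⟩) (conj t)
⟨⟩-evʳ zero    v w t = ⟨,0ⱽ⟩ w
⟨⟩-evʳ (suc n) v w t = ≈-trans (⟨⟩-+ʳ w (v 0) (t •ⱽ evⱽ n (v ∘ suc) t))
  (+-congˡ (≈-trans (⟨⟩-•ʳ t w (evⱽ n (v ∘ suc) t)) (*-congˡ (⟨⟩-evʳ n (v ∘ suc) w t))))

-- Lowering operator and lowest weight vectors

-- lower k is L^k / k!, where L sends a vertex to the sum of the vertices covered by it.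
lower : ℕ → V D → V D
lower zero    v []       = v []
lower (suc k) v []       = 0ℂ
lower zero    v (0F ∷ y) = lower zero (v ∘ (0F ∷_)) y
lower (suc k) v (0F ∷ y) = lower (suc k) (v ∘ (0F ∷_)) y +ℂ lower k (v ∘ (1F ∷_)) y
lower zero    v (1F ∷ y) = lower zero (v ∘ (1F ∷_)) y
lower (suc k) v (1F ∷ y) = lower (suc k) (v ∘ (1F ∷_)) y

lower-cong : ∀ k {v w : V D} → v ≋ w → lower k v ≋ lower k w
lower-cong zero    p []       = p []
lower-cong (suc k) p []       = ≈-refl
lower-cong zero    p (0F ∷ y) = lower-cong zero (p ∘ (0F ∷_)) y
lower-cong (suc k) p (0F ∷ y) = +-cong (lower-cong (suc k) (p ∘ (0F ∷_)) y) (lower-cong k (p ∘ (1F ∷_)) y)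
lower-cong zero    p (1F ∷ y) = lower-cong zero (p ∘ (1F ∷_)) y
lower-cong (suc k) p (1F ∷ y) = lower-cong (suc k) (p ∘ (1F ∷_)) y

lower-+ : ∀ k (v w : V D) → lower k (v +ⱽ w) ≋ lower k v +ⱽ lower k w
lower-+ zero    v w []       = ≈-refl
lower-+ (suc k) v w []       = ≈-sym (+-identityˡ 0ℂ)
lower-+ zero    v w (0F ∷ y) = lower-+ zero (v ∘ (0F ∷_)) (w ∘ (0F ∷_)) y
lower-+ (suc k) v w (0F ∷ y) = ≈-trans
  (+-cong (lower-+ (suc k) (v ∘ (0F ∷_)) (w ∘ (0F ∷_)) y) (lower-+ k (v ∘ (1F ∷_)) (w ∘ (1F ∷_)) y))
  (solve 4 (λ a b c d → (a :+ b) :+ (c :+ d) := (a :+ c) :+ (b :+ d)) ≈-refl _ _ _ _)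
lower-+ zero    v w (1F ∷ y) = lower-+ zero (v ∘ (1F ∷_)) (w ∘ (1F ∷_)) y
lower-+ (suc k) v w (1F ∷ y) = lower-+ (suc k) (v ∘ (1F ∷_)) (w ∘ (1F ∷_)) y

lower-0ⱽ : ∀ k → lower k (0ⱽ {D}) ≋ 0ⱽ
lower-0ⱽ zero    []       = ≈-refl
lower-0ⱽ (suc k) []       = ≈-refl
lower-0ⱽ zero    (0F ∷ y) = lower-0ⱽ zero y
lower-0ⱽ (suc k) (0F ∷ y) = ≈-trans (+-cong (lower-0ⱽ (suc k) y) (lower-0ⱽ k y)) (+-identityˡ 0ℂ)
lower-0ⱽ zero    (1F ∷ y) = lower-0ⱽ zero y
lower-0ⱽ (suc k) (1F ∷ y) = lower-0ⱽ (suc k) y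

lower-zero : ∀ (v : V D) → lower 0 v ≋ v
lower-zero v []       = ≈-refl
lower-zero v (0F ∷ y) = lower-zero (v ∘ (0F ∷_)) y
lower-zero v (1F ∷ y) = lower-zero (v ∘ (1F ∷_)) y

lower-suc : ∀ k (v : V D) → lower k (lower 1 v) ≋ ν (suc k) •ⱽ lower (suc k) v
lower-suc zero    v y = ≈-trans (lower-zero (lower 1 v) y) (≈-sym (*-identityˡ _))
lower-suc (suc k) v []       = ≈-sym (zeroʳ _)
lower-suc (suc k) v (0F ∷ y) = begin
  lower (suc k) (lower 1 v₀ +ⱽ lower 0 v₁) y +ℂ lower k (lower 1 v₁) y
    ≈⟨ +-cong (≈-trans (lower-+ (suc k) (lower 1 v₀) (lower 0 v₁) y)
                (+-cong (lower-suc (suc k) v₀ y) (lower-cong (suc k) (lower-zero v₁) y)))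
              (lower-suc k v₁ y) ⟩
  ν (suc (suc k)) *ℂ a +ℂ b +ℂ ν (suc k) *ℂ b
    ≈⟨ +-congʳ (+-congʳ (*-congʳ (ν-+ 1 (suc k)))) ⟩
  (1ℂ +ℂ ν (suc k)) *ℂ a +ℂ b +ℂ ν (suc k) *ℂ b
    ≈⟨ solve 3 (λ n a b → (:1 :+ n) :* a :+ b :+ n :* b := (:1 :+ n) :* (a :+ b)) ≈-refl (ν (suc k)) a b ⟩
  (1ℂ +ℂ ν (suc k)) *ℂ (a +ℂ b)
    ≈⟨ *-congʳ (ν-+ 1 (suc k)) ⟨
  ν (suc (suc k)) *ℂ (a +ℂ b) ∎
  where
  v₀ = v ∘ (0F ∷_)
  v₁ = v ∘ (1F ∷_)
  a = lower (suc (suc k)) v₀ y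
  b = lower (suc k) v₁ y
lower-suc (suc k) v (1F ∷ y) = lower-suc (suc k) (v ∘ (1F ∷_)) y

upper : ℂ → Mat₂
upper x 0F 0F = 1ℂ
upper x 0F 1F = x
upper x 1F 0F = 0ℂ
upper x 1F 1F = 1ℂ

-- The Kronecker power of a unitriangular matrix is `exp(xL)`. Divided powers remove the factorials
-- from the series, and terms with `k > D` vanish, so any length `n > D` gives the same value.
act-upper : ∀ n x (v : V D) y → D < n → act (upper x) v y ≈ℂ ev n (λ k → lower k v y) x
act-upper (suc n) x v []       _ = ≈-sym (≈-trans (+-congˡ (≈-trans (*-congˡ (ev-0 n x)) (zeroʳ x))) (+-identityʳ (v [])))
act-upper (suc n) x v (0F ∷ y) (s≤s D<n) = begin
  1ℂ *ℂ act (upper x) v₀ y +ℂ x *ℂ act (upper x) v₁ y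
    ≈⟨ +-cong (≈-trans (*-identityˡ _) (act-upper (suc n) x v₀ y (ℕ.m<n⇒m<1+n D<n))) (*-congˡ (act-upper n x v₁ y D<n)) ⟩
  (lower 0 v₀ y +ℂ x *ℂ ev n (λ k → lower (suc k) v₀ y) x) +ℂ x *ℂ ev n (λ k → lower k v₁ y) x
    ≈⟨ solve 4 (λ a x b c → (a :+ x :* b) :+ x :* c := a :+ x :* (b :+ c)) ≈-refl _ x _ _ ⟩
  lower 0 v₀ y +ℂ x *ℂ (ev n (λ k → lower (suc k) v₀ y) x +ℂ ev n (λ k → lower k v₁ y) x)
    ≈⟨ +-congˡ (*-congˡ (ev-+ n (λ k → lower (suc k) v₀ y) (λ k → lower k v₁ y) x)) ⟨
  lower 0 v₀ y +ℂ x *ℂ ev n (λ k → lower (suc k) v₀ y +ℂ lower k v₁ y) x ∎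
  where
  v₀ = v ∘ (0F ∷_)
  v₁ = v ∘ (1F ∷_)
act-upper (suc n) x v (1F ∷ y) (s≤s D<n) = ≈-trans
  (solve 2 (λ a b → :0 :* a :+ :1 :* b := b) ≈-refl _ _)
  (act-upper (suc n) x (v ∘ (1F ∷_)) y (ℕ.m<n⇒m<1+n D<n))

act-upper-fixed : ∀ x (v : V D) → lower 1 v ≋ 0ⱽ → act (upper x) v ≋ v
act-upper-fixed {D} x v p y = begin
  act (upper x) v y                              ≈⟨ act-upper (suc D) x v y (ℕ.n<1+n D) ⟩
  lower 0 v y +ℂ x *ℂ ev D (λ k → lower (suc k) v y) x
    ≈⟨ +-cong (lower-zero v y) (*-congˡ (≈-trans (ev-cong D (λ k _ → vanish k) ≈-refl) (ev-0 D x))) ⟩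
  v y +ℂ x *ℂ 0ℂ                                 ≈⟨ ≈-trans (+-congˡ (zeroʳ x)) (+-identityʳ (v y)) ⟩
  v y                                            ∎
  where
  vanish : ∀ k → lower (suc k) v y ≈ℂ 0ℂ
  -- `(Lᵏ / k!) L` is `k + 1` times the next divided power, and `k + 1` is invertible.
  vanish k = cancel (ι-inverseˡ (fromℕ-suc≢0 k)) (begin
    ν (suc k) *ℂ lower (suc k) v y  ≈⟨ lower-suc k v y ⟨
    lower k (lower 1 v) y           ≈⟨ lower-cong k p y ⟩
    lower k 0ⱽ y                    ≈⟨ lower-0ⱽ k y ⟩
    0ℂ                              ≈⟨ zeroʳ (ν (suc k)) ⟨
    ν (suc k) *ℂ 0ℂ                 ∎)

raise : V D → V D
raise v []       = 0ℂ
raise v (0F ∷ y) = raise (v ∘ (0F ∷_)) y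
raise v (1F ∷ y) = raise (v ∘ (1F ∷_)) y +ℂ v (0F ∷ y)

-- The two summands change the weight by -1 and by +1. Applied to a vector of a single weight they
-- have disjoint supports, so `L u` can be read off from `A · u`.
A-· : ∀ (v : V D) → A · v ≋ lower 1 v +ⱽ raise v
A-· v []       = ≈-trans (zeroˡ (v [])) (≈-sym (+-identityˡ 0ℂ))
A-· v (0F ∷ y) = ≈-trans (A-·-0 v y) (≈-trans (+-cong (A-· (v ∘ (0F ∷_)) y) (≈-sym (lower-zero (v ∘ (1F ∷_)) y)))
  (solve 3 (λ a b c → (a :+ b) :+ c := (a :+ c) :+ b) ≈-refl _ _ _))
A-· v (1F ∷ y) = ≈-trans (A-·-1 v y) (≈-trans (+-congʳ (A-· (v ∘ (1F ∷_)) y)) (+-assoc _ _ _))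

lower≈0 : ∀ (v : V D) y → (∀ z → weight z ≡ suc (weight y) → v z ≈ℂ 0ℂ) → lower 1 v y ≈ℂ 0ℂ
lower≈0 v []       h = ≈-refl
lower≈0 v (0F ∷ y) h = ≈-trans
  (+-cong (lower≈0 (v ∘ (0F ∷_)) y (h ∘ (0F ∷_))) (≈-trans (lower-zero (v ∘ (1F ∷_)) y) (h (1F ∷ y) refl)))
  (+-identityˡ 0ℂ)
lower≈0 v (1F ∷ y) h = lower≈0 (v ∘ (1F ∷_)) y (λ z p → h (1F ∷ z) (cong suc p))

raise≈0 : ∀ (v : V D) y → (∀ z → suc (weight z) ≡ weight y → v z ≈ℂ 0ℂ) → raise v y ≈ℂ 0ℂ
raise≈0 v []       h = ≈-refl
raise≈0 v (0F ∷ y) h = raise≈0 (v ∘ (0F ∷_)) y (h ∘ (0F ∷_))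
raise≈0 v (1F ∷ y) h = ≈-trans
  (+-cong (raise≈0 (v ∘ (1F ∷_)) y (λ z p → h (1F ∷ z) (cong suc p))) (h (0F ∷ y) refl))
  (+-identityˡ 0ℂ)

record IsLowest (r : ℕ) (u : V D) : Set where
  field
    support : ∀ y → weight y ≢ r → u y ≈ℂ 0ℂ
    lowered : lower 1 u ≋ 0ⱽ

module _ {r : ℕ} {u : V D} (lowest : IsLowest r u) where
  open IsLowest lowest

  act-diag₂-lowest : ∀ c → act (diag₂ 1ℂ c) u ≋ c ^ℂ r •ⱽ u
  act-diag₂-lowest c y = ≈-trans (act-diag₂ c u y) (power (weight y ℕ.≟ r))
    where
    power : Dec (weight y ≡ r) → c ^ℂ weight y *ℂ u y ≈ℂ c ^ℂ r *ℂ u y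
    power (yes refl) = ≈-refl
    power (no  w≢r)  = ≈-trans (≈-trans (*-congˡ (support y w≢r)) (zeroʳ _))
      (≈-sym (≈-trans (*-congˡ (support y w≢r)) (zeroʳ _)))

  -- A lower unitriangular factor moves to the second argument as its adjoint, which is upper
  -- unitriangular and fixes `u`. The inner `conj` is undone by `†`, so the entry below the diagonal
  -- is `x`.
  ⟨⟩-act-lower : ∀ x v → ⟨ act ((upper (conj x)) †) v , u ⟩ ≈ℂ ⟨ v , u ⟩
  ⟨⟩-act-lower x v = ≈-trans (≈-sym (⟨⟩-act (upper (conj x)) v u))
    (⟨⟩-cong (λ _ → ≈-refl) (act-upper-fixed (conj x) u lowered))

  -- With h inverse to the corner g of G, G is g times a lower unitriangular matrix
  -- times diag(1, h² det G) times an upper unitriangular matrix.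
  ⟨⟩-act-lowest : ∀ {d} → d + 2 * r ≡ D → ∀ G h → h *ℂ G 0F 0F ≈ℂ 1ℂ →
    ⟨ act G u , u ⟩ ≈ℂ G 0F 0F ^ℂ d *ℂ (G 0F 0F *ℂ G 1F 1F +ℂ -ℂ (G 0F 1F *ℂ G 1F 0F)) ^ℂ r *ℂ ∥ u ∥²
  ⟨⟩-act-lowest {d} d+2r≡D G h hg≈1 = begin
    ⟨ act G u , u ⟩
      ≈⟨ ⟨⟩-cong factorise (λ _ → ≈-refl) ⟩
    ⟨ g ^ℂ D •ⱽ act Lo (s •ⱽ u) , u ⟩
      ≈⟨ ≈-trans (⟨⟩-•ˡ (g ^ℂ D) (act Lo (s •ⱽ u)) u) (*-congˡ (≈-trans (⟨⟩-act-lower x (s •ⱽ u)) (⟨⟩-•ˡ s u u))) ⟩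
    g ^ℂ D *ℂ (s *ℂ ∥ u ∥²)
      ≈⟨ *-assoc _ _ _ ⟨
    g ^ℂ D *ℂ s *ℂ ∥ u ∥²
      ≈⟨ *-congʳ powers ⟩
    g ^ℂ d *ℂ Δ ^ℂ r *ℂ ∥ u ∥² ∎
    where
    g = G 0F 0F
    Δ = g *ℂ G 1F 1F +ℂ -ℂ (G 0F 1F *ℂ G 1F 0F)
    x = h *ℂ G 1F 0F
    q = h *ℂ h *ℂ Δ
    s = q ^ℂ r
    Lo = (upper (conj x)) †
    conj-1 : conj 1ℂ ≈ℂ 1ℂ
    conj-1 = pointwiseℂ (λ _ → refl) (λ _ → refl)
    conj-0 : conj 0ℂ ≈ℂ 0ℂ
    conj-0 = pointwiseℂ (λ _ → refl) (λ _ → refl)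
    conj²x : conj (conj x) ≈ℂ x
    conj²x = conj-involutive x
    product : Mat₂
    product a b = g *ℂ (Lo ⊡ (diag₂ 1ℂ q ⊡ upper (h *ℂ G 0F 1F))) a b
    entries : ∀ a b → product a b ≈ℂ G a b
    entries 0F 0F = ≈-trans
      (*-congˡ (+-cong (*-congʳ conj-1) (*-congʳ conj-0)))
      (solve 2 (λ g q → g :* (:1 :* (:1 :* :1 :+ :0 :* :0) :+ :0 :* (:0 :* :1 :+ q :* :0)) := g) ≈-refl g q)
    entries 0F 1F = ≈-trans
      (*-congˡ (+-cong (*-congʳ conj-1) (*-congʳ conj-0)))
      (≈-trans (solve 4 (λ g q h b → g :* (:1 :* (:1 :* (h :* b) :+ :0 :* :1) :+ :0 :* (:0 :* (h :* b) :+ q :* :1)) := (h :* g) :* b) ≈-refl g q h (G 0F 1F))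
        (≈-trans (*-congʳ hg≈1) (*-identityˡ _)))
    entries 1F 0F = ≈-trans
      (*-congˡ (+-cong (*-congʳ conj²x) (*-congʳ conj-1)))
      (≈-trans (solve 4 (λ g q h c → g :* ((h :* c) :* (:1 :* :1 :+ :0 :* :0) :+ :1 :* (:0 :* :1 :+ q :* :0)) := (h :* g) :* c) ≈-refl g q h (G 1F 0F))
        (≈-trans (*-congʳ hg≈1) (*-identityˡ _)))
    entries 1F 1F = ≈-trans
      (*-congˡ (+-cong (*-congʳ conj²x) (*-congʳ conj-1)))
      (≈-trans (solve 5 (λ g h b c e → g :* ((h :* c) :* (:1 :* (h :* b) :+ :0 :* :1) :+ :1 :* (:0 :* (h :* b) :+ (h :* h :* (g :* e :+ :- (b :* c))) :* :1))
          := (h :* g) :* (h :* g) :* e) ≈-refl g h (G 0F 1F) (G 1F 0F) (G 1F 1F))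
        (≈-trans (*-congʳ (≈-trans (*-cong hg≈1 hg≈1) (*-identityˡ 1ℂ))) (*-identityˡ _)))
    factorise : act G u ≋ g ^ℂ D •ⱽ act Lo (s •ⱽ u)
    factorise y = begin
      act G u y                              ≈⟨ act-congʳ u entries y ⟨
      act product u y                        ≈⟨ act-scalar g (Lo ⊡ (diag₂ 1ℂ q ⊡ upper (h *ℂ G 0F 1F))) u y ⟩
      g ^ℂ D *ℂ act (Lo ⊡ (diag₂ 1ℂ q ⊡ upper (h *ℂ G 0F 1F))) u y
        ≈⟨ *-congˡ (act-⊡ Lo (diag₂ 1ℂ q ⊡ upper (h *ℂ G 0F 1F)) u y) ⟨
      g ^ℂ D *ℂ act Lo (act (diag₂ 1ℂ q ⊡ upper (h *ℂ G 0F 1F)) u) y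
        ≈⟨ *-congˡ (act-congˡ Lo (≋-trans (≋-sym (act-⊡ (diag₂ 1ℂ q) (upper (h *ℂ G 0F 1F)) u))
             (≋-trans (act-congˡ (diag₂ 1ℂ q) (act-upper-fixed (h *ℂ G 0F 1F) u lowered)) (act-diag₂-lowest q))) y) ⟩
      g ^ℂ D *ℂ act Lo (s •ⱽ u) y            ∎
    -- In `D = d + 2r` the surplus `2r` powers of `g` cancel the factor `h` to the power `2r`
    -- contained in `q ^ℂ r`.
    powers : g ^ℂ D *ℂ s ≈ℂ g ^ℂ d *ℂ Δ ^ℂ r
    powers = begin
      g ^ℂ D *ℂ (h *ℂ h *ℂ Δ) ^ℂ r
        ≈⟨ *-cong (≈-trans (≈-reflexive (cong (g ^ℂ_) (sym d+2r≡D))) (≈-trans (^-homo-* g d (2 * r)) (*-congˡ (≈-sym (^-assocʳ g 2 r)))))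
                  (^-distrib-* (h *ℂ h) Δ r) ⟩
      g ^ℂ d *ℂ (g ^ℂ 2) ^ℂ r *ℂ ((h *ℂ h) ^ℂ r *ℂ Δ ^ℂ r)
        ≈⟨ solve 4 (λ a b c e → a :* b :* (c :* e) := a :* (c :* b) :* e) ≈-refl _ _ _ _ ⟩
      g ^ℂ d *ℂ ((h *ℂ h) ^ℂ r *ℂ (g ^ℂ 2) ^ℂ r) *ℂ Δ ^ℂ r
        ≈⟨ *-congʳ (*-congˡ (≈-trans (≈-sym (^-distrib-* (h *ℂ h) (g ^ℂ 2) r)) (≈-trans (^-congˡ r square) (1^n≈1 r)))) ⟩
      g ^ℂ d *ℂ 1ℂ *ℂ Δ ^ℂ r
        ≈⟨ *-congʳ (*-identityʳ _) ⟩
      g ^ℂ d *ℂ Δ ^ℂ r ∎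
      where
      square : h *ℂ h *ℂ g ^ℂ 2 ≈ℂ 1ℂ
      square = ≈-trans (solve 2 (λ h g → h :* h :* (g :* (g :* :1)) := (h :* g) :* (h :* g)) ≈-refl h g)
        (≈-trans (*-cong hg≈1 hg≈1) (*-identityˡ 1ℂ))

*-self≥0 : ∀ p → 0ℚ ℚ.≤ p ℚ.* p
*-self≥0 p with ℚ.≤-total 0ℚ p
... | inj₁ 0≤p = ℚ.nonNegative⁻¹ (p ℚ.* p) {{ℚ.nonNeg*nonNeg⇒nonNeg p {{ℚ.nonNegative 0≤p}} p {{ℚ.nonNegative 0≤p}}}}
... | inj₂ p≤0 = ℚ.nonNegative⁻¹ (p ℚ.* p) {{ℚ.nonPos*nonPos⇒nonPos p {{ℚ.nonPositive p≤0}} p {{ℚ.nonPositive p≤0}}}}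

p≢0⇒p²+q²≢0 : ∀ {p} q → p ≢ 0ℚ → p ℚ.* p ℚ.+ q ℚ.* q ≢ 0ℚ
p≢0⇒p²+q²≢0 {p} q p≢0 eq = *-≢0 p≢0 p≢0 (ℚ.≤-antisym p²≤0 (*-self≥0 p))
  where
  p²≤0 : p ℚ.* p ℚ.≤ 0ℚ
  p²≤0 = subst (ℚ._≤ 0ℚ) (ℚ.+-identityʳ (p ℚ.* p)) (subst (p ℚ.* p ℚ.+ 0ℚ ℚ.≤_) eq (ℚ.+-monoʳ-≤ (p ℚ.* p) (*-self≥0 q)))

gaussian⁻¹ : ℚ → ℚ → ℂ
gaussian⁻¹ p q = gaussian (p ℚ.* s) (ℚ.- (q ℚ.* s))
  where s = (p ℚ.* p ℚ.+ q ℚ.* q) ⁻¹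

gaussian-inverseˡ : ∀ {p} q → p ≢ 0ℚ → gaussian⁻¹ p q *ℂ gaussian p q ≈ℂ 1ℂ
gaussian-inverseˡ {p} q p≢0 = pointwiseℂ
  (λ _ → trans (re-eq p q s) (⁻¹-inverseʳ (p≢0⇒p²+q²≢0 q p≢0))) (λ _ → im-eq p q s)
  where
  s = (p ℚ.* p ℚ.+ q ℚ.* q) ⁻¹
  re-eq : ∀ p q s → p ℚ.* s ℚ.* p ℚ.- ℚ.- (q ℚ.* s) ℚ.* q ≡ (p ℚ.* p ℚ.+ q ℚ.* q) ℚ.* s
  re-eq = solveℚ 3 (λ p q s → p ⊗ s ⊗ p ⊝ (⊝ (q ⊗ s)) ⊗ q ≐ (p ⊗ p ⊕ q ⊗ q) ⊗ s) refl
  im-eq : ∀ p q s → p ℚ.* s ℚ.* q ℚ.+ ℚ.- (q ℚ.* s) ℚ.* p ≡ 0ℚ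
  im-eq = solveℚ 3 (λ p q s → p ⊗ s ⊗ q ⊕ (⊝ (q ⊗ s)) ⊗ p ≐ conℚ 0ℚ) refl

-- Generating functions of the inner products

-- These are `E₀ + a E₁` and `Eᵋ₀ + b Eᵋ₁` for one coordinate: `(1 + t)/2` times the identity plus
-- `(1 - t)/2` times `A`, respectively `A^ε`, whose rows for `D = 1` are `(0, 𝐢)` and `(-𝐢, 0)`.
rotationX rotationY : ℂ → Mat₂
rotationX a 0F 0F = ι ½ *ℂ (1ℂ +ℂ a)
rotationX a 0F 1F = ι ½ *ℂ (1ℂ +ℂ -ℂ a)
rotationX a 1F 0F = ι ½ *ℂ (1ℂ +ℂ -ℂ a)
rotationX a 1F 1F = ι ½ *ℂ (1ℂ +ℂ a)
rotationY b 0F 0F = ι ½ *ℂ (1ℂ +ℂ b)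
rotationY b 0F 1F = 𝐢 *ℂ (ι ½ *ℂ (1ℂ +ℂ -ℂ b))
rotationY b 1F 0F = -ℂ 𝐢 *ℂ (ι ½ *ℂ (1ℂ +ℂ -ℂ b))
rotationY b 1F 1F = ι ½ *ℂ (1ℂ +ℂ b)

conjugate-diag₂ : ∀ t a b → conjugate (diag₂ 1ℂ t) a b ≈ℂ rotationX t a b
conjugate-diag₂ t 0F 0F = solve 1 (λ t → :½ :* (:1 :* :1 :+ :0 :* :- :𝐢) :+ :½ :* :𝐢 :* (:0 :* :1 :+ t :* :- :𝐢) := :½ :* (:1 :+ t)) ≈-refl t
conjugate-diag₂ t 0F 1F = solve 1 (λ t → :½ :* (:1 :* :1 :+ :0 :* :𝐢) :+ :½ :* :𝐢 :* (:0 :* :1 :+ t :* :𝐢) := :½ :* (:1 :+ :- t)) ≈-refl t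
conjugate-diag₂ t 1F 0F = solve 1 (λ t → :½ :* (:1 :* :1 :+ :0 :* :- :𝐢) :+ :- (:½ :* :𝐢) :* (:0 :* :1 :+ t :* :- :𝐢) := :½ :* (:1 :+ :- t)) ≈-refl t
conjugate-diag₂ t 1F 1F = solve 1 (λ t → :½ :* (:1 :* :1 :+ :0 :* :𝐢) :+ :- (:½ :* :𝐢) :* (:0 :* :1 :+ t :* :𝐢) := :½ :* (:1 :+ t)) ≈-refl t

⊡-cong : ∀ {M M′ N N′ : Mat₂} → (∀ a b → M a b ≈ℂ M′ a b) → (∀ a b → N a b ≈ℂ N′ a b) → ∀ a b → (M ⊡ N) a b ≈ℂ (M′ ⊡ N′) a b
⊡-cong p q a b = +-cong (*-cong (p a 0F) (q 0F b)) (*-cong (p a 1F) (q 1F b))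

conjugate-rotationX : ∀ t a b → conjugate (rotationX t) a b ≈ℂ rotationY t a b
conjugate-rotationX t 0F 0F = solve 1 (λ t → let p = :½ :* (:1 :+ t); m = :½ :* (:1 :+ :- t) in
  :½ :* (p :* :1 :+ m :* :- :𝐢) :+ :½ :* :𝐢 :* (m :* :1 :+ p :* :- :𝐢) := :½ :* (:1 :+ t)) ≈-refl t
conjugate-rotationX t 0F 1F = solve 1 (λ t → let p = :½ :* (:1 :+ t); m = :½ :* (:1 :+ :- t) in
  :½ :* (p :* :1 :+ m :* :𝐢) :+ :½ :* :𝐢 :* (m :* :1 :+ p :* :𝐢) := :𝐢 :* (:½ :* (:1 :+ :- t))) ≈-refl t
conjugate-rotationX t 1F 0F = solve 1 (λ t → let p = :½ :* (:1 :+ t); m = :½ :* (:1 :+ :- t) in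
  :½ :* (p :* :1 :+ m :* :- :𝐢) :+ :- (:½ :* :𝐢) :* (m :* :1 :+ p :* :- :𝐢) := :- :𝐢 :* (:½ :* (:1 :+ :- t))) ≈-refl t
conjugate-rotationX t 1F 1F = solve 1 (λ t → let p = :½ :* (:1 :+ t); m = :½ :* (:1 :+ :- t) in
  :½ :* (p :* :1 :+ m :* :𝐢) :+ :- (:½ :* :𝐢) :* (m :* :1 :+ p :* :𝐢) := :½ :* (:1 :+ t)) ≈-refl t

conjugate²-diag₂ : ∀ t a b → conjugate (conjugate (diag₂ 1ℂ t)) a b ≈ℂ rotationY t a b
conjugate²-diag₂ t a b = ≈-trans
  (⊡-cong {P₁⁻¹} (λ _ _ → ≈-refl) (⊡-cong {N = P₁} (conjugate-diag₂ t) (λ _ _ → ≈-refl)) a b) (conjugate-rotationX t a b)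

conj-gaussian : ∀ p q → conj (gaussian p q) ≈ℂ gaussian p (ℚ.- q)
conj-gaussian p q = pointwiseℂ (λ _ → refl) (λ _ → refl)

-- Self-adjointness relies on a real parameter. It allows the `Eᵋ` side of an inner product to be
-- moved to the first argument unchanged.
rotationY-† : ∀ q a b → (rotationY (ι q) †) a b ≈ℂ rotationY (ι q) a b
rotationY-† q = entries
  where
  one-plus : conj (ι ½ *ℂ (1ℂ +ℂ ι q)) ≈ℂ ι ½ *ℂ (1ℂ +ℂ ι q)
  one-plus = ≈-trans (conj-* (ι ½) _) (*-cong (conj-gaussian ½ 0ℚ)
    (≈-trans (conj-+ 1ℂ (ι q)) (+-cong (conj-gaussian 1ℚ 0ℚ) (conj-gaussian q 0ℚ))))
  one-minus : conj (ι ½ *ℂ (1ℂ +ℂ -ℂ ι q)) ≈ℂ ι ½ *ℂ (1ℂ +ℂ -ℂ ι q)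
  one-minus = ≈-trans (conj-* (ι ½) _) (*-cong (conj-gaussian ½ 0ℚ)
    (≈-trans (conj-+ 1ℂ (-ℂ ι q)) (+-cong (conj-gaussian 1ℚ 0ℚ) (pointwiseℂ (λ _ → refl) (λ _ → refl)))))
  entries : ∀ a b → (rotationY (ι q) †) a b ≈ℂ rotationY (ι q) a b
  entries 0F 0F = one-plus
  entries 0F 1F = ≈-trans (conj-* (-ℂ 𝐢) _) (*-cong (pointwiseℂ (λ _ → refl) (λ _ → refl)) one-minus)
  entries 1F 0F = ≈-trans (conj-* 𝐢 _) (*-cong (pointwiseℂ (λ _ → refl) (λ _ → refl)) one-minus)
  entries 1F 1F = one-plus

rotation : ℂ → ℂ → Mat₂
rotation a b = rotationY b ⊡ rotationX a

-- Each factor has the eigenvalue 1 and its own parameter as the other eigenvalue.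
rotation-determinant : ∀ a b →
  rotation a b 0F 0F *ℂ rotation a b 1F 1F +ℂ -ℂ (rotation a b 0F 1F *ℂ rotation a b 1F 0F) ≈ℂ a *ℂ b
rotation-determinant = solve 2 (λ a b → let p = :½ :* (:1 :+ a); m = :½ :* (:1 :+ :- a); p′ = :½ :* (:1 :+ b); m′ = :½ :* (:1 :+ :- b) in
  (p′ :* p :+ :𝐢 :* m′ :* m) :* (:- :𝐢 :* m′ :* m :+ p′ :* p) :+
  :- ((p′ :* m :+ :𝐢 :* m′ :* p) :* (:- :𝐢 :* m′ :* p :+ p′ :* m)) := a :* b) ≈-refl

-- `(1 + 𝐢)/4` is the inverse of `2 - 2𝐢`. The other factor is `1 + α + β - αβ` at `α = -𝐢a`,
-- `β = -𝐢b`; this substitution is the source of the power `𝐢^(-i-j)` in the formula.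
rotation-corner : ∀ a b → rotation a b 0F 0F ≈ℂ
  gaussian (+ 1 ℚ./ 4) (+ 1 ℚ./ 4) *ℂ (1ℂ +ℂ -ℂ 𝐢 *ℂ a +ℂ -ℂ 𝐢 *ℂ b +ℂ -ℂ (-ℂ 𝐢 *ℂ a *ℂ (-ℂ 𝐢 *ℂ b)))
rotation-corner = solve 2 (λ a b → let p = :½ :* (:1 :+ a); m = :½ :* (:1 :+ :- a); p′ = :½ :* (:1 :+ b); m′ = :½ :* (:1 :+ :- b) in
  p′ :* p :+ :𝐢 :* m′ :* m :=
  con (+ 1 ℚ./ 4 , + 1 ℚ./ 4) :* (:1 :+ :- :𝐢 :* a :+ :- :𝐢 :* b :+ :- (:- :𝐢 :* a :* (:- :𝐢 :* b)))) ≈-refl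

-- For natural parameters the real part of the corner is `(1 + l)(1 + m)/4`, a nonzero rational,
-- whatever the imaginary part is.
rotation-corner-inverse : ∀ l m → ∃ λ h → h *ℂ rotation (ν l) (ν m) 0F 0F ≈ℂ 1ℂ
rotation-corner-inverse l m = gaussian⁻¹ p q , ≈-trans (*-congˡ corner) (gaussian-inverseˡ q p≢0)
  where
  x = fromℕ l
  y = fromℕ m
  p = ½ ℚ.* (1ℚ ℚ.+ y) ℚ.* (½ ℚ.* (1ℚ ℚ.+ x))
  q = ½ ℚ.* (1ℚ ℚ.+ ℚ.- y) ℚ.* (½ ℚ.* (1ℚ ℚ.+ ℚ.- x))
  ½≢0 : ½ ≢ 0ℚ
  ½≢0 ()
  1+≢0 : ∀ n → 1ℚ ℚ.+ fromℕ n ≢ 0ℚ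
  1+≢0 n = subst (_≢ 0ℚ) (fromℕ-suc n) (fromℕ-suc≢0 n)
  p≢0 : p ≢ 0ℚ
  p≢0 = *-≢0 (*-≢0 ½≢0 (1+≢0 m)) (*-≢0 ½≢0 (1+≢0 l))
  one-plus : ∀ x → ι ½ *ℂ (1ℂ +ℂ ι x) ≈ℂ ι (½ ℚ.* (1ℚ ℚ.+ x))
  one-plus x = ≈-sym (≈-trans (ι-* ½ _) (*-congˡ (ι-+ 1ℚ x)))
  one-minus : ∀ x → ι ½ *ℂ (1ℂ +ℂ -ℂ ι x) ≈ℂ ι (½ ℚ.* (1ℚ ℚ.+ ℚ.- x))
  one-minus x = ≈-trans (*-congˡ (+-congˡ (≈-sym (ι-neg x)))) (one-plus (ℚ.- x))
  corner : rotation (ν l) (ν m) 0F 0F ≈ℂ gaussian p q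
  corner = begin
    ι ½ *ℂ (1ℂ +ℂ ι y) *ℂ (ι ½ *ℂ (1ℂ +ℂ ι x)) +ℂ 𝐢 *ℂ (ι ½ *ℂ (1ℂ +ℂ -ℂ ι y)) *ℂ (ι ½ *ℂ (1ℂ +ℂ -ℂ ι x))
      ≈⟨ +-cong (≈-trans (*-cong (one-plus y) (one-plus x)) (≈-sym (ι-* _ _)))
           (≈-trans (*-assoc 𝐢 _ _) (*-congˡ (≈-trans (*-cong (one-minus y) (one-minus x)) (≈-sym (ι-* _ _))))) ⟩
    ι p +ℂ 𝐢 *ℂ ι q
      ≈⟨ pointwiseℂ (λ _ → re-eq p q) (λ _ → im-eq q) ⟩
    gaussian p q ∎
    where
    re-eq : ∀ p q → p ℚ.+ (0ℚ ℚ.* q ℚ.- 1ℚ ℚ.* 0ℚ) ≡ p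
    re-eq = solveℚ 2 (λ p q → p ⊕ (conℚ 0ℚ ⊗ q ⊝ conℚ 1ℚ ⊗ conℚ 0ℚ) ≐ p) refl
    im-eq : ∀ q → 0ℚ ℚ.+ (0ℚ ℚ.* 0ℚ ℚ.+ 1ℚ ℚ.* q) ≡ q
    im-eq = solveℚ 1 (λ q → conℚ 0ℚ ⊕ (conℚ 0ℚ ⊗ conℚ 0ℚ ⊕ conℚ 1ℚ ⊗ q) ≐ q) refl

formula : ℕ → ℂ → ℕ → ℕ → ℂ
formula d n i j = 𝐢ᵘ ^⁻ (i + j) *ℂ [2-2𝐢]ᵘ ^⁻ d *ℂ n
  *ℂ ι (fromℕ (d C i)) *ℂ ι (fromℕ (d C j)) *ℂ ι ₂F₁[- i ,- j ∣- d ∣2]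

module _ (d : ℕ) (n : ℂ) where

  private
    κ = gaussian (+ 1 ℚ./ 4) (+ 1 ℚ./ 4)
    c = κ ^ℂ d *ℂ n
    j⁻ = -ℂ 𝐢

  formula-krawtchouk : ∀ i j → formula d n i j ≈ℂ j⁻ ^ℂ i *ℂ (j⁻ ^ℂ j *ℂ (c *ℂ krawtchouk d i j))
  formula-krawtchouk i j = begin
    j⁻ ^ℂ (i + j) *ℂ κ ^ℂ d *ℂ n *ℂ ν (d C i) *ℂ ν (d C j) *ℂ ι ₂F₁[- i ,- j ∣- d ∣2]
      ≈⟨ *-congʳ (*-congʳ (*-congʳ (*-congʳ (*-congʳ (^-homo-* j⁻ i j))))) ⟩
    j⁻ ^ℂ i *ℂ j⁻ ^ℂ j *ℂ κ ^ℂ d *ℂ n *ℂ ν (d C i) *ℂ ν (d C j) *ℂ ι ₂F₁[- i ,- j ∣- d ∣2]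
      ≈⟨ solve 7 (λ p q k n a b f → p :* q :* k :* n :* a :* b :* f := p :* (q :* (k :* n :* (a :* b :* f)))) ≈-refl
           (j⁻ ^ℂ i) (j⁻ ^ℂ j) (κ ^ℂ d) n (ν (d C i)) (ν (d C j)) (ι ₂F₁[- i ,- j ∣- d ∣2]) ⟩
    j⁻ ^ℂ i *ℂ (j⁻ ^ℂ j *ℂ (c *ℂ (ν (d C i) *ℂ ν (d C j) *ℂ ι ₂F₁[- i ,- j ∣- d ∣2])))
      ≈⟨ *-congˡ (*-congˡ (*-congˡ (≈-trans (≈-sym (≈-trans (ι-* _ _) (*-congʳ (ι-* _ _))))
           (≈-reflexive (cong ι (₂F₁-krawtchouk d i j)))))) ⟩
    j⁻ ^ℂ i *ℂ (j⁻ ^ℂ j *ℂ (c *ℂ krawtchouk d i j)) ∎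

  formula-generating : ∀ a b → ev (suc d) (λ i → ev (suc d) (formula d n i) b) a ≈ℂ rotation a b 0F 0F ^ℂ d *ℂ n
  formula-generating a b = begin
    ev N (λ i → ev N (formula d n i) b) a
      ≈⟨ ev-cong N {s = a} (λ i _ → ≈-trans (ev-cong N {s = b} (λ j _ → formula-krawtchouk i j) ≈-refl)
           (≈-trans (ev-* N (j⁻ ^ℂ i) (λ j → j⁻ ^ℂ j *ℂ (c *ℂ krawtchouk d i j)) b)
           (*-congˡ (≈-trans (ev-scale N j⁻ (λ j → c *ℂ krawtchouk d i j) b) (ev-* N c (krawtchouk d i) (j⁻ *ℂ b)))))) ≈-refl ⟩
    ev N (λ i → j⁻ ^ℂ i *ℂ (c *ℂ ev N (krawtchouk d i) (j⁻ *ℂ b))) a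
      ≈⟨ ≈-trans (ev-scale N j⁻ (λ i → c *ℂ ev N (krawtchouk d i) (j⁻ *ℂ b)) a)
           (ev-* N c (λ i → ev N (krawtchouk d i) (j⁻ *ℂ b)) (j⁻ *ℂ a)) ⟩
    c *ℂ ev N (λ i → ev N (krawtchouk d i) (j⁻ *ℂ b)) (j⁻ *ℂ a)
      ≈⟨ *-congˡ (krawtchouk-generating d (j⁻ *ℂ a) (j⁻ *ℂ b)) ⟩
    κ ^ℂ d *ℂ n *ℂ z ^ℂ d
      ≈⟨ solve 3 (λ k n z → k :* n :* z := k :* z :* n) ≈-refl (κ ^ℂ d) n (z ^ℂ d) ⟩
    κ ^ℂ d *ℂ z ^ℂ d *ℂ n
      ≈⟨ *-congʳ (^-distrib-* κ z d) ⟨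
    (κ *ℂ z) ^ℂ d *ℂ n
      ≈⟨ *-congʳ (^-congˡ d (rotation-corner a b)) ⟨
    rotation a b 0F 0F ^ℂ d *ℂ n ∎
    where
    N = suc d
    z = 1ℂ +ℂ j⁻ *ℂ a +ℂ j⁻ *ℂ b +ℂ -ℂ (j⁻ *ℂ a *ℂ (j⁻ *ℂ b))

  formula≈0ˡ : ∀ i j → d < i → formula d n i j ≈ℂ 0ℂ
  formula≈0ˡ i j d<i = ≈-trans (*-congʳ (≈-trans (*-congʳ (≈-trans (*-congˡ (ν-cong (k>n⇒nCk≡0 d<i))) (zeroʳ _))) (zeroˡ _))) (zeroˡ _)

  formula≈0ʳ : ∀ i j → d < j → formula d n i j ≈ℂ 0ℂ
  formula≈0ʳ i j d<j = ≈-trans (*-congʳ (≈-trans (*-congˡ (ν-cong (k>n⇒nCk≡0 d<j))) (zeroʳ _))) (zeroˡ _)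

ev-shift-cutoff : ∀ r n m f t → n ≤ m → (∀ k → n ≤ k → f k ≈ℂ 0ℂ) → ev (r + m) (shift r f) t ≈ℂ t ^ℂ r *ℂ ev n f t
ev-shift-cutoff r n m f t n≤m h = ≈-trans (ev-shift r m f t) (*-congˡ (ev-extend f t n≤m h))

ev-shift-swap : ∀ r n (f : ℕ → ℕ → ℂ) t k → ev n (λ l → shift r (λ i → f i l) k) t ≈ℂ shift r (λ i → ev n (f i) t) k
ev-shift-swap zero    n f t k       = ≈-refl
ev-shift-swap (suc r) n f t zero    = ev-0 n t
ev-shift-swap (suc r) n f t (suc k) = ev-shift-swap r n f t k

shift² : ℕ → (ℕ → ℕ → ℂ) → ℕ → ℕ → ℂ
shift² r f k l = shift r (λ i → shift r (f i) l) k

-- The factor `(ab)ʳ` moves index `i` to `r + i`. The range `r + m` may exceed `r + n`, because the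
-- idempotents are indexed up to `D` while the formula is supported on indices up to `d`.
ev-shift² : ∀ r m n (f : ℕ → ℕ → ℂ) a b → n ≤ m → (∀ i j → n ≤ i → f i j ≈ℂ 0ℂ) → (∀ i j → n ≤ j → f i j ≈ℂ 0ℂ) →
  ev (r + m) (λ k → ev (r + m) (shift² r f k) b) a ≈ℂ (a *ℂ b) ^ℂ r *ℂ ev n (λ i → ev n (f i) b) a
ev-shift² r m n f a b n≤m rows≈0 columns≈0 = begin
  ev (r + m) (λ k → ev (r + m) (shift² r f k) b) a
    ≈⟨ ev-cong (r + m) (λ k _ → ev-shift-swap r (r + m) (λ i → shift r (f i)) b k) ≈-refl ⟩
  ev (r + m) (shift r (λ i → ev (r + m) (shift r (f i)) b)) a
    ≈⟨ ev-shift r m (λ i → ev (r + m) (shift r (f i)) b) a ⟩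
  a ^ℂ r *ℂ ev m (λ i → ev (r + m) (shift r (f i)) b) a
    ≈⟨ *-congˡ (ev-cong m (λ i _ → ev-shift-cutoff r n m (f i) b n≤m (columns≈0 i)) ≈-refl) ⟩
  a ^ℂ r *ℂ ev m (λ i → b ^ℂ r *ℂ ev n (f i) b) a
    ≈⟨ *-congˡ (ev-* m (b ^ℂ r) (λ i → ev n (f i) b) a) ⟩
  a ^ℂ r *ℂ (b ^ℂ r *ℂ ev m (λ i → ev n (f i) b) a)
    ≈⟨ *-congˡ (*-congˡ (ev-extend (λ i → ev n (f i) b) a n≤m
         (λ i n≤i → ≈-trans (ev-cong n (λ j _ → rows≈0 i j n≤i) ≈-refl) (ev-0 n b)))) ⟩
  a ^ℂ r *ℂ (b ^ℂ r *ℂ ev n (λ i → ev n (f i) b) a)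
    ≈⟨ ≈-trans (≈-sym (*-assoc _ _ _)) (*-congʳ (≈-sym (^-distrib-* a b r))) ⟩
  (a *ℂ b) ^ℂ r *ℂ ev n (λ i → ev n (f i) b) a ∎

module _ {r : ℕ} {u : V D} (lowest : IsLowest r u) (d : ℕ) (d+2r≡D : d + 2 * r ≡ D) where

  inner-product-generating : ∀ l m →
    ev (suc D) (λ i → ev (suc D) (λ j → ⟨ E i · u , Eᵋ j · u ⟩) (ν m)) (ν l) ≈ℂ
    rotation (ν l) (ν m) 0F 0F ^ℂ d *ℂ (ν l *ℂ ν m) ^ℂ r *ℂ ∥ u ∥²
  inner-product-generating l m = begin
    ev (suc D) (λ i → ev (suc D) (λ j → ⟨ E i · u , Eᵋ j · u ⟩) b) a
      -- The form is conjugate-linear in its second argument, so extracting the sum evaluates it at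
      -- `conj b`; this is `b`, a rational.
      ≈⟨ ev-cong (suc D) {g = λ i → ⟨ E i · u , evⱽ (suc D) (λ j → Eᵋ j · u) b ⟩} {s = a} (λ i _ → ≈-trans
           (ev-cong (suc D) {f = λ j → ⟨ E i · u , Eᵋ j · u ⟩} {s = b} (λ _ _ → ≈-refl) (≈-sym (conj-gaussian (fromℕ m) 0ℚ)))
           (≈-sym (⟨⟩-evʳ (suc D) (λ j → Eᵋ j · u) (E i · u) b))) ≈-refl ⟩
    ev (suc D) (λ i → ⟨ E i · u , evⱽ (suc D) (λ j → Eᵋ j · u) b ⟩) a
      ≈⟨ ⟨⟩-evˡ (suc D) (λ i → E i · u) (evⱽ (suc D) (λ j → Eᵋ j · u) b) a ⟨
    ⟨ evⱽ (suc D) (λ i → E i · u) a , evⱽ (suc D) (λ j → Eᵋ j · u) b ⟩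
      ≈⟨ ⟨⟩-cong (≋-trans (E-generating u a) (act-congʳ u (conjugate-diag₂ a)))
                 (≋-trans (Eᵋ-generating u b) (act-congʳ u (conjugate²-diag₂ b))) ⟩
    ⟨ act (rotationX a) u , act (rotationY b) u ⟩
      ≈⟨ ⟨⟩-act (rotationY b) (act (rotationX a) u) u ⟩
    ⟨ act (rotationY b †) (act (rotationX a) u) , u ⟩
      ≈⟨ ⟨⟩-cong (≋-trans (act-congʳ (act (rotationX a) u) (rotationY-† (fromℕ m))) (act-⊡ (rotationY b) (rotationX a) u)) (λ _ → ≈-refl) ⟩
    ⟨ act (rotation a b) u , u ⟩
      ≈⟨ ⟨⟩-act-lowest lowest {d} d+2r≡D (rotation a b) (proj₁ (rotation-corner-inverse l m)) (proj₂ (rotation-corner-inverse l m)) ⟩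
    rotation a b 0F 0F ^ℂ d *ℂ _ ^ℂ r *ℂ ∥ u ∥²
      ≈⟨ *-congʳ (*-congˡ (^-congˡ r (rotation-determinant a b))) ⟩
    rotation a b 0F 0F ^ℂ d *ℂ (a *ℂ b) ^ℂ r *ℂ ∥ u ∥² ∎
    where
    a = ν l
    b = ν m

  private
    -- Of the indices from 0 to `D`, there are `r` below `r`, `d + 1` from `r` to `r + d`, and `r`
    -- above.
    size : suc D ≡ r + (suc d + r)
    size = trans (cong suc (sym d+2r≡D)) (1+d+2r≡r+1+d+r d r)

    index : ∀ {i} → i ≤ d → r + i < r + (suc d + r)
    index i≤d = ℕ.+-monoʳ-< r (ℕ.≤-trans (s≤s i≤d) (ℕ.m≤m+n (suc d) r))

  inner-product-lowest : ∀ i j → i ≤ d → j ≤ d → ⟨ E (r + i) · u , Eᵋ (r + j) · u ⟩ ≈ℂ formula d ∥ u ∥² i j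
  inner-product-lowest i j i≤d j≤d = ≈-trans
    (ev²-injective (r + (suc d + r)) (λ k l → ⟨ E k · u , Eᵋ l · u ⟩) (shift² r (formula d ∥ u ∥²)) equal
      (r + i) (r + j) (index i≤d) (index j≤d))
    (≈-reflexive (trans (shift-+ r _ i) (shift-+ r (formula d ∥ u ∥² i) j)))
    where
    equal : ∀ l m → ev (r + (suc d + r)) (λ k → ev (r + (suc d + r)) (λ l → ⟨ E k · u , Eᵋ l · u ⟩) (ν m)) (ν l) ≈ℂ
      ev (r + (suc d + r)) (λ k → ev (r + (suc d + r)) (shift² r (formula d ∥ u ∥²) k) (ν m)) (ν l)
    equal l m = begin
      ev N (λ k → ev N (λ l → ⟨ E k · u , Eᵋ l · u ⟩) (ν m)) (ν l)
        ≈⟨ ≈-reflexive (cong (λ N → ev N (λ k → ev N (λ l → ⟨ E k · u , Eᵋ l · u ⟩) (ν m)) (ν l)) (sym size)) ⟩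
      ev (suc D) (λ k → ev (suc D) (λ l → ⟨ E k · u , Eᵋ l · u ⟩) (ν m)) (ν l)
        ≈⟨ inner-product-generating l m ⟩
      g ^ℂ d *ℂ (ν l *ℂ ν m) ^ℂ r *ℂ ∥ u ∥²
        ≈⟨ solve 3 (λ a b c → a :* b :* c := b :* (a :* c)) ≈-refl _ _ _ ⟩
      (ν l *ℂ ν m) ^ℂ r *ℂ (g ^ℂ d *ℂ ∥ u ∥²)
        ≈⟨ *-congˡ (formula-generating d ∥ u ∥² (ν l) (ν m)) ⟨
      (ν l *ℂ ν m) ^ℂ r *ℂ ev (suc d) (λ i → ev (suc d) (formula d ∥ u ∥² i) (ν m)) (ν l)
        ≈⟨ ev-shift² r (suc d + r) (suc d) (formula d ∥ u ∥²) (ν l) (ν m) (ℕ.m≤m+n (suc d) r) (formula≈0ˡ d ∥ u ∥²) (formula≈0ʳ d ∥ u ∥²) ⟨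
      ev N (λ k → ev N (shift² r (formula d ∥ u ∥²) k) (ν m)) (ν l) ∎
      where
      N = r + (suc d + r)
      g = rotation (ν l) (ν m) 0F 0F

-- The symmetry given by `P₁`

norm-act-P₁ : ∀ (v w : V D) → ⟨ act P₁ v , act P₁ w ⟩ ≈ℂ (1ℂ +ℂ 1ℂ) ^ℂ D *ℂ ⟨ v , w ⟩
norm-act-P₁ {D} v w = begin
  ⟨ act P₁ v , act P₁ w ⟩                        ≈⟨ ⟨⟩-act P₁ (act P₁ v) w ⟩
  ⟨ act (P₁ †) (act P₁ v) , w ⟩                  ≈⟨ ⟨⟩-cong scaled (λ _ → ≈-refl) ⟩
  ⟨ (1ℂ +ℂ 1ℂ) ^ℂ D •ⱽ v , w ⟩                   ≈⟨ ⟨⟩-•ˡ ((1ℂ +ℂ 1ℂ) ^ℂ D) v w ⟩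
  (1ℂ +ℂ 1ℂ) ^ℂ D *ℂ ⟨ v , w ⟩                   ∎
  where
  entries : ∀ a b → ((P₁ †) ⊡ P₁) a b ≈ℂ (1ℂ +ℂ 1ℂ) *ℂ diag₂ 1ℂ 1ℂ a b
  entries 0F 0F = pointwiseℂ (λ _ → refl) (λ _ → refl)
  entries 0F 1F = pointwiseℂ (λ _ → refl) (λ _ → refl)
  entries 1F 0F = pointwiseℂ (λ _ → refl) (λ _ → refl)
  entries 1F 1F = pointwiseℂ (λ _ → refl) (λ _ → refl)
  scaled : act (P₁ †) (act P₁ v) ≋ (1ℂ +ℂ 1ℂ) ^ℂ D •ⱽ v
  scaled = ≋-trans (act-⊡ (P₁ †) P₁ v) (≋-trans (act-congʳ v entries)
    (≋-trans (act-scalar (1ℂ +ℂ 1ℂ) (diag₂ 1ℂ 1ℂ) v) (λ y → *-congˡ (act-I v y))))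

P₁³ : ∀ (v : V D) → act P₁ (act P₁ (act P₁ v)) ≋ (Unit.val [2-2𝐢]ᵘ) ^ℂ D •ⱽ v
P₁³ v = ≋-trans (act-congˡ P₁ (act-⊡ P₁ P₁ v)) (≋-trans (act-⊡ P₁ (P₁ ⊡ P₁) v) (≋-trans (act-congʳ v entries)
  (≋-trans (act-scalar (Unit.val [2-2𝐢]ᵘ) (diag₂ 1ℂ 1ℂ) v) (λ y → *-congˡ (act-I v y)))))
  where
  entries : ∀ a b → (P₁ ⊡ (P₁ ⊡ P₁)) a b ≈ℂ Unit.val [2-2𝐢]ᵘ *ℂ diag₂ 1ℂ 1ℂ a b
  entries 0F 0F = pointwiseℂ (λ _ → refl) (λ _ → refl)
  entries 0F 1F = pointwiseℂ (λ _ → refl) (λ _ → refl)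
  entries 1F 0F = pointwiseℂ (λ _ → refl) (λ _ → refl)
  entries 1F 1F = pointwiseℂ (λ _ → refl) (λ _ → refl)

·-• : ∀ (M : Mat D) c v → M · (c •ⱽ v) ≋ c •ⱽ (M · v)
·-• M c v y = ≈-trans
  (sumX-cong (λ z → solve 3 (λ m c v → m :* (c :* v) := c :* (m :* v)) ≈-refl (M y z) c (v z)))
  (sumX-scale c (λ z → M y z *ℂ v z))

-- A consequence of the other two intertwining relations: after two more applications of `P₁` the
-- left side carries the cube, a scalar that commutes with `E* i`, and `P₁-E` and `P₁-Eᵋ` then
-- apply.
P₁-E* : ∀ i (v : V D) → act P₁ (E* i · v) ≋ Eᵋ i · act P₁ v
P₁-E* {D} i v = P₁-injective (P₁-injective cubed)
  where
  c = (Unit.val [2-2𝐢]ᵘ) ^ℂ D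
  cubed : act P₁ (act P₁ (act P₁ (E* i · v))) ≋ act P₁ (act P₁ (Eᵋ i · act P₁ v))
  cubed = ≋-trans (P₁³ (E* i · v)) (≋-trans (≋-sym (·-• (E* i) c v)) (≋-trans (≋-sym (·-congˡ (E* i) (P₁³ v)))
    (≋-trans (≋-sym (P₁-E i (act P₁ (act P₁ v)))) (act-congˡ P₁ (≋-sym (P₁-Eᵋ i (act P₁ v)))))))

-- The factors are quarter turns about the axes of `A` and `A*`; composing quarter turns about
-- perpendicular axes gives a third of a turn. The scalar `1 - 𝐢` adjusts the normalisation to that
-- of `P₁`.
P₁-factorisation : ∀ (v : V D) →
  act P₁ v ≋ (1ℂ -ℂ 𝐢) ^ℂ D •ⱽ act (conjugate (diag₂ 1ℂ 𝐢)) (act (diag₂ 1ℂ 𝐢) v)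
P₁-factorisation v = ≋-trans (act-congʳ v entries)
  (≋-trans (act-scalar (1ℂ -ℂ 𝐢) (conjugate (diag₂ 1ℂ 𝐢) ⊡ diag₂ 1ℂ 𝐢) v)
    (λ y → *-congˡ (≈-sym (act-⊡ (conjugate (diag₂ 1ℂ 𝐢)) (diag₂ 1ℂ 𝐢) v y))))
  where
  entries : ∀ a b → P₁ a b ≈ℂ (1ℂ -ℂ 𝐢) *ℂ (conjugate (diag₂ 1ℂ 𝐢) ⊡ diag₂ 1ℂ 𝐢) a b
  entries 0F 0F = pointwiseℂ (λ _ → refl) (λ _ → refl)
  entries 0F 1F = pointwiseℂ (λ _ → refl) (λ _ → refl)
  entries 1F 0F = pointwiseℂ (λ _ → refl) (λ _ → refl)
  entries 1F 1F = pointwiseℂ (λ _ → refl) (λ _ → refl)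

-- `formula` is linear in the squared norm, and `P₁` multiplies every inner product by the same
-- invertible `2ᴰ`, which therefore cancels.
transfer : ∀ {d i j} (u v w : V D) →
  ⟨ act P₁ v , act P₁ w ⟩ ≈ℂ formula d ∥ act P₁ u ∥² i j → ⟨ v , w ⟩ ≈ℂ formula d ∥ u ∥² i j
transfer {D} {d} {i} {j} u v w eq = cancel halved (begin
  2ᴰ *ℂ ⟨ v , w ⟩                    ≈⟨ norm-act-P₁ v w ⟨
  ⟨ act P₁ v , act P₁ w ⟩            ≈⟨ eq ⟩
  formula d ∥ act P₁ u ∥² i j        ≈⟨ *-congʳ (*-congʳ (*-congʳ (*-congˡ (norm-act-P₁ u u)))) ⟩
  formula d (2ᴰ *ℂ ∥ u ∥²) i j       ≈⟨ solve 6 (λ p t n a b f → p :* (t :* n) :* a :* b :* f := t :* (p :* n :* a :* b :* f)) ≈-refl _ 2ᴰ ∥ u ∥² _ _ _ ⟩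
  2ᴰ *ℂ formula d ∥ u ∥² i j         ∎)
  where
  2ᴰ = (1ℂ +ℂ 1ℂ) ^ℂ D
  halved : ι ½ ^ℂ D *ℂ 2ᴰ ≈ℂ 1ℂ
  halved = ≈-trans (≈-sym (^-distrib-* (ι ½) (1ℂ +ℂ 1ℂ) D))
    (≈-trans (^-congˡ D (pointwiseℂ (λ _ → refl) (λ _ → refl))) (1^n≈1 D))

-- Modules

T-projection : ∀ {B : Mat D} → T B → ∀ i → T (projection B i)
T-projection {D} {B} T-B i = product (others D i)
  where
  T-factor : ∀ j → T (factor B i j)
  T-factor j = scale _ (resp (λ y z → ≈-trans (+-congˡ (solve 1 (λ x → :- :1 :* x := :- x) ≈-refl _)) (≈-sym (minus (B y z) _)))
    (add T-B (scale (-ℂ 1ℂ) (scale (ι (θ D j)) one))))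
  product : ∀ js → T (∏ᴹ (map (factor B i) js))
  product []       = one
  product (j ∷ js) = mul (T-factor j) (product js)

module _ (W : Subspace D) (isModule : IsModule W) where
  open Subspace W using (mem-resp; mem-0; mem-+; mem-•)

  mem-E : ∀ i {v} → v ∈ˢ W → (E i · v) ∈ˢ W
  mem-E i v∈W = isModule (E i) (T-projection gen-A i) _ v∈W

  mem-E* : ∀ i {v} → v ∈ˢ W → (E* i · v) ∈ˢ W
  mem-E* i {v} v∈W = mem-resp (E*-projection i v) (isModule (projection A* i) (T-projection gen-A* i) v v∈W)

  mem-evⱽ : ∀ n (v : ℕ → V D) t → (∀ k → v k ∈ˢ W) → evⱽ n v t ∈ˢ W
  mem-evⱽ zero    v t h = mem-0
  mem-evⱽ (suc n) v t h = mem-+ (h 0) (mem-• t (mem-evⱽ n (v ∘ suc) t (h ∘ suc)))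

  mem-P₁ : ∀ {v} → v ∈ˢ W → act P₁ v ∈ˢ W
  mem-P₁ {v} v∈W = mem-resp (≋-sym (P₁-factorisation v)) (mem-• ((1ℂ -ℂ 𝐢) ^ℂ D)
    (mem-resp (E-generating _ 𝐢) (mem-evⱽ (suc D) (λ k → E k · act (diag₂ 1ℂ 𝐢) v) 𝐢 (λ k → mem-E k
      (mem-resp (E*-generating v 𝐢) (mem-evⱽ (suc D) (λ k → E* k · v) 𝐢 (λ k → mem-E* k v∈W)))))))

  E⇒E* : ∀ {r u} → u ∈ E r ⟨ W ⟩ → act P₁ u ∈ E* r ⟨ W ⟩
  E⇒E* {r} (w , w∈W , eq) = act P₁ w , mem-P₁ w∈W , ≋-trans (act-congˡ P₁ eq) (P₁-E r w)

  Eᵋ⇒E : ∀ {r u} → u ∈ Eᵋ r ⟨ W ⟩ → act P₁ u ∈ E r ⟨ W ⟩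
  Eᵋ⇒E {r} (w , w∈W , eq) = act P₁ w , mem-P₁ w∈W , ≋-trans (act-congˡ P₁ eq) (P₁-Eᵋ r w)

  -- Minimality of `r` refutes `E*W≢0 W i`, itself a negation, so it gives vanishing only under a
  -- double negation, which `stable` removes.
  E*W≈0 : ∀ {r} → IsEndpoint W r → ∀ {i} → i < r → ∀ {v} → v ∈ˢ W → E* i · v ≋ 0ⱽ
  E*W≈0 ((r≤D , _) , least) {i} i<r {v} v∈W y = stable λ nonzero →
    ℕ.<⇒≱ i<r (least i (ℕ.≤-trans (ℕ.<⇒≤ i<r) r≤D) (λ zero → nonzero (zero (E* i · v) (v , v∈W , λ _ → ≈-refl) y)))

  -- `A · u` lies in `W`, so its part of weight `r - 1` is zero. At that weight only the lowering
  -- half of `A` contributes, since the raising half would need entries of `u` at weight `r - 2`; at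
  -- other weights `L u` vanishes by support.
  endpoint-lowest : ∀ {r u} → IsEndpoint W r → u ∈ E* r ⟨ W ⟩ → IsLowest r u
  endpoint-lowest {r} {u} endpoint (w , w∈W , u≋) = record { support = support ; lowered = λ y → lowered y (suc (weight y) ℕ.≟ r) }
    where
    entry : ∀ i (v : V D) y → (E* i · v) y ≈ℂ indicator (does (weight y ℕ.≟ i)) *ℂ v y
    entry i = diag-· (λ y → if does (∂ 𝟎 y ℕ.≟ i) then 1ℂ else 0ℂ)
    u∈W : u ∈ˢ W
    u∈W = mem-resp (≋-sym u≋) (mem-E* r w∈W)
    support : ∀ y → weight y ≢ r → u y ≈ℂ 0ℂ
    support y w≢r = ≈-trans (u≋ y) (≈-trans (entry r w y)
      (≈-trans (*-congʳ (≈-reflexive (cong indicator (dec-false (weight y ℕ.≟ r) w≢r)))) (zeroˡ (w y))))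
    lowered : ∀ y → Dec (suc (weight y) ≡ r) → lower 1 u y ≈ℂ 0ℂ
    lowered y (no  w≢r) = lower≈0 u y (λ z eq → support z (λ z≡r → w≢r (trans (sym eq) z≡r)))
    lowered y (yes w≡r) = begin
      lower 1 u y                                              ≈⟨ +-identityʳ _ ⟨
      lower 1 u y +ℂ 0ℂ                                        ≈⟨ +-congˡ (raise≈0 u y (λ z eq → support z (λ z≡r →
                                                                    ℕ.<⇒≢ (ℕ.<-trans (ℕ.n<1+n (weight y)) (ℕ.n<1+n _)) (trans (sym eq) (cong suc (trans z≡r (sym w≡r))))))) ⟨
      lower 1 u y +ℂ raise u y                                 ≈⟨ A-· u y ⟨
      (A · u) y                                                ≈⟨ *-identityˡ _ ⟨
      1ℂ *ℂ (A · u) y                                          ≈⟨ *-congʳ (≈-reflexive (cong indicator (dec-true (weight y ℕ.≟ weight y) refl))) ⟨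
      indicator (does (weight y ℕ.≟ weight y)) *ℂ (A · u) y    ≈⟨ entry (weight y) (A · u) y ⟨
      (E* (weight y) · (A · u)) y                              ≈⟨ E*W≈0 endpoint (ℕ.≤-reflexive w≡r) (isModule A gen-A u u∈W) y ⟩
      0ℂ                                                       ∎

theorem11p8 : (D : ℕ) → 1 ≤ D →
    (W : Subspace D) → IsIrreducible W →
    (r d : ℕ) → IsEndpoint W r → IsDiameter W d → d + 2 * r ≡ D →
    (i j : ℕ) → i ≤ d → j ≤ d →
    (u u* uᵋ : V D) →
    ¬ (u ≋ 0ⱽ) → u ∈ E r ⟨ W ⟩ →
    ¬ (u* ≋ 0ⱽ) → u* ∈ E* r ⟨ W ⟩ →
    ¬ (uᵋ ≋ 0ⱽ) → uᵋ ∈ Eᵋ r ⟨ W ⟩ →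
    let rhs = λ (v : V D) →
          𝐢ᵘ ^⁻ (i + j) *ℂ [2-2𝐢]ᵘ ^⁻ d *ℂ ∥ v ∥²
            *ℂ ι (fromℕ (d C i)) *ℂ ι (fromℕ (d C j))
            *ℂ ι ₂F₁[- i ,- j ∣- d ∣2]
    in (⟨ E (r + i) · u* , Eᵋ (r + j) · u* ⟩ ≈ℂ rhs u*)
     × (⟨ E* (r + i) · uᵋ , E (r + j) · uᵋ ⟩ ≈ℂ rhs uᵋ)
     × (⟨ Eᵋ (r + i) · u , E* (r + j) · u ⟩ ≈ℂ rhs u)
theorem11p8 D _ W irreducible r d endpoint _ d+2r≡D i j i≤d j≤d u u* uᵋ _ u∈ _ u*∈ _ uᵋ∈ =
  part-i u*∈ , part-ii uᵋ∈ , part-iii u∈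
  where
  isModule = IsIrreducible.isModule irreducible
  part-i : ∀ {v} → v ∈ E* r ⟨ W ⟩ → ⟨ E (r + i) · v , Eᵋ (r + j) · v ⟩ ≈ℂ formula d ∥ v ∥² i j
  part-i v∈ = inner-product-lowest (endpoint-lowest W isModule {r} endpoint v∈) d d+2r≡D i j i≤d j≤d
  part-iii : ∀ {v} → v ∈ E r ⟨ W ⟩ → ⟨ Eᵋ (r + i) · v , E* (r + j) · v ⟩ ≈ℂ formula d ∥ v ∥² i j
  part-iii {v} v∈ = transfer {d = d} {i} {j} v _ _ (≈-trans
    (⟨⟩-cong (P₁-Eᵋ (r + i) v) (P₁-E* (r + j) v)) (part-i (E⇒E* W isModule {r} v∈)))
  -- One application of `P₁` leads from (ii) to (iii), and a second one from there to (i).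
  part-ii : ∀ {v} → v ∈ Eᵋ r ⟨ W ⟩ → ⟨ E* (r + i) · v , E (r + j) · v ⟩ ≈ℂ formula d ∥ v ∥² i j
  part-ii {v} v∈ = transfer {d = d} {i} {j} v _ _ (≈-trans
    (⟨⟩-cong (P₁-E* (r + i) v) (P₁-E (r + j) v)) (part-iii (Eᵋ⇒E W isModule {r} v∈)))
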